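{- Let $q$ be an odd prime power, $n\geq 2$, $V=V(2n+1,q)$, and let $\eta$ be a non-singular quadratic form on $V$. As $\varphi$ ranges over all non-zero alternating bilinear forms on $V$, the maximum number of $2$-dimensional subspaces $\ell$ of $V$ which are simultaneously totally singular for $\eta$ and totally isotropic for $\varphi$ is \[ f_{\max}=\frac{(q^{n-1}-1)}{(q-1)(q^2-1)}\left(q^{3n-2}+q^{3n-3}-q^{3n-4}+q^{2n}-q^{n-1}-1\right). \]
   Context: A subspace $X\le V$ is totally singular for $\eta$ if $\eta(x)=0$ for all $x\in X$, and totally isotropic for an alternating bilinear form $\varphi$ if $\varphi(x,y)=0$ for all $x,y\in X$. (Since $\dim V$ is odd, every alternating form on $V$ is degenerate.) -}

module Defs where

open import Level using (0ℓ)
open import Data.Nat as ℕ using (ℕ; zero; suc; _∸_; _^_; _≥_)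
open import Data.Nat.Primality using (Prime)
open import Data.Fin using (Fin; zero; suc)
open import Data.Product using (Σ; ∃; _×_; _,_; ∃-syntax)
open import Relation.Binary.PropositionalEquality using (_≡_; _≢_)
open import Relation.Nullary using (¬_)
open import Algebra.Structures using (IsCommutativeRing)
open import Function.Bundles using (_↔_)

record FiniteField (q : ℕ) : Set₁ where
  infixl 6 _+_ _-_
  infixl 7 _*_
  field
    Carrier : Set
    _+_ _*_ : Carrier → Carrier → Carrier
    -_      : Carrier → Carrier
    0# 1#   : Carrier
    isCommutativeRing : IsCommutativeRing _≡_ _+_ _*_ -_ 0# 1#
    0≢1     : 0# ≢ 1#
    inverse : ∀ x → x ≢ 0# → ∃[ y ] (x * y ≡ 1#)
    enumeration : Fin q ↔ Carrier

  _-_ : Carrier → Carrier → Carrier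
  x - y = x + (- y)

OddPrimePower : ℕ → Set
OddPrimePower q = ∃[ p ] ∃[ k ] (Prime p × p ≢ 2 × k ≥ 1 × q ≡ p ^ k)

module _ {q : ℕ} (𝔽 : FiniteField q) where
  open FiniteField 𝔽

  Vec : ℕ → Set
  Vec m = Fin m → Carrier

  sumF : ∀ {m} → (Fin m → Carrier) → Carrier
  sumF {zero}  f = 0#
  sumF {suc m} f = f zero + sumF (λ i → f (suc i))

  _≈V_ : ∀ {m} → Vec m → Vec m → Set
  x ≈V y = ∀ i → x i ≡ y i

  0V : ∀ {m} → Vec m
  0V _ = 0#

  _+V_ : ∀ {m} → Vec m → Vec m → Vec m
  (x +V y) i = x i + y i

  _·V_ : ∀ {m} → Carrier → Vec m → Vec m
  (a ·V x) i = a * x i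

  -- A quadratic form on F^m: a homogeneous polynomial of degree 2,
  --   η(x) = Σ_{i ≤ j} c_{ij} x_i x_j,
  -- given by its (upper-triangular) coefficients c_{ij}, i ≤ j.
  record QuadraticForm (m : ℕ) : Set where
    field
      coeff : Fin m → Fin m → Carrier
    eval : Vec m → Carrier
    eval x = sumF (λ i → sumF (λ j → upper i j * (x i * x j)))
      where
      upper : Fin m → Fin m → Carrier
      upper i j with Data.Fin._≤?_ i j
      ... | Relation.Nullary.yes _ = coeff i j
      ... | Relation.Nullary.no  _ = 0#
    polar : Vec m → Vec m → Carrier
    polar x y = eval (x +V y) - eval x - eval y

  NonSingular : ∀ {m} → QuadraticForm m → Set
  NonSingular {m} η =
    ∀ (x : Vec m) → QuadraticForm.eval η x ≡ 0#
                  → (∀ y → QuadraticForm.polar η x y ≡ 0#) → x ≈V 0V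

  record BilinearForm (m : ℕ) : Set where
    field
      matrix : Fin m → Fin m → Carrier
    eval : Vec m → Vec m → Carrier
    eval x y = sumF (λ i → sumF (λ j → matrix i j * (x i * y j)))

  Alternating : ∀ {m} → BilinearForm m → Set
  Alternating {m} φ = ∀ (x : Vec m) → BilinearForm.eval φ x x ≡ 0#

  NonZeroForm : ∀ {m} → BilinearForm m → Set
  NonZeroForm {m} φ = ∃[ x ] ∃[ y ] (BilinearForm.eval φ x y ≢ 0#)

  -- 2-dimensional subspaces, presented by a basis (u , v);
  -- two bases present the same subspace iff their spans coincide.

  _∈⟨_,_⟩ : ∀ {m} → Vec m → Vec m → Vec m → Set
  x ∈⟨ u , v ⟩ = ∃[ a ] ∃[ b ] (x ≈V ((a ·V u) +V (b ·V v)))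

  LinIndep : ∀ {m} → Vec m → Vec m → Set
  LinIndep u v = ∀ a b → ((a ·V u) +V (b ·V v)) ≈V 0V → (a ≡ 0#) × (b ≡ 0#)

  SameSpan : ∀ {m} → Vec m × Vec m → Vec m × Vec m → Set
  SameSpan (u , v) (u' , v') =
    (u' ∈⟨ u , v ⟩ × v' ∈⟨ u , v ⟩) × (u ∈⟨ u' , v' ⟩ × v ∈⟨ u' , v' ⟩)

  TotallySingular : ∀ {m} → QuadraticForm m → Vec m → Vec m → Set
  TotallySingular η u v = ∀ x → x ∈⟨ u , v ⟩ → QuadraticForm.eval η x ≡ 0#

  TotallyIsotropic : ∀ {m} → BilinearForm m → Vec m → Vec m → Set
  TotallyIsotropic φ u v =
    ∀ x y → x ∈⟨ u , v ⟩ → y ∈⟨ u , v ⟩ → BilinearForm.eval φ x y ≡ 0#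

  GoodBasis : ∀ {m} → QuadraticForm m → BilinearForm m → Set
  GoodBasis {m} η φ = Σ (Vec m × Vec m) λ { (u , v) →
    LinIndep u v × TotallySingular η u v × TotallyIsotropic φ u v }

  basis : ∀ {m} {η : QuadraticForm m} {φ : BilinearForm m} →
          GoodBasis η φ → Vec m × Vec m
  basis (b , _) = b

  -- "there are at most N such subspaces": a map on bases into Fin N
  -- which is well defined and injective on subspaces
  AtMost : ∀ {m} → QuadraticForm m → BilinearForm m → ℕ → Set
  AtMost η φ N = Σ (GoodBasis η φ → Fin N) λ f →
      (∀ g g' → SameSpan (basis g) (basis g') → f g ≡ f g')
    × (∀ g g' → f g ≡ f g' → SameSpan (basis g) (basis g'))

  Exactly : ∀ {m} → QuadraticForm m → BilinearForm m → ℕ → Set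
  Exactly η φ N = Σ (GoodBasis η φ → Fin N) λ f →
      (∀ g g' → SameSpan (basis g) (basis g') → f g ≡ f g')
    × (∀ g g' → f g ≡ f g' → SameSpan (basis g) (basis g'))
    × (∀ k → ∃[ g ] (f g ≡ k))

-- f_max = (q^{n-1} - 1) / ((q-1)(q^2-1)) ·
--         (q^{3n-2} + q^{3n-3} - q^{3n-4} + q^{2n} - q^{n-1} - 1),
-- given as numerator and denominator (natural-number arithmetic; all
-- truncated subtractions are genuine for q ≥ 3, n ≥ 2).

fmax-numer : ℕ → ℕ → ℕ
fmax-numer q n =
  (q ^ (n ∸ 1) ∸ 1) ℕ.*
  ((q ^ (3 ℕ.* n ∸ 2) ℕ.+ q ^ (3 ℕ.* n ∸ 3) ℕ.+ q ^ (2 ℕ.* n))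
     ∸ (q ^ (3 ℕ.* n ∸ 4) ℕ.+ q ^ (n ∸ 1) ℕ.+ 1))

fmax-denom : ℕ → ℕ
fmax-denom q = (q ∸ 1) ℕ.* (q ^ 2 ∸ 1)

{-# OPTIONS --safe #-}
module Submission where

-- Write φ(x, y) = b(Tx, y), where b is the polar form of η and T is skew, and count the pairs (x, y) that span
-- totally singular φ-isotropic subspaces. For a singular x ≠ 0 the admissible y are the zeros of η on ⟨x, Tx⟩^⊥:
-- there are q^{2n−1} of them if x is an eigenvector of T, q^{2n−2} if it is not but Tx is singular ("x is
-- tangent"), and otherwise at most q^{2n−2} + q^n − q^{n−1}, by the Cauchy-Schwarz inequality for the sizes of the
-- level sets of η. So singular eigenvectors in excess of q^{2n−2} must be compensated by tangent vectors. The sum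
-- of two orthogonal singular eigenvectors with different eigenvalues is tangent, and this suffices unless ker T
-- has more than q^{2n−2} zeros. In that case T has rank 2, the radical of ker T is a line R, and the singular
-- vectors of R^⊥ outside ker T are tangent. Equality holds for φ = b(u, ·) ∧ b(v, ·) with u ≠ 0 in a maximal
-- totally singular subspace W and v in W^⊥ but not in W.

open import Defs
open import Level using (0ℓ)
open import Algebra.Bundles using (CommutativeRing)
import Algebra.Solver.Ring as RingSolver
open import Algebra.Solver.Ring.AlmostCommutativeRing using (fromCommutativeRing; _-Raw-AlmostCommutative⟶_)
open import Data.Empty using (⊥-elim)
open import Data.Fin as Fin using (Fin; zero; suc)
import Data.Fin.Properties as Fin
open import Data.Integer as ℤ using (ℤ; -[1+_])
import Data.Integer.Properties as ℤ
open import Data.List as List using (List; []; _∷_)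
import Data.List.Membership.Propositional as List
import Data.List.Membership.Propositional.Properties as List
open import Data.List.Relation.Unary.All as All using (All; []; _∷_)
open import Data.List.Relation.Unary.Any using (here; there)
open import Data.Maybe using (Maybe; just; nothing)
open import Data.Nat as ℕ using (ℕ; zero; suc; _≥_)
open import Data.Nat.Divisibility using (_∣_; divides; ∣1⇒≡1)
open import Data.Nat.Primality using (prime[2]; euclidsLemma; prime⇒irreducible)
import Data.Nat.Properties as ℕ
open import Data.Nat.Tactic.RingSolver using (solve-∀)
open import Data.Product using (_×_; _,_; proj₁; proj₂; ∃-syntax; uncurry)
open import Data.Product.Function.NonDependent.Propositional using (_×-↔_)
import Data.Sign as Sign
open import Data.Sum using (_⊎_; inj₁; inj₂)
open import Data.Unit using (⊤; tt)
open import Data.Vec as Vec using ([]; _∷_; lookup; tabulate)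
import Data.Vec.Properties as Vec
open import Function using (_∘_)
open import Function.Bundles using (_↔_; Inverse; mk↔ₛ′)
open import Function.Construct.Composition using (_↔-∘_)
open import Function.Construct.Identity using (↔-id)
open import Relation.Binary.PropositionalEquality using (_≡_; _≢_; refl; sym; trans; cong; cong₂; subst; module ≡-Reasoning)
open import Relation.Nullary using (¬_; Dec; yes; no)
open import Relation.Nullary.Decidable using (_×-dec_; ¬?; map′; _→-dec_; decidable-stable)
open import Relation.Unary using (Decidable)

-- Counting in finite types

-- The exchange rate behind the compensation, with Q = q^(n-1): measured against the bound Q² + (q -
-- 1)Q for a generic x, a singular eigenvector gains (q - 1)Q(Q - 1) and a tangent vector loses (q -
-- 1)Q. Beyond an allowance of Q² - 1 non-zero singular eigenvectors, each further one must
-- therefore be paid for by Q - 1 tangent vectors. This is what sums provide: if v is orthogonal to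
-- at least Q singular vectors w of another eigenspace, including w = 0, it yields at least Q - 1
-- tangent vectors v + w. A kernel with more than Q² zeros exhausts the allowance by itself, hence
-- its separate treatment. In the extremal example the surplus is (q - 1)Q and there are exactly (q
-- - 1)Q(Q - 1) tangent vectors, so the rate is met with equality. No classification of quadratic
-- forms is used. Sizes of subspaces replace dimensions, orthogonal complements are measured by
-- double counting, and the number of zeros is controlled by the second moment of the level sizes
-- together with the fact that sizes are powers of q. Inequalities are stated in ℕ with subtracted
-- terms moved across.

module Counting where
  open import Data.Nat hiding (_≟_)
  open import Data.Nat.Properties hiding (_≟_)
  open import Algebra.Properties.CommutativeMonoid.Sum +-0-commutativeMonoid
    using (sum; ∑-distrib-+; ∑-comm; sum-cong-≗)
  open import Algebra.Properties.Semiring.Sum +-*-semiring using (*-distribˡ-sum)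

  record Finite (X : Set) : Set where
    field
      card : ℕ
      enum : Fin card ↔ X
    open Inverse enum public using (to; from)

  ∣_∣ : (X : Set) → {{Finite X}} → ℕ
  ∣ X ∣ {{fin}} = Finite.card fin

  instance
    Fin-finite : ∀ {n} → Finite (Fin n)
    Fin-finite {n} = record { card = n ; enum = ↔-id (Fin n) }

  module _ {X : Set} {{fX : Finite X}} where
    open Finite fX using (to; from; enum)

    to∘from : ∀ x → to (from x) ≡ x
    to∘from x = Inverse.inverseˡ enum refl

    from∘to : ∀ i → from (to i) ≡ i
    from∘to i = Inverse.inverseʳ enum refl

    from-injective : ∀ {x y : X} → from x ≡ from y → x ≡ y
    from-injective {x} {y} e = trans (sym (to∘from x)) (trans (cong to e) (to∘from y))

    infix 4 _≟_
    abstract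
      _≟_ : (x y : X) → Dec (x ≡ y)
      x ≟ y = map′ from-injective (cong from) (from x Fin.≟ from y)

      any? : {P : X → Set} → Decidable P → Dec (∃[ x ] P x)
      any? {P} P? = map′ (λ (i , p) → to i , p)
                     (λ (x , p) → from x , subst P (sym (to∘from x)) p) (Fin.any? (P? ∘ to))

      all? : {P : X → Set} → Decidable P → Dec (∀ x → P x)
      all? {P} P? = map′ (λ f x → subst P (to∘from x) (f (from x))) (λ f i → f (to i)) (Fin.all? (P? ∘ to))

      search : {P : X → Set} → Decidable P → ¬ (∀ x → ¬ P x) → ∃[ x ] P x
      search P? ¬none with any? P?
      ... | yes found = found
      ... | no none   = ⊥-elim (¬none λ x p → none (x , p))

      ∑ : (X → ℕ) → ℕ
      ∑ f = sum (f ∘ to)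

      ∑-cong : ∀ {f g : X → ℕ} → (∀ x → f x ≡ g x) → ∑ f ≡ ∑ g
      ∑-cong e = sum-cong-≗ (e ∘ to)

      ∑-+ : (f g : X → ℕ) → ∑ (λ x → f x + g x) ≡ ∑ f + ∑ g
      ∑-+ f g = ∑-distrib-+ (f ∘ to) (g ∘ to)

      ∑-* : (c : ℕ) (f : X → ℕ) → ∑ (λ x → c * f x) ≡ c * ∑ f
      ∑-* c f = sym (*-distribˡ-sum c (f ∘ to))

      ∑-mono : ∀ {f g : X → ℕ} → (∀ x → f x ≤ g x) → ∑ f ≤ ∑ g
      ∑-mono {f} {g} h = go (h ∘ to)
        where
        go : ∀ {n} {f g : Fin n → ℕ} → (∀ i → f i ≤ g i) → sum f ≤ sum g
        go {zero}  h = z≤n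
        go {suc n} h = +-mono-≤ (h zero) (go (h ∘ suc))

      ∑-const : ∀ c → ∑ (λ _ → c) ≡ ∣ X ∣ * c
      ∑-const c = go ∣ X ∣
        where
        go : ∀ n → sum {n} (λ _ → c) ≡ n * c
        go zero    = refl
        go (suc n) = cong (c +_) (go n)

      ∑-single : (f : X → ℕ) (a : X) → (∀ x → x ≢ a → f x ≡ 0) → ∑ f ≡ f a
      ∑-single f a h = trans (go (f ∘ to) (from a) λ j j≢ → h (to j) λ e → j≢ (trans (sym (from∘to j)) (cong from e)))
                             (cong f (to∘from a))
        where
        zeros : ∀ {n} (f : Fin n → ℕ) → (∀ i → f i ≡ 0) → sum f ≡ 0
        zeros {zero}  f h = refl
        zeros {suc n} f h = cong₂ _+_ (h zero) (zeros (f ∘ suc) (h ∘ suc))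
        go : ∀ {n} (f : Fin n → ℕ) (i : Fin n) → (∀ j → j ≢ i → f j ≡ 0) → sum f ≡ f i
        go {suc n} f zero    h =
          trans (cong (f zero +_) (zeros (f ∘ suc) λ j → h (suc j) λ ())) (+-identityʳ _)
        go {suc n} f (suc i) h =
          trans (cong (_+ sum (f ∘ suc)) (h zero λ ()))
                (go (f ∘ suc) i λ j j≢ → h (suc j) (j≢ ∘ Fin.suc-injective))

  abstract
    ∑-swap : ∀ {X Y : Set} {{_ : Finite X}} {{_ : Finite Y}} (f : X → Y → ℕ) →
             ∑ (λ x → ∑ (f x)) ≡ ∑ (λ y → ∑ (λ x → f x y))
    ∑-swap {{fX}} {{fY}} f = ∑-comm (λ i j → f (Finite.to fX i) (Finite.to fY j))

  [_] : ∀ {A : Set} → Dec A → ℕ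
  [ yes _ ] = 1
  [ no  _ ] = 0

  []-yes : ∀ {A : Set} (d : Dec A) → A → [ d ] ≡ 1
  []-yes (yes _) a = refl
  []-yes (no ¬a) a = ⊥-elim (¬a a)

  []-no : ∀ {A : Set} (d : Dec A) → ¬ A → [ d ] ≡ 0
  []-no (yes a) ¬a = ⊥-elim (¬a a)
  []-no (no _)  ¬a = refl

  []-× : ∀ {A B : Set} (d : Dec A) (e : Dec B) → [ d ×-dec e ] ≡ [ d ] * [ e ]
  []-× (yes a) (yes b) = refl
  []-× (yes a) (no ¬b) = refl
  []-× (no ¬a) e       = refl

  []-mono : ∀ {A B : Set} (d : Dec A) (e : Dec B) → (A → B) → [ d ] ≤ [ e ]
  []-mono (yes a) e f = ≤-reflexive (sym ([]-yes e (f a)))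
  []-mono (no _)  e f = z≤n

  []-cong : ∀ {A B : Set} (d : Dec A) (e : Dec B) → (A → B) → (B → A) → [ d ] ≡ [ e ]
  []-cong d e f g = ≤-antisym ([]-mono d e f) ([]-mono e d g)

  module _ {X : Set} {{fX : Finite X}} where

    # : {P : X → Set} → Decidable P → ℕ
    # P? = ∑ (λ x → [ P? x ])

    ∑∈ : {P : X → Set} → Decidable P → (X → ℕ) → ℕ
    ∑∈ P? f = ∑ (λ x → [ P? x ] * f x)

    module _ {P Q : X → Set} (P? : Decidable P) (Q? : Decidable Q) where

      #-mono : (∀ x → P x → Q x) → # P? ≤ # Q?
      #-mono h = ∑-mono λ x → []-mono (P? x) (Q? x) (h x)

      #-cong : (∀ x → P x → Q x) → (∀ x → Q x → P x) → # P? ≡ # Q?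
      #-cong f g = ∑-cong λ x → []-cong (P? x) (Q? x) (f x) (g x)

      #-split : # P? ≡ # (λ x → P? x ×-dec Q? x) + # (λ x → P? x ×-dec ¬? (Q? x))
      #-split = trans (∑-cong λ x → lem (P? x) (Q? x)) (∑-+ _ _)
        where
        lem : ∀ {A B : Set} (d : Dec A) (e : Dec B) → [ d ] ≡ [ d ×-dec e ] + [ d ×-dec ¬? e ]
        lem (yes a) (yes b) = refl
        lem (yes a) (no ¬b) = refl
        lem (no ¬a) e       = refl

      #-subset : (∀ x → Q x → P x) → # P? ≡ # Q? + # (λ x → P? x ×-dec ¬? (Q? x))
      #-subset h = trans #-split (cong (_+ # (λ x → P? x ×-dec ¬? (Q? x)))
        (∑-cong λ x → []-cong (P? x ×-dec Q? x) (Q? x) proj₂ (λ q → h x q , q)))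

      #-full : (∀ x → Q x → P x) → # P? ≤ # Q? → ∀ x → P x → Q x
      #-full h le x p with Q? x
      ... | yes q = q
      ... | no ¬q = ⊥-elim (<-irrefl refl (≤-trans (s≤s le) (≤-trans
          (≤-trans (≤-reflexive (+-comm 1 (# Q?))) (+-monoʳ-≤ (# Q?) one)) (≤-reflexive (sym (#-subset h))))))
        where
        one : 1 ≤ # (λ y → P? y ×-dec ¬? (Q? y))
        one = ≤-trans (≤-reflexive (sym (trans (∑-single (λ y → [ y ≟ x ]) x (λ y y≢ → []-no (y ≟ x) y≢))
                                               ([]-yes (x ≟ x) refl))))
                (∑-mono λ y → []-mono (y ≟ x) (P? y ×-dec ¬? (Q? y)) λ { refl → p , ¬q })

    module _ {P : X → Set} (P? : Decidable P) where

      #-none : (∀ x → ¬ P x) → # P? ≡ 0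
      #-none h = trans (∑-cong λ x → []-no (P? x) (h x)) (trans (∑-const 0) (*-zeroʳ ∣ X ∣))

      #-all : (∀ x → P x) → # P? ≡ ∣ X ∣
      #-all h = trans (∑-cong λ x → []-yes (P? x) (h x)) (trans (∑-const 1) (*-identityʳ ∣ X ∣))

      #-one : ∀ a → P a → (∀ x → P x → x ≡ a) → # P? ≡ 1
      #-one a pa u = trans (∑-single (λ x → [ P? x ]) a (λ x x≢a → []-no (P? x) (x≢a ∘ u x))) ([]-yes (P? a) pa)

      #-pos : ∀ a → P a → 1 ≤ # P?
      #-pos a pa = ≤-trans (≤-reflexive (sym (trans (∑-single (λ y → [ y ≟ a ]) a (λ y y≢ → []-no (y ≟ a) y≢))
                                               ([]-yes (a ≟ a) refl))))
                     (∑-mono λ y → []-mono (y ≟ a) (P? y) λ { refl → pa })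

      ∑∈-const : ∀ {f : X → ℕ} {c} → (∀ x → P x → f x ≡ c) → ∑∈ P? f ≡ # P? * c
      ∑∈-const {f} {c} h = trans (∑-cong λ x → lem x (P? x)) (trans (∑-* c _) (*-comm c _))
        where
        lem : ∀ x (d : Dec (P x)) → [ d ] * f x ≡ c * [ d ]
        lem x (yes p) = trans (*-identityˡ (f x)) (trans (h x p) (sym (*-identityʳ c)))
        lem x (no _)  = sym (*-zeroʳ c)

      ∑∈-cong : ∀ {f g : X → ℕ} → (∀ x → P x → f x ≡ g x) → ∑∈ P? f ≡ ∑∈ P? g
      ∑∈-cong {f} {g} h = ∑-cong λ x → lem x (P? x)
        where
        lem : ∀ x (d : Dec (P x)) → [ d ] * f x ≡ [ d ] * g x
        lem x (yes p) = cong (1 *_) (h x p)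
        lem x (no _)  = refl

      ∑∈-mono : ∀ {f g : X → ℕ} → (∀ x → P x → f x ≤ g x) → ∑∈ P? f ≤ ∑∈ P? g
      ∑∈-mono {f} {g} h = ∑-mono λ x → lem x (P? x)
        where
        lem : ∀ x (d : Dec (P x)) → [ d ] * f x ≤ [ d ] * g x
        lem x (yes p) = *-monoʳ-≤ 1 (h x p)
        lem x (no _)  = z≤n

      ∑∈-+ : (f g : X → ℕ) → ∑∈ P? (λ x → f x + g x) ≡ ∑∈ P? f + ∑∈ P? g
      ∑∈-+ f g = trans (∑-cong λ x → *-distribˡ-+ [ P? x ] (f x) (g x)) (∑-+ _ _)

      ∑∈-# : {Q : X → Set} (Q? : Decidable Q) → ∑∈ P? (λ x → [ Q? x ]) ≡ # (λ x → P? x ×-dec Q? x)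
      ∑∈-# Q? = ∑-cong λ x → sym ([]-× (P? x) (Q? x))

      ∑∈-* : ∀ c (f : X → ℕ) → ∑∈ P? (λ x → c * f x) ≡ c * ∑∈ P? f
      ∑∈-* c f = trans (∑-cong λ x → trans (sym (*-assoc [ P? x ] c (f x)))
                   (trans (cong (_* f x) (*-comm [ P? x ] c)) (*-assoc c [ P? x ] (f x)))) (∑-* c _)

      ∑∈-split : {Q : X → Set} (Q? : Decidable Q) (f : X → ℕ) →
        ∑∈ P? f ≡ ∑∈ (λ x → P? x ×-dec Q? x) f + ∑∈ (λ x → P? x ×-dec ¬? (Q? x)) f
      ∑∈-split {Q} Q? f = trans (∑-cong λ x → lem x (P? x) (Q? x)) (∑-+ _ _)
        where
        lem : ∀ x (d : Dec (P x)) (e : Dec (Q x)) → [ d ] * f x ≡ [ d ×-dec e ] * f x + [ d ×-dec ¬? e ] * f x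
        lem x (yes _) (yes _) = sym (+-identityʳ _)
        lem x (yes _) (no _)  = refl
        lem x (no _)  e       = refl

  module _ {X Y : Set} {{fX : Finite X}} {{fY : Finite Y}} where

    double-count : {P : X → Set} {Q : Y → Set} {R : X → Y → Set}
      (P? : Decidable P) (Q? : Decidable Q) (R? : ∀ x y → Dec (R x y)) →
      ∑∈ P? (λ x → # (λ y → Q? y ×-dec R? x y)) ≡ ∑∈ Q? (λ y → # (λ x → P? x ×-dec R? x y))
    double-count P? Q? R? = begin
      ∑∈ P? (λ x → # (λ y → Q? y ×-dec R? x y))            ≡⟨ ∑-cong (λ x → sym (∑-* [ P? x ] _)) ⟩
      ∑ (λ x → ∑ (λ y → [ P? x ] * [ Q? y ×-dec R? x y ])) ≡⟨ ∑-swap _ ⟩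
      ∑ (λ y → ∑ (λ x → [ P? x ] * [ Q? y ×-dec R? x y ])) ≡⟨ ∑-cong (λ y → ∑-cong (λ x → lem (P? x) (Q? y) (R? x y))) ⟩
      ∑ (λ y → ∑ (λ x → [ Q? y ] * [ P? x ×-dec R? x y ])) ≡⟨ ∑-cong (λ y → ∑-* [ Q? y ] _) ⟩
      ∑∈ Q? (λ y → # (λ x → P? x ×-dec R? x y))            ∎
      where
      open ≡-Reasoning
      lem : ∀ {A B C : Set} (a : Dec A) (b : Dec B) (c : Dec C) → [ a ] * [ b ×-dec c ] ≡ [ b ] * [ a ×-dec c ]
      lem (yes _) (yes _) (yes _) = refl
      lem (yes _) (yes _) (no _)  = refl
      lem (yes _) (no _)  c = refl
      lem (no _)  (yes _) c = refl
      lem (no _)  (no _)  c = refl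

    #-fibres : {P : X → Set} (P? : Decidable P) (f : X → Y) →
      # P? ≡ ∑ (λ y → # (λ x → P? x ×-dec f x ≟ y))
    #-fibres P? f = trans (∑-cong λ x → sym (lem x)) (∑-swap _)
      where
      lem : ∀ x → ∑ (λ y → [ P? x ×-dec f x ≟ y ]) ≡ [ P? x ]
      lem x = trans (∑-single (λ y → [ P? x ×-dec f x ≟ y ]) (f x)
                       (λ y y≢ → []-no (P? x ×-dec f x ≟ y) λ (_ , e) → y≢ (sym e)))
                    ([]-cong (P? x ×-dec f x ≟ f x) (P? x) proj₁ (λ p → p , refl))

    module _ {P : X → Set} {Q : Y → Set} (P? : Decidable P) (Q? : Decidable Q) where

      #-inj : (f : X → Y) → (∀ x → P x → Q (f x)) → (∀ x x′ → P x → P x′ → f x ≡ f x′ → x ≡ x′) → # P? ≤ # Q?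
      #-inj f pq inj = ≤-trans (≤-reflexive (#-fibres P? f)) (∑-mono le)
        where
        le : ∀ y → # (λ x → P? x ×-dec f x ≟ y) ≤ [ Q? y ]
        le y with any? (λ x → P? x ×-dec f x ≟ y)
        ... | no none = ≤-trans (≤-reflexive (#-none _ λ x px → none (x , px))) z≤n
        ... | yes (x , p , refl) = ≤-reflexive (trans
                (#-one _ x (p , refl) λ x′ (p′ , e) → inj x′ x p′ p e) (sym ([]-yes (Q? y) (pq x p))))

  #-bij : {X Y : Set} {{fX : Finite X}} {{fY : Finite Y}} {P : X → Set} {Q : Y → Set}
    (P? : Decidable P) (Q? : Decidable Q) (f : X → Y) (g : Y → X) →
    (∀ x → P x → Q (f x)) → (∀ y → Q y → P (g y)) →
    (∀ x → P x → g (f x) ≡ x) → (∀ y → Q y → f (g y) ≡ y) → # P? ≡ # Q?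
  #-bij P? Q? f g pq qp gf fg = ≤-antisym
    (#-inj P? Q? f pq λ x x′ p p′ e → trans (sym (gf x p)) (trans (cong g e) (gf x′ p′)))
    (#-inj Q? P? g qp λ y y′ p p′ e → trans (sym (fg y p)) (trans (cong f e) (fg y′ p′)))

open Counting

-- Inequalities and identities in the natural numbers

module Inequalities where
  open import Data.Empty using (⊥)
  open import Data.Nat hiding (_≟_)
  open import Data.Nat.Properties hiding (_≟_)

  2ab≤a²+b² : ∀ a b → 2 * a * b ≤ a * a + b * b
  2ab≤a²+b² a b with ≤-total a b
  ... | inj₁ a≤b with m≤n⇒∃[o]m+o≡n a≤b
  ...   | k , refl = ≤-trans (m≤m+n _ (k * k)) (≤-reflexive (lem a k))
    where
    lem : ∀ a k → 2 * a * (a + k) + k * k ≡ a * a + (a + k) * (a + k)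
    lem = solve-∀
  2ab≤a²+b² a b | inj₂ b≤a with m≤n⇒∃[o]m+o≡n b≤a
  ...   | k , refl = ≤-trans (m≤m+n _ (k * k)) (≤-reflexive (lem b k))
    where
    lem : ∀ b k → 2 * (b + k) * b + k * k ≡ (b + k) * (b + k) + b * b
    lem = solve-∀

  -- Summing `2ab≤a²+b²` over all ordered pairs of elements of P gives twice the inequality, which
  -- avoids subtraction.
  cauchy-schwarz : {X : Set} {{_ : Finite X}} {P : X → Set} (P? : Decidable P) (f : X → ℕ) →
    ∑∈ P? f * ∑∈ P? f ≤ # P? * ∑∈ P? (λ x → f x * f x)
  cauchy-schwarz P? f = *-cancelˡ-≤ 2 (begin
    2 * (S * S)                                ≡⟨ lem₁ S ⟩
    2 * S * S                                  ≡⟨ ∑∈-* P? (2 * S) f ⟨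
    ∑∈ P? (λ x → 2 * S * f x)                  ≤⟨ ∑∈-mono P? (λ x _ → inner x) ⟩
    ∑∈ P? (λ x → # P? * (f x * f x) + S₂)      ≡⟨ ∑∈-+ P? _ _ ⟩
    ∑∈ P? (λ x → # P? * (f x * f x)) + ∑∈ P? (λ _ → S₂)
      ≡⟨ cong₂ _+_ (∑∈-* P? (# P?) _) (∑∈-const P? (λ _ _ → refl)) ⟩
    # P? * S₂ + # P? * S₂                      ≡⟨ lem₂ (# P? * S₂) ⟩
    2 * (# P? * S₂)                            ∎)
    where
    open ≤-Reasoning
    S  = ∑∈ P? f
    S₂ = ∑∈ P? (λ x → f x * f x)
    lem₁ : ∀ s → 2 * (s * s) ≡ 2 * s * s
    lem₁ = solve-∀
    lem₂ : ∀ s → s + s ≡ 2 * s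
    lem₂ = solve-∀
    lem₃ : ∀ s c → 2 * s * c ≡ 2 * c * s
    lem₃ = solve-∀
    inner : ∀ x → 2 * S * f x ≤ # P? * (f x * f x) + S₂
    inner x = begin
      2 * S * f x                              ≡⟨ lem₃ S (f x) ⟩
      2 * f x * S                              ≡⟨ ∑∈-* P? (2 * f x) f ⟨
      ∑∈ P? (λ y → 2 * f x * f y)              ≤⟨ ∑∈-mono P? (λ y _ → 2ab≤a²+b² (f x) (f y)) ⟩
      ∑∈ P? (λ y → f x * f x + f y * f y)      ≡⟨ ∑∈-+ P? _ _ ⟩
      ∑∈ P? (λ _ → f x * f x) + S₂             ≡⟨ cong (_+ S₂) (∑∈-const P? (λ _ _ → refl)) ⟩
      # P? * (f x * f x) + S₂                  ∎

  -- With q = p + 2, A = A₀ + A₁ and B = B₀ + B₁, the two sides of the hypothesis are (q - 1)A₀B +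
  -- AB and (q - 1)B₀A + AB. Cancelling AB and the factor q - 1 leaves the claim.
  pairing-arithmetic : ∀ p A₀ A₁ B₀ B₁ →
    A₀ * (suc (suc p) * (B₀ + B₁)) + A₁ * (B₀ + B₁) ≡ B₀ * (suc (suc p) * (A₀ + A₁)) + B₁ * (A₀ + A₁) →
    (A₀ + A₁) * B₀ ≡ (B₀ + B₁) * A₀
  pairing-arithmetic p A₀ A₁ B₀ B₁ e = *-cancelˡ-≡ _ _ (suc p) (+-cancelʳ-≡ ((A₀ + A₁) * (B₀ + B₁)) _ _
    (trans (lem₁ p A₀ A₁ B₀ B₁) (trans (sym e) (lem₂ p A₀ A₁ B₀ B₁))))
    where
    lem₁ : ∀ p A₀ A₁ B₀ B₁ → suc p * ((A₀ + A₁) * B₀) + (A₀ + A₁) * (B₀ + B₁)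
      ≡ B₀ * (suc (suc p) * (A₀ + A₁)) + B₁ * (A₀ + A₁)
    lem₁ = solve-∀
    lem₂ : ∀ p A₀ A₁ B₀ B₁ → A₀ * (suc (suc p) * (B₀ + B₁)) + A₁ * (B₀ + B₁)
      ≡ suc p * ((B₀ + B₁) * A₀) + (A₀ + A₁) * (B₀ + B₁)
    lem₂ = solve-∀

  -- S is the size of the zero level, X and Y are the first and second moments of the other levels, R = |rad P|, N = |P|.
  variance-arithmetic : ∀ p R S X Y N → X + S ≡ N → suc p * (Y + S * S) ≡ p * (R * N) + N * N → X * X ≤ p * Y →
    (suc p * S) * (suc p * S) + N * N ≤ 2 * (suc p * S) * N + p * p * (R * N)
  variance-arithmetic p R S X Y .(X + S) refl e le = +-cancelʳ-≤ (p * (N * N)) _ _ (begin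
    (suc p * S) * (suc p * S) + N * N + p * (N * N)                     ≡⟨ lem₁ p S X ⟩
    suc p * (X * X) + (p * (suc p * (S * S)) + 2 * (suc p * S) * N)     ≤⟨ +-monoˡ-≤ _ (*-monoʳ-≤ (suc p) le) ⟩
    suc p * (p * Y) + (p * (suc p * (S * S)) + 2 * (suc p * S) * N)     ≡⟨ lem₂ p S X Y ⟩
    p * (suc p * (Y + S * S)) + 2 * (suc p * S) * N                     ≡⟨ cong (λ z → p * z + 2 * (suc p * S) * N) e ⟩
    p * (p * (R * N) + N * N) + 2 * (suc p * S) * N                     ≡⟨ lem₃ p R S X ⟩
    2 * (suc p * S) * N + p * p * (R * N) + p * (N * N)                 ∎)
    where
    open ≤-Reasoning
    N = X + S
    lem₁ : ∀ p S X → (suc p * S) * (suc p * S) + (X + S) * (X + S) + p * ((X + S) * (X + S))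
      ≡ suc p * (X * X) + (p * (suc p * (S * S)) + 2 * (suc p * S) * (X + S))
    lem₁ = solve-∀
    lem₂ : ∀ p S X Y → suc p * (p * Y) + (p * (suc p * (S * S)) + 2 * (suc p * S) * (X + S))
      ≡ p * (suc p * (Y + S * S)) + 2 * (suc p * S) * (X + S)
    lem₂ = solve-∀
    lem₃ : ∀ p R S X → p * (p * (R * (X + S)) + (X + S) * (X + S)) + 2 * (suc p * S) * (X + S)
      ≡ 2 * (suc p * S) * (X + S) + p * p * (R * (X + S)) + p * ((X + S) * (X + S))
    lem₃ = solve-∀

  -- The largest number of zeros of η on ⟨x, w⟩^⊥ for x singular and w ∈ x^⊥ non-singular; q = p + 1 and Q = q ^ (n − 1).
  maxZeros : ℕ → ℕ → ℕ
  maxZeros p Q = Q * Q + p * Q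

  -- The maximum over φ of the number of pairs (x, y), x ≠ 0, with ⟨x, y⟩ totally singular and φ-isotropic,
  -- where N is the number of choices for x and Q₁ = q ^ (n − 1) − 1.
  maxTotal : ℕ → ℕ → ℕ → ℕ
  maxTotal p Q₁ N = N * maxZeros p (suc Q₁) + (Q₁ * (Q₁ + 2)) * (p * suc Q₁ * Q₁)

  -- The hypothesis is (S - Q²)² ≤ (pQ)² with the negative term moved to the right. If S exceeded Q²
  -- + pQ by `suc e`, the left side would be strictly larger.
  square-bound : ∀ p Q S → S * S + (Q * Q) * (Q * Q) ≤ 2 * S * (Q * Q) + p * p * (Q * Q) → S ≤ maxZeros p Q
  square-bound p Q S le with S ≤? Q * Q + p * Q
  ... | yes h = h
  ... | no ¬h with m≤n⇒∃[o]m+o≡n (≰⇒> ¬h)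
  ...   | e , refl = ⊥-elim (<-irrefl refl (<-≤-trans (s≤s (m≤m+n _ _)) (≤-trans (≤-reflexive (lem p Q e)) le)))
    where
    lem : ∀ p Q e → suc (2 * (suc (Q * Q + p * Q) + e) * (Q * Q) + p * p * (Q * Q) + (2 * (p * Q) * suc e + (e * e + 2 * e)))
      ≡ (suc (Q * Q + p * Q) + e) * (suc (Q * Q + p * Q) + e) + (Q * Q) * (Q * Q)
    lem = solve-∀

  -- Here |P| = q Q², R = |rad P|, and S is the number of zeros in P.
  zeros-bound-arithmetic : ∀ p Q R S → R ≤ suc p →
    (suc p * S) * (suc p * S) + (suc p * (Q * Q)) * (suc p * (Q * Q))
      ≤ 2 * (suc p * S) * (suc p * (Q * Q)) + p * p * (R * (suc p * (Q * Q))) → S ≤ maxZeros p Q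
  zeros-bound-arithmetic p Q R S R≤q le = square-bound p Q S (*-cancelˡ-≤ (suc p * suc p) (begin
    suc p * suc p * (S * S + (Q * Q) * (Q * Q))   ≡⟨ lem₁ p Q S ⟩
    (suc p * S) * (suc p * S) + (suc p * (Q * Q)) * (suc p * (Q * Q))  ≤⟨ le ⟩
    2 * (suc p * S) * (suc p * (Q * Q)) + p * p * (R * (suc p * (Q * Q)))
      ≤⟨ +-monoʳ-≤ _ (*-monoʳ-≤ (p * p) (*-monoˡ-≤ (suc p * (Q * Q)) R≤q)) ⟩
    2 * (suc p * S) * (suc p * (Q * Q)) + p * p * (suc p * (suc p * (Q * Q))) ≡⟨ lem₂ p Q S ⟩
    suc p * suc p * (2 * S * (Q * Q) + p * p * (Q * Q)) ∎))
    where
    open ≤-Reasoning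
    lem₁ : ∀ p Q S → suc p * suc p * (S * S + (Q * Q) * (Q * Q))
      ≡ (suc p * S) * (suc p * S) + (suc p * (Q * Q)) * (suc p * (Q * Q))
    lem₁ = solve-∀
    lem₂ : ∀ p Q S → 2 * (suc p * S) * (suc p * (Q * Q)) + p * p * (suc p * (suc p * (Q * Q)))
      ≡ suc p * suc p * (2 * S * (Q * Q) + p * p * (Q * Q))
    lem₂ = solve-∀

  -- Here w = |W|, B = |P ∩ W^⊥|, N = |P| and S is the number of zeros in P, for a maximal totally singular W in P.
  anisotropic-arithmetic : ∀ p w B N S G → 1 ≤ p → 1 ≤ w → 2 ≤ G → B ≡ suc p * (suc p * G) * w →
    suc p * S + B ≡ N + suc p * w →
    (suc p * S) * (suc p * S) + N * N ≤ 2 * (suc p * S) * N + p * p * (w * B) → ⊥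
  anisotropic-arithmetic (suc p′) (suc w′) B N S (suc (suc g)) (s≤s z≤n) (s≤s z≤n) (s≤s (s≤s z≤n)) refl e le =
    <-irrefl refl (<-≤-trans (m<m*n G G (s≤s (s≤s z≤n))) G²≤G)
    where
    open ≤-Reasoning
    p = suc p′
    w = suc w′
    q = suc p
    G = suc (suc g)
    -- `k` is the gap N - qS. The balance equation gives it as q(qG - 1)w, and qG - 1 = pG + (G -
    -- 1). The variance inequality then reads k² ≤ p²wB, and k ≥ qpGw turns it into G² ≤ G.
    k = q * (p * G + suc g) * w
    N≡ : N ≡ q * S + k
    N≡ = +-cancelʳ-≡ (q * w) _ _ (trans (sym e) (lem p g w S))
      where
      lem : ∀ p g w S → suc p * S + suc p * (suc p * suc (suc g)) * w
        ≡ suc p * S + suc p * (p * suc (suc g) + suc g) * w + suc p * w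
      lem = solve-∀
    k²≤ : k * k ≤ p * p * (w * (q * (q * G) * w))
    k²≤ = +-cancelˡ-≤ (2 * (q * S) * (q * S + k)) _ _ (begin
      2 * (q * S) * (q * S + k) + k * k                        ≡⟨ lem (q * S) k ⟩
      (q * S) * (q * S) + (q * S + k) * (q * S + k)            ≡⟨ cong (λ z → (q * S) * (q * S) + z * z) N≡ ⟨
      (q * S) * (q * S) + N * N                                ≤⟨ le ⟩
      2 * (q * S) * N + p * p * (w * (q * (q * G) * w))        ≡⟨ cong (λ z → 2 * (q * S) * z + p * p * (w * (q * (q * G) * w))) N≡ ⟩
      2 * (q * S) * (q * S + k) + p * p * (w * (q * (q * G) * w)) ∎)
      where
      lem : ∀ s k → 2 * s * (s + k) + k * k ≡ s * s + (s + k) * (s + k)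
      lem = solve-∀
    c = (p * p) * (q * q) * (w * w)
    G²≤G : G * G ≤ G
    G²≤G = *-cancelˡ-≤ c (begin
      c * (G * G)                                   ≡⟨ lem₁ p g w ⟩
      (q * (p * G) * w) * (q * (p * G) * w)         ≤⟨ *-mono-≤ le′ le′ ⟩
      k * k                                         ≤⟨ k²≤ ⟩
      p * p * (w * (q * (q * G) * w))               ≡⟨ lem₂ p g w ⟩
      c * G                                         ∎)
      where
      le′ : q * (p * G) * w ≤ k
      le′ = *-monoˡ-≤ w (*-monoʳ-≤ q (m≤m+n (p * G) (suc g)))
      lem₁ : ∀ p g w → (p * p) * (suc p * suc p) * (w * w) * (suc (suc g) * suc (suc g))
        ≡ (suc p * (p * suc (suc g)) * w) * (suc p * (p * suc (suc g)) * w)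
      lem₁ = solve-∀
      lem₂ : ∀ p g w → p * p * (w * (suc p * (suc p * suc (suc g)) * w)) ≡ (p * p) * (suc p * suc p) * (w * w) * suc (suc g)
      lem₂ = solve-∀

  -- C is the number of pairs, N counts the non-zero singular vectors, E the eigenvectors among
  -- them, Z the tangent ones. The allowance of eigenvectors is Q² - 1 = Q₁(Q₁ + 2); the e beyond it
  -- gain pQQ₁ each, which eQ₁ ≤ Z tangent vectors losing pQ each make up for.
  total-arithmetic : ∀ p Q₁ N E Z e C → C + Z * (p * suc Q₁) ≤ N * maxZeros p (suc Q₁) + E * (p * suc Q₁ * Q₁) →
    suc E ≤ suc Q₁ * suc Q₁ + e → e * suc Q₁ ≤ Z + e → C ≤ maxTotal p Q₁ N
  total-arithmetic p Q₁ N E Z e C le E≤ e≤ = +-cancelʳ-≤ (Z * (p * Q)) _ _ (begin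
    C + Z * (p * Q)                                    ≤⟨ le ⟩
    A + E * (p * Q * Q₁)                             ≤⟨ +-monoʳ-≤ A (*-monoˡ-≤ (p * Q * Q₁) E≤′) ⟩
    A + (Q₁ * (Q₁ + 2) + e) * (p * Q * Q₁)     ≡⟨ lem₁ A p Q₁ e ⟩
    A + (Q₁ * (Q₁ + 2)) * (p * Q * Q₁) + (e * Q₁) * (p * Q) ≤⟨ +-monoʳ-≤ _ (*-monoˡ-≤ (p * Q) eQ₁≤) ⟩
    A + (Q₁ * (Q₁ + 2)) * (p * Q * Q₁) + Z * (p * Q) ∎)
    where
    open ≤-Reasoning
    Q = suc Q₁
    A = N * (Q * Q + p * Q)
    E≤′ : E ≤ Q₁ * (Q₁ + 2) + e
    E≤′ = ≤-pred (≤-trans E≤ (≤-reflexive (lem Q₁ e)))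
      where
      lem : ∀ Q₁ e → suc Q₁ * suc Q₁ + e ≡ suc (Q₁ * (Q₁ + 2) + e)
      lem = solve-∀
    eQ₁≤ : e * Q₁ ≤ Z
    eQ₁≤ = +-cancelʳ-≤ e _ _ (≤-trans (≤-reflexive (lem e Q₁)) e≤)
      where
      lem : ∀ e Q₁ → e * Q₁ + e ≡ e * suc Q₁
      lem = solve-∀
    lem₁ : ∀ A p Q₁ e → A + (Q₁ * (Q₁ + 2) + e) * (p * suc Q₁ * Q₁)
      ≡ A + (Q₁ * (Q₁ + 2)) * (p * suc Q₁ * Q₁) + (e * Q₁) * (p * suc Q₁)
    lem₁ = solve-∀

  -- The case of equality: A vectors in the kernel, B tangent ones, C generic ones. The hypotheses
  -- force A = Q² - 1 + pQ and B = pQQ₁, so the surplus pQ over the allowance is paid by exactly Q₁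
  -- tangent vectors each.
  example-arithmetic : ∀ p Q₁ A B C → suc A ≡ maxZeros p (suc Q₁) → suc (A + B) ≡ suc p * (suc Q₁ * suc Q₁) →
    A * (suc p * (suc Q₁ * suc Q₁)) + (B * (suc Q₁ * suc Q₁) + C * maxZeros p (suc Q₁))
      ≡ maxTotal p Q₁ (A + (B + C))
  example-arithmetic p Q₁ A B C eA eB = substitute A B
      (suc-injective (trans eA (lem₁ p Q₁)))
      (λ A≡ → +-cancelˡ-≡ A _ _ (suc-injective (trans eB (trans (lem₂ p Q₁) (cong (λ z → suc (z + p * suc Q₁ * Q₁)) (sym A≡))))))
    where
    lem₁ : ∀ p Q₁ → suc Q₁ * suc Q₁ + p * suc Q₁ ≡ suc (Q₁ * (Q₁ + 2) + p * suc Q₁)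
    lem₁ = solve-∀
    lem₂ : ∀ p Q₁ → suc p * (suc Q₁ * suc Q₁) ≡ suc (Q₁ * (Q₁ + 2) + p * suc Q₁ + p * suc Q₁ * Q₁)
    lem₂ = solve-∀
    lem₃ : ∀ p Q₁ C → (Q₁ * (Q₁ + 2) + p * suc Q₁) * (suc p * (suc Q₁ * suc Q₁))
        + (p * suc Q₁ * Q₁ * (suc Q₁ * suc Q₁) + C * (suc Q₁ * suc Q₁ + p * suc Q₁))
      ≡ (Q₁ * (Q₁ + 2) + p * suc Q₁ + (p * suc Q₁ * Q₁ + C)) * (suc Q₁ * suc Q₁ + p * suc Q₁)
        + (Q₁ * (Q₁ + 2)) * (p * suc Q₁ * Q₁)
    lem₃ = solve-∀
    substitute : ∀ A B → A ≡ Q₁ * (Q₁ + 2) + p * suc Q₁ → (A ≡ Q₁ * (Q₁ + 2) + p * suc Q₁ → B ≡ p * suc Q₁ * Q₁) →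
      A * (suc p * (suc Q₁ * suc Q₁)) + (B * (suc Q₁ * suc Q₁) + C * maxZeros p (suc Q₁))
      ≡ maxTotal p Q₁ (A + (B + C))
    substitute A B refl B≡ with B≡ refl
    ... | refl = lem₃ p Q₁ C

  -- Translates lines into pairs: (q² - 1)(q² - q) ordered bases for each of f lines, plus q
  -- dependent pairs for each of N singular vectors. Since (q² - 1)(q² - q) is q times the
  -- denominator, multiplying the defining equation of f by q removes the division.
  fmax-arithmetic : ∀ p k N f → let q = suc (suc p) ; Q = q ^ suc k ; Q₁ = pred Q in
    suc N ≡ q * (q * (Q * Q)) →
    f * fmax-denom q ≡ fmax-numer q (suc (suc k)) →
    f * ((q * q ∸ 1) * (q * q ∸ q)) + N * q
      ≡ maxTotal (suc p) Q₁ N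
  fmax-arithmetic p k N f sizes e = begin
    f * ((q * q ∸ 1) * (q * q ∸ q)) + N * q
      ≡⟨ cong (λ z → f * z + N * q) denominators ⟩
    f * (q * fmax-denom q) + N * q
      ≡⟨ cong (_+ N * q) (trans (swap f q (fmax-denom q)) (cong (q *_) e)) ⟩
    q * fmax-numer q (suc (suc k)) + N * q
      ≡⟨ cong (_+ N * q) numerators ⟩
    Q₁ * (N * (Q + q) + (Q₁ * (Q₁ + 2)) * (suc p * Q)) + N * q
      ≡⟨ cong (λ z → Q₁ * (N * (z + q) + (Q₁ * (Q₁ + 2)) * (suc p * z)) + N * q) Q≡ ⟩
    Q₁ * (N * (suc Q₁ + q) + (Q₁ * (Q₁ + 2)) * (suc p * suc Q₁)) + N * q
      ≡⟨ collect p Q₁ N ⟩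
    maxTotal (suc p) Q₁ N ∎
    where
    open ≡-Reasoning
    q = suc (suc p)
    Q = q ^ suc k
    Q₁ = pred Q
    Q≡ : Q ≡ suc Q₁
    Q≡ = sym (suc-pred Q {{m^n≢0 q (suc k)}})
    swap : ∀ f q d → f * (q * d) ≡ q * (f * d)
    swap = solve-∀
    collect : ∀ p Q₁ N → Q₁ * (N * (suc Q₁ + suc (suc p)) + (Q₁ * (Q₁ + 2)) * (suc p * suc Q₁)) + N * suc (suc p)
      ≡ N * (suc Q₁ * suc Q₁ + suc p * suc Q₁) + (Q₁ * (Q₁ + 2)) * (suc p * suc Q₁ * Q₁)
    collect = solve-∀
    ∸-from-+ : ∀ {a c d} → a ≡ c + d → a ∸ c ≡ d
    ∸-from-+ {a} {c} {d} e = trans (cong (_∸ c) e) (m+n∸m≡n c d)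
    denominators : (q * q ∸ 1) * (q * q ∸ q) ≡ q * fmax-denom q
    denominators = trans (cong₂ _*_ {q * q ∸ 1} {q ^ 2 ∸ 1} {q * q ∸ q} {suc p * q}
        (cong (λ z → q * z ∸ 1) (sym (*-identityʳ q))) (∸-from-+ {q * q} {q} {suc p * q} (lem p))) (lem₂ (q ^ 2 ∸ 1) (suc p) q)
      where
      lem : ∀ p → suc (suc p) * suc (suc p) ≡ suc (suc p) + suc p * suc (suc p)
      lem = solve-∀
      lem₂ : ∀ a c q → a * (c * q) ≡ q * (c * a)
      lem₂ = solve-∀
    -- This is q^(3n - 4), the one power in the numerator that is not q^i Q^j with i ≥ 0 in an
    -- evident way; only qY = Q³ is used.
    Y = q ^ (2 + 3 * k)
    cube : q ^ (3 * suc k) ≡ Q * (Q * Q)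
    cube = trans (cong (q ^_) (lem k)) (trans (^-distribˡ-+-* q (suc k) (suc k + suc k)) (cong (Q *_) (^-distribˡ-+-* q (suc k) (suc k))))
      where
      lem : ∀ k → 3 * suc k ≡ suc k + (suc k + suc k)
      lem = solve-∀
    3n : 3 * suc (suc k) ≡ 3 + 3 * suc k
    3n = lem k
      where
      lem : ∀ k → 3 * suc (suc k) ≡ 3 + 3 * suc k
      lem = solve-∀
    e₂ : q ^ (3 * suc (suc k) ∸ 2) ≡ q * (Q * (Q * Q))
    e₂ = trans (cong (λ z → q ^ (z ∸ 2)) 3n) (cong (q *_) cube)
    e₃ : q ^ (3 * suc (suc k) ∸ 3) ≡ Q * (Q * Q)
    e₃ = trans (cong (λ z → q ^ (z ∸ 3)) 3n) cube
    e₄ : q ^ (3 * suc (suc k) ∸ 4) ≡ Y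
    e₄ = cong (λ z → q ^ (z ∸ 4)) (lem k)
      where
      lem : ∀ k → 3 * suc (suc k) ≡ 6 + 3 * k
      lem = solve-∀
    qY : q * Y ≡ Q * (Q * Q)
    qY = trans (cong (q ^_) (lem k)) cube
      where
      lem : ∀ k → 3 + 3 * k ≡ 3 * suc k
      lem = solve-∀
    e₅ : q ^ (2 * suc (suc k)) ≡ q * (q * (Q * Q))
    e₅ = trans (cong (q ^_) (lem k)) (cong (λ z → q * (q * z)) (^-distribˡ-+-* q (suc k) (suc k)))
      where
      lem : ∀ k → 2 * suc (suc k) ≡ 2 + (suc k + suc k)
      lem = solve-∀
    -- `X` is q times the bracket of the numerator, free of subtraction and already expressed
    -- through N.
    X = N * (Q + q) + (Q₁ * (Q₁ + 2)) * (suc p * Q)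
    difference : q * (q * (Q * (Q * Q)) + Q * (Q * Q) + q * (q * (Q * Q))) ≡ q * (Y + Q + 1) + X
    difference = sym (begin
      q * (Y + Q + 1) + X
        ≡⟨ lem₁ p Y Q N Z ⟩
      q * Y + (suc Z * (suc p * Q) + suc N * (Q + q))
        ≡⟨ cong₂ (λ s t → s + (suc Z * (suc p * Q) + t * (Q + q))) qY sizes ⟩
      Q * (Q * Q) + (suc Z * (suc p * Q) + q * (q * (Q * Q)) * (Q + q))
        ≡⟨ cong (λ z → Q * (Q * Q) + (z * (suc p * Q) + q * (q * (Q * Q)) * (Q + q)))
             (trans (square Q₁) (cong₂ _*_ (sym Q≡) (sym Q≡))) ⟩
      Q * (Q * Q) + (Q * Q * (suc p * Q) + q * (q * (Q * Q)) * (Q + q))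
        ≡⟨ lem₂ p Q ⟩
      q * (q * (Q * (Q * Q)) + Q * (Q * Q) + q * (q * (Q * Q))) ∎)
      where
      Z = Q₁ * (Q₁ + 2)
      square : ∀ r → suc (r * (r + 2)) ≡ suc r * suc r
      square = solve-∀
      lem₁ : ∀ p Y Q N Z → suc (suc p) * (Y + Q + 1) + (N * (Q + suc (suc p)) + Z * (suc p * Q))
        ≡ suc (suc p) * Y + (suc Z * (suc p * Q) + suc N * (Q + suc (suc p)))
      lem₁ = solve-∀
      lem₂ : ∀ p Q → Q * (Q * Q) + (Q * Q * (suc p * Q) + suc (suc p) * (suc (suc p) * (Q * Q)) * (Q + suc (suc p)))
        ≡ suc (suc p) * (suc (suc p) * (Q * (Q * Q)) + Q * (Q * Q) + suc (suc p) * (suc (suc p) * (Q * Q)))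
      lem₂ = solve-∀
    numerators : q * fmax-numer q (suc (suc k)) ≡ Q₁ * X
    numerators = begin
      q * ((Q ∸ 1) * (A ∸ B))   ≡⟨ swap q (Q ∸ 1) (A ∸ B) ⟩
      (Q ∸ 1) * (q * (A ∸ B))   ≡⟨ cong₂ _*_ (cong (_∸ 1) Q≡) (trans (*-distribˡ-∸ q A B) (∸-from-+ {q * A} {q * B} {X} AB)) ⟩
      Q₁ * X                          ∎
      where
      A = q ^ (3 * suc (suc k) ∸ 2) + q ^ (3 * suc (suc k) ∸ 3) + q ^ (2 * suc (suc k))
      B = q ^ (3 * suc (suc k) ∸ 4) + Q + 1
      AB : q * A ≡ q * B + X
      AB = trans (cong (q *_) (cong₂ _+_ (cong₂ _+_ e₂ e₃) e₅)) (trans difference (cong (λ z → q * (z + Q + 1) + X) (sym e₄)))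

open Inequalities

-- Finite fields and their vector spaces

-- Coefficients are integers mapped into R by `⟦_⟧ℤ`: integer equality is decided by computation,
-- which allows numerals such as 0, 1 and -1 to cancel during normalisation.
module IntegerSolver (R : CommutativeRing 0ℓ 0ℓ) where
  open import Data.Integer using (+_)
  open CommutativeRing R renaming (refl to ≈-refl; sym to ≈-sym; trans to ≈-trans)
  open import Algebra.Properties.Ring ring
  open import Algebra.Properties.AbelianGroup +-abelianGroup using (⁻¹-∙-comm)
  open import Algebra.Properties.Semiring.Mult.TCOptimised semiring renaming (_×_ to _·_)
  open import Relation.Binary.Reasoning.Setoid setoid

  ⟦_⟧ℤ : ℤ → Carrier
  ⟦ + n ⟧ℤ      = n · 1#
  ⟦ -[1+ n ] ⟧ℤ = - (suc n · 1#)

  ⟦⟧-neg : ∀ i → ⟦ ℤ.- i ⟧ℤ ≈ - ⟦ i ⟧ℤ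
  ⟦⟧-neg (+ zero)   = ≈-sym -0#≈0#
  ⟦⟧-neg (+ suc n)  = ≈-refl
  ⟦⟧-neg -[1+ n ]   = ≈-sym (-‿involutive _)

  cancel : ∀ x y z → (x + y) - (x + z) ≈ y - z
  cancel x y z = begin
    (x + y) - (x + z)      ≈⟨ +-congˡ (⁻¹-∙-comm x z) ⟨
    (x + y) + (- x - z)    ≈⟨ +-congʳ (+-comm x y) ⟩
    (y + x) + (- x - z)    ≈⟨ +-assoc y x _ ⟩
    y + (x + (- x - z))    ≈⟨ +-congˡ (+-assoc x _ _) ⟨
    y + (x - x - z)        ≈⟨ +-congˡ (+-congʳ (-‿inverseʳ x)) ⟩
    y + (0# - z)           ≈⟨ +-congˡ (+-identityˡ _) ⟩
    y - z                  ∎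

  ⟦⟧-⊖ : ∀ m n → ⟦ m ℤ.⊖ n ⟧ℤ ≈ m · 1# - n · 1#
  ⟦⟧-⊖ m zero = ≈-trans (≈-sym (+-identityʳ _)) (+-congˡ (≈-sym -0#≈0#))
  ⟦⟧-⊖ zero (suc n) = ≈-sym (+-identityˡ _)
  ⟦⟧-⊖ (suc m) (suc n) = begin
    ⟦ suc m ℤ.⊖ suc n ⟧ℤ              ≡⟨ cong ⟦_⟧ℤ (ℤ.[1+m]⊖[1+n]≡m⊖n m n) ⟩
    ⟦ m ℤ.⊖ n ⟧ℤ                      ≈⟨ ⟦⟧-⊖ m n ⟩
    m · 1# - n · 1#                   ≈⟨ cancel 1# _ _ ⟨
    (1# + m · 1#) - (1# + n · 1#)     ≈⟨ +-cong (×-homo-+ 1# 1 m) (-‿cong (×-homo-+ 1# 1 n)) ⟨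
    suc m · 1# - suc n · 1#           ∎

  ⟦⟧-+ : ∀ i j → ⟦ i ℤ.+ j ⟧ℤ ≈ ⟦ i ⟧ℤ + ⟦ j ⟧ℤ
  ⟦⟧-+ (+ m)    (+ n)    = ×-homo-+ 1# m n
  ⟦⟧-+ (+ m)    -[1+ n ] = ⟦⟧-⊖ m (suc n)
  ⟦⟧-+ -[1+ m ] (+ n)    = ≈-trans (⟦⟧-⊖ n (suc m)) (+-comm _ _)
  ⟦⟧-+ -[1+ m ] -[1+ n ] = begin
    - (suc (suc (m ℕ.+ n)) · 1#)    ≡⟨ cong (λ k → - (suc k · 1#)) (ℕ.+-suc m n) ⟨
    - ((suc m ℕ.+ suc n) · 1#)      ≈⟨ -‿cong (×-homo-+ 1# (suc m) (suc n)) ⟩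
    - (suc m · 1# + suc n · 1#)     ≈⟨ ⁻¹-∙-comm _ _ ⟨
    - (suc m · 1#) - (suc n · 1#)   ∎

  ⟦⟧-* : ∀ i j → ⟦ i ℤ.* j ⟧ℤ ≈ ⟦ i ⟧ℤ * ⟦ j ⟧ℤ
  ⟦⟧-* (+ m)    (+ n)    = ≈-trans (reflexive (cong ⟦_⟧ℤ (ℤ.+◃n≡+n (m ℕ.* n)))) (×1-homo-* m n)
  ⟦⟧-* (+ m)    -[1+ n ] = begin
    ⟦ Sign.- ℤ.◃ (m ℕ.* suc n) ⟧ℤ  ≡⟨ cong ⟦_⟧ℤ (ℤ.-◃n≡-n (m ℕ.* suc n)) ⟩
    ⟦ ℤ.- (+ (m ℕ.* suc n)) ⟧ℤ     ≈⟨ ⟦⟧-neg (+ (m ℕ.* suc n)) ⟩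
    - ((m ℕ.* suc n) · 1#)         ≈⟨ -‿cong (×1-homo-* m (suc n)) ⟩
    - (m · 1# * suc n · 1#)        ≈⟨ -‿distribʳ-* _ _ ⟩
    m · 1# * - (suc n · 1#)        ∎
  ⟦⟧-* -[1+ m ] (+ n)    = begin
    ⟦ Sign.- ℤ.◃ (suc m ℕ.* n) ⟧ℤ  ≡⟨ cong ⟦_⟧ℤ (ℤ.-◃n≡-n (suc m ℕ.* n)) ⟩
    ⟦ ℤ.- (+ (suc m ℕ.* n)) ⟧ℤ     ≈⟨ ⟦⟧-neg (+ (suc m ℕ.* n)) ⟩
    - ((suc m ℕ.* n) · 1#)         ≈⟨ -‿cong (×1-homo-* (suc m) n) ⟩
    - (suc m · 1# * n · 1#)        ≈⟨ -‿distribˡ-* _ _ ⟩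
    - (suc m · 1#) * n · 1#        ∎
  ⟦⟧-* -[1+ m ] -[1+ n ] = begin
    (suc m ℕ.* suc n) · 1#             ≈⟨ ×1-homo-* (suc m) (suc n) ⟩
    suc m · 1# * suc n · 1#            ≈⟨ *-congʳ (-‿involutive _) ⟨
    - (- (suc m · 1#)) * suc n · 1#    ≈⟨ -‿distribˡ-* _ _ ⟨
    - (- (suc m · 1#) * suc n · 1#)    ≈⟨ -‿distribʳ-* _ _ ⟩
    - (suc m · 1#) * - (suc n · 1#)    ∎

  ⟦⟧-weak-dec : ∀ i j → Maybe (⟦ i ⟧ℤ ≈ ⟦ j ⟧ℤ)
  ⟦⟧-weak-dec i j with i ℤ.≟ j
  ... | yes e = just (reflexive (cong ⟦_⟧ℤ e))
  ... | no _  = nothing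

  ⟦⟧-morphism : ℤ.+-*-rawRing -Raw-AlmostCommutative⟶ fromCommutativeRing R
  ⟦⟧-morphism = record
    { ⟦_⟧ = ⟦_⟧ℤ ; +-homo = ⟦⟧-+ ; *-homo = ⟦⟧-* ; -‿homo = ⟦⟧-neg ; 0-homo = ≈-refl ; 1-homo = ≈-refl }

  open RingSolver ℤ.+-*-rawRing (fromCommutativeRing R) ⟦⟧-morphism ⟦⟧-weak-dec public

module FieldProperties {q : ℕ} (𝔽 : FiniteField q) where
  open FiniteField 𝔽 public

  commutativeRing : CommutativeRing 0ℓ 0ℓ
  commutativeRing = record { isCommutativeRing = isCommutativeRing }

  open CommutativeRing commutativeRing public
    using (*-comm; *-assoc; *-identityˡ; *-identityʳ; +-identityˡ; +-identityʳ; zeroʳ; +-comm; +-assoc;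
           distribʳ; -‿inverseʳ; -‿inverseˡ)
  open IntegerSolver commutativeRing public
    using (solve; _:=_; _:+_; _:*_; _:-_; :-_; con; Polynomial)

  𝟘 𝟙 : ∀ {n} → Polynomial n
  𝟘 = con (ℤ.+ 0)
  𝟙 = con (ℤ.+ 1)

  instance
    F-finite : Finite Carrier
    F-finite = record { card = q ; enum = enumeration }

  no-zero-divisors : ∀ {a b} → a * b ≡ 0# → a ≢ 0# → b ≡ 0#
  no-zero-divisors {a} {b} ab≡0 a≢0 = let (c , ac≡1) = inverse a a≢0 in begin
    b             ≡⟨ *-identityˡ b ⟨
    1# * b        ≡⟨ cong (_* b) ac≡1 ⟨
    a * c * b     ≡⟨ solve 3 (λ a b c → a :* c :* b := c :* (a :* b)) refl a b c ⟩
    c * (a * b)   ≡⟨ cong (c *_) ab≡0 ⟩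
    c * 0#        ≡⟨ zeroʳ c ⟩
    0#            ∎
    where open ≡-Reasoning

  a-b≡0⇒a≡b : ∀ {a b} → a - b ≡ 0# → a ≡ b
  a-b≡0⇒a≡b {a} {b} e = trans (solve 2 (λ a b → a := (a :- b) :+ b) refl a b)
                         (trans (cong (_+ b) e) (+-identityˡ b))

  2# : Carrier
  2# = 1# + 1#

module VectorSpace {q : ℕ} (𝔽 : FiniteField q) (m : ℕ) where
  open FieldProperties 𝔽 renaming (Carrier to F)

  -- Vectors are tuples, unlike the functions `Fin m → Carrier` of the statement: tuples with equal
  -- entries are propositionally equal, so they form a finite type that can be counted.
  V : Set
  V = Vec.Vec F m

  Vec-enum : ∀ n → Fin (q ℕ.^ n) ↔ Vec.Vec F n
  Vec-enum zero    = mk↔ₛ′ (λ _ → []) (λ _ → zero) (λ { [] → refl }) (λ { zero → refl })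
  Vec-enum (suc n) = cons ↔-∘ ((enumeration ×-↔ Vec-enum n) ↔-∘ Fin.*↔×)
    where
    cons : (F × Vec.Vec F n) ↔ Vec.Vec F (suc n)
    cons = mk↔ₛ′ (uncurry _∷_) (λ { (x ∷ xs) → x , xs }) (λ { (_ ∷ _) → refl }) (λ _ → refl)

  instance
    V-finite : ∀ {n} → Finite (Vec.Vec F n)
    V-finite {n} = record { card = q ℕ.^ n ; enum = Vec-enum n }

  ext : ∀ {x y : V} → (∀ i → lookup x i ≡ lookup y i) → x ≡ y
  ext {x} {y} e = trans (sym (Vec.tabulate∘lookup x)) (trans (Vec.tabulate-cong e) (Vec.tabulate∘lookup y))

  -- Linear combinations are the only operation on vectors: x + y is lin 1 x 1 y.
  abstract
    𝟎 : V
    𝟎 = tabulate (λ _ → 0#)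

    lookup-𝟎 : ∀ i → lookup 𝟎 i ≡ 0#
    lookup-𝟎 i = Vec.lookup∘tabulate _ i

    lin : F → V → F → V → V
    lin a x c y = tabulate (λ i → a * lookup x i + c * lookup y i)

    lookup-lin : ∀ a x c y i → lookup (lin a x c y) i ≡ a * lookup x i + c * lookup y i
    lookup-lin a x c y i = Vec.lookup∘tabulate _ i

  lin-lin : ∀ a b c d e f {x y} → lin a (lin b x c y) d (lin e x f y) ≡ lin (a * b + d * e) x (a * c + d * f) y
  lin-lin a b c d e f {x} {y} = ext λ i → begin
    lookup (lin a (lin b x c y) d (lin e x f y)) i
      ≡⟨ lookup-lin a _ d _ i ⟩
    a * lookup (lin b x c y) i + d * lookup (lin e x f y) i
      ≡⟨ cong₂ (λ s t → a * s + d * t) (lookup-lin b x c y i) (lookup-lin e x f y i) ⟩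
    a * (b * lookup x i + c * lookup y i) + d * (e * lookup x i + f * lookup y i)
      ≡⟨ solve 8 (λ a b c d e f x y → a :* (b :* x :+ c :* y) :+ d :* (e :* x :+ f :* y)
                   := (a :* b :+ d :* e) :* x :+ (a :* c :+ d :* f) :* y) refl a b c d e f (lookup x i) (lookup y i) ⟩
    (a * b + d * e) * lookup x i + (a * c + d * f) * lookup y i
      ≡⟨ lookup-lin _ x _ y i ⟨
    lookup (lin (a * b + d * e) x (a * c + d * f) y) i ∎
    where open ≡-Reasoning

  lin-10 : ∀ {x y} → lin 1# x 0# y ≡ x
  lin-10 {x} {y} = ext λ i → trans (lookup-lin 1# x 0# y i)
    (solve 2 (λ x y → 𝟙 :* x :+ 𝟘 :* y := x) refl (lookup x i) (lookup y i))

  lin-01 : ∀ {x y} → lin 0# x 1# y ≡ y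
  lin-01 {x} {y} = ext λ i → trans (lookup-lin 0# x 1# y i)
    (solve 2 (λ x y → 𝟘 :* x :+ 𝟙 :* y := y) refl (lookup x i) (lookup y i))

  lin-00 : ∀ {x y} → lin 0# x 0# y ≡ 𝟎
  lin-00 {x} {y} = ext λ i → trans (lookup-lin 0# x 0# y i)
    (trans (solve 2 (λ x y → 𝟘 :* x :+ 𝟘 :* y := 𝟘) refl (lookup x i) (lookup y i)) (sym (lookup-𝟎 i)))

  lin-comm : ∀ a x c y → lin a x c y ≡ lin c y a x
  lin-comm a x c y = ext λ i → trans (lookup-lin a x c y i) (trans (+-comm _ _) (sym (lookup-lin c y a x i)))

  lin-linˡ : ∀ a b c d {x y} → lin a (lin b x c y) d y ≡ lin (a * b) x (a * c + d) y
  lin-linˡ a b c d {x} {y} = trans (cong (lin a (lin b x c y) d) (sym lin-01))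
    (trans (lin-lin a b c d 0# 1#)
      (cong₂ (λ s t → lin s x t y) (solve 3 (λ a b d → a :* b :+ d :* 𝟘 := a :* b) refl a b d)
                                   (solve 3 (λ a c d → a :* c :+ d :* 𝟙 := a :* c :+ d) refl a c d)))

  lin-collapse : ∀ a c {x} → lin a x c x ≡ lin (a + c) x 0# x
  lin-collapse a c {x} = ext λ i → trans (lookup-lin a x c x i)
    (trans (solve 3 (λ a c x → a :* x :+ c :* x := (a :+ c) :* x :+ 𝟘 :* x) refl a c (lookup x i))
           (sym (lookup-lin _ x _ x i)))

  lin-cancel : ∀ c {x y} → lin 1# (lin 1# x c y) (- c) y ≡ x
  lin-cancel c {x} {y} = trans (lin-linˡ 1# 1# c (- c))
    (trans (cong₂ (λ s t → lin s x t y) (*-identityˡ 1#) (solve 1 (λ c → 𝟙 :* c :- c := 𝟘) refl c)) lin-10)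

  lin-cancel′ : ∀ c {x y} → lin 1# (lin 1# x (- c) y) c y ≡ x
  lin-cancel′ c {x} {y} = trans (lin-linˡ 1# 1# (- c) c)
    (trans (cong₂ (λ s t → lin s x t y) (*-identityˡ 1#) (solve 1 (λ c → 𝟙 :* (:- c) :+ c := 𝟘) refl c)) lin-10)

  difference-zero : ∀ {x y} → lin 1# x (- 1#) y ≡ 𝟎 → x ≡ y
  difference-zero {x} {y} e = begin
    x                                   ≡⟨ lin-cancel′ 1# ⟨
    lin 1# (lin 1# x (- 1#) y) 1# y     ≡⟨ cong (λ z → lin 1# z 1# y) (trans e (sym lin-00)) ⟩
    lin 1# (lin 0# x 0# y) 1# y         ≡⟨ lin-linˡ 1# 0# 0# 1# ⟩
    lin (1# * 0#) x (1# * 0# + 1#) y    ≡⟨ cong₂ (λ s t → lin s x t y) (zeroʳ 1#) (solve 0 (𝟙 :* 𝟘 :+ 𝟙 := 𝟙) refl) ⟩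
    lin 0# x 1# y                       ≡⟨ lin-01 ⟩
    y                                   ∎
    where open ≡-Reasoning

  Linear : (V → F) → Set
  Linear f = ∀ a x c y → f (lin a x c y) ≡ a * f x + c * f y

  linear-0 : ∀ {f} → Linear f → f 𝟎 ≡ 0#
  linear-0 {f} f-lin = trans (cong f (sym (lin-00 {𝟎} {𝟎}))) (trans (f-lin 0# 𝟎 0# 𝟎)
    (solve 1 (λ x → 𝟘 :* x :+ 𝟘 :* x := 𝟘) refl (f 𝟎)))

  record Subspace : Set₁ where
    field
      Mem   : V → Set
      mem?  : Decidable Mem
      zero∈ : Mem 𝟎
      lin∈  : ∀ a c {x y} → Mem x → Mem y → Mem (lin a x c y)

  open Subspace public

  infix 4 _∈_ _⊆_
  _∈_ : V → Subspace → Set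
  x ∈ P = Mem P x

  _⊆_ : Subspace → Subspace → Set
  P ⊆ Q = ∀ {x} → x ∈ P → x ∈ Q

  size : Subspace → ℕ
  size P = # (mem? P)

  size-pos : ∀ P → 1 ℕ.≤ size P
  size-pos P = #-pos (mem? P) 𝟎 (zero∈ P)

  size-mono : ∀ P Q → P ⊆ Q → size P ℕ.≤ size Q
  size-mono P Q h = #-mono (mem? P) (mem? Q) (λ x → h)

  size-cong : ∀ P Q → P ⊆ Q → Q ⊆ P → size P ≡ size Q
  size-cong P Q h k = #-cong (mem? P) (mem? Q) (λ x → h) (λ x → k)

  full : Subspace
  full = record { Mem = λ _ → ⊤ ; mem? = λ _ → yes tt ; zero∈ = tt ; lin∈ = λ _ _ _ _ → tt }

  size-full : size full ≡ q ℕ.^ m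
  size-full = #-all (mem? full) (λ _ → tt)

  infixl 6 _∩_
  _∩_ : Subspace → Subspace → Subspace
  P ∩ Q = record
    { Mem   = λ x → x ∈ P × x ∈ Q
    ; mem?  = λ x → mem? P x ×-dec mem? Q x
    ; zero∈ = zero∈ P , zero∈ Q
    ; lin∈  = λ a c (p , q) (p′ , q′) → lin∈ P a c p p′ , lin∈ Q a c q q′
    }

  kernel : (f : V → F) → Linear f → Subspace
  kernel f f-lin = record
    { Mem   = λ x → f x ≡ 0#
    ; mem?  = λ x → f x ≟ 0#
    ; zero∈ = linear-0 f-lin
    ; lin∈  = λ a c {x} {y} p p′ → trans (f-lin a x c y) (trans (cong₂ (λ s t → a * s + c * t) p p′)
                (solve 2 (λ a c → a :* 𝟘 :+ c :* 𝟘 := 𝟘) refl a c))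
    }

  zeroSpace : Subspace
  zeroSpace = record
    { Mem = _≡ 𝟎 ; mem? = _≟ 𝟎 ; zero∈ = refl
    ; lin∈ = λ { a c refl refl → ext λ i → trans (lookup-lin a 𝟎 c 𝟎 i)
        (trans (cong₂ (λ s t → a * s + c * t) (lookup-𝟎 i) (lookup-𝟎 i))
          (trans (solve 2 (λ a c → a :* 𝟘 :+ c :* 𝟘 := 𝟘) refl a c) (sym (lookup-𝟎 i)))) }
    }

  adjoin : Subspace → V → Subspace
  adjoin P x = record
    { Mem   = λ y → ∃[ a ] (lin 1# y (- a) x ∈ P)
    ; mem?  = λ y → any? (λ a → mem? P (lin 1# y (- a) x))
    ; zero∈ = 0# , subst (_∈ P) (sym zero-diff) (zero∈ P)
    ; lin∈  = λ { a c {y} {z} (s , p) (t , p′) → a * s + c * t , subst (_∈ P) (lin-diff a c s t y z) (lin∈ P a c p p′) }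
    }
    where
    zero-diff : lin 1# 𝟎 (- 0#) x ≡ 𝟎
    zero-diff = ext λ i → trans (lookup-lin 1# 𝟎 (- 0#) x i)
      (trans (cong (λ z → 1# * z + - 0# * lookup x i) (lookup-𝟎 i))
        (trans (solve 1 (λ x → 𝟙 :* 𝟘 :+ (:- 𝟘) :* x := 𝟘) refl (lookup x i)) (sym (lookup-𝟎 i))))
    lin-diff : ∀ a c s t y z → lin a (lin 1# y (- s) x) c (lin 1# z (- t) x) ≡ lin 1# (lin a y c z) (- (a * s + c * t)) x
    lin-diff a c s t y z = ext λ i → begin
      lookup (lin a (lin 1# y (- s) x) c (lin 1# z (- t) x)) i
        ≡⟨ lookup-lin a _ c _ i ⟩
      a * lookup (lin 1# y (- s) x) i + c * lookup (lin 1# z (- t) x) i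
        ≡⟨ cong₂ (λ u v → a * u + c * v) (lookup-lin 1# y (- s) x i) (lookup-lin 1# z (- t) x i) ⟩
      a * (1# * lookup y i + - s * lookup x i) + c * (1# * lookup z i + - t * lookup x i)
        ≡⟨ solve 7 (λ a c s t x y z → a :* (𝟙 :* y :+ (:- s) :* x) :+ c :* (𝟙 :* z :+ (:- t) :* x)
             := 𝟙 :* (a :* y :+ c :* z) :+ (:- (a :* s :+ c :* t)) :* x) refl a c s t (lookup x i) (lookup y i) (lookup z i) ⟩
      1# * (a * lookup y i + c * lookup z i) + - (a * s + c * t) * lookup x i
        ≡⟨ cong (λ u → 1# * u + - (a * s + c * t) * lookup x i) (lookup-lin a y c z i) ⟨
      1# * lookup (lin a y c z) i + - (a * s + c * t) * lookup x i
        ≡⟨ lookup-lin 1# _ _ x i ⟨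
      lookup (lin 1# (lin a y c z) (- (a * s + c * t)) x) i ∎
      where open ≡-Reasoning

  module _ (P : Subspace) {f : V → F} (f-lin : Linear f) where

    level? : ∀ t → Decidable (λ x → x ∈ P × f x ≡ t)
    level? t x = mem? P x ×-dec f x ≟ t

    -- Translation by a multiple of p identifies all level sets of f on P.
    functional-levels : ∀ {p} → p ∈ P → f p ≢ 0# → ∀ t → q ℕ.* # (level? t) ≡ size P
    functional-levels {p} p∈P fp≢0 t = sym (trans (#-fibres (mem? P) f) (trans (∑-cong same) (∑-const _)))
      where
      s = proj₁ (inverse (f p) fp≢0)
      fp*s : f p * s ≡ 1#
      fp*s = proj₂ (inverse (f p) fp≢0)
      shift : ∀ c x → f (lin 1# x (c * s) p) ≡ f x + c
      shift c x = trans (f-lin 1# x (c * s) p) (trans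
        (solve 4 (λ x c s p → 𝟙 :* x :+ c :* s :* p := x :+ c :* (p :* s)) refl (f x) c s (f p))
        (trans (cong (λ z → f x + c * z) fp*s) (cong (f x +_) (*-identityʳ c))))
      move : ∀ u v x → x ∈ P × f x ≡ u → lin 1# x ((v - u) * s) p ∈ P × f (lin 1# x ((v - u) * s) p) ≡ v
      move u v x (x∈P , e) = lin∈ P _ _ x∈P p∈P , trans (shift (v - u) x)
        (trans (cong (_+ (v - u)) e) (solve 2 (λ u v → u :+ (v :- u) := v) refl u v))
      back : ∀ u v x → lin 1# (lin 1# x ((v - u) * s) p) ((u - v) * s) p ≡ x
      back u v x = trans (cong (λ z → lin 1# (lin 1# x ((v - u) * s) p) z p)
        (solve 3 (λ u v s → (u :- v) :* s := :- ((v :- u) :* s)) refl u v s)) (lin-cancel _)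
      same : ∀ u → # (level? u) ≡ # (level? t)
      same u = #-bij (level? u) (level? t) (λ x → lin 1# x ((t - u) * s) p) (λ x → lin 1# x ((u - t) * s) p)
        (move u t) (move t u) (λ x _ → back u t x) (λ x _ → back t u x)

  size-kernel : ∀ P {f} (f-lin : Linear f) {p} → p ∈ P → f p ≢ 0# → q ℕ.* size (P ∩ kernel f f-lin) ≡ size P
  size-kernel P f-lin p∈P fp≢0 = functional-levels P f-lin p∈P fp≢0 0#

  -- Intersecting with the coordinate hyperplanes one after another either leaves the subspace
  -- unchanged or divides its size by q, and ends at the zero space.
  dimension : ∀ P → ∃[ d ] (size P ≡ q ℕ.^ d)
  dimension P₀ = go (List.allFin m) P₀ λ x _ zs → ext λ i → trans (All.lookup zs (List.∈-allFin i)) (sym (lookup-𝟎 i))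
    where
    lookup-linear : ∀ i → Linear (λ x → lookup x i)
    lookup-linear i a x c y = lookup-lin a x c y i
    go : ∀ is P → (∀ x → x ∈ P → All (λ i → lookup x i ≡ 0#) is → x ≡ 𝟎) → ∃[ d ] (size P ≡ q ℕ.^ d)
    go [] P h = 0 , #-one (mem? P) 𝟎 (zero∈ P) λ x x∈P → h x x∈P []
    go (i ∷ is) P h with any? (λ x → mem? P x ×-dec ¬? (lookup x i ≟ 0#))
                       | go is (P ∩ kernel _ (lookup-linear i)) (λ x (x∈P , z) zs → h x x∈P (z ∷ zs))
    ... | yes (x , x∈P , xi≢0) | d , e = suc d ,
            trans (sym (size-kernel P (lookup-linear i) x∈P xi≢0)) (cong (q ℕ.*_) e)
    ... | no none | d , e = d , trans (size-cong P (P ∩ kernel _ (lookup-linear i))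
            (λ {x} x∈P → x∈P , stable x x∈P) proj₁) e
      where
      stable : ∀ x → x ∈ P → lookup x i ≡ 0#
      stable x x∈P with lookup x i ≟ 0#
      ... | yes e = e
      ... | no ne = ⊥-elim (none (x , x∈P , ne))

  module _ (P : Subspace) {x : V} where

    adjoin-elim : ∀ {y} → y ∈ adjoin P x → ∃[ a ] ∃[ p ] (p ∈ P × y ≡ lin 1# p a x)
    adjoin-elim {y} (a , p) = a , lin 1# y (- a) x , p , sym (lin-cancel′ a)

    adjoin-intro : ∀ a {p} → p ∈ P → lin 1# p a x ∈ adjoin P x
    adjoin-intro a p = a , subst (_∈ P) (sym (lin-cancel a)) p

    adjoin-⊇ : P ⊆ adjoin P x
    adjoin-⊇ p = subst (_∈ adjoin P x) lin-10 (adjoin-intro 0# p)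

    adjoin-∋ : x ∈ adjoin P x
    adjoin-∋ = 1# , subst (_∈ P) (sym (trans (lin-collapse 1# (- 1#))
      (trans (cong (λ s → lin s x 0# x) (-‿inverseʳ 1#)) lin-00))) (zero∈ P)

    -- Subtracting the two memberships puts (a - c)x into P, and a - c would be invertible. So the
    -- cosets of P making up `adjoin P x` are disjoint.
    adjoin-unique : ¬ x ∈ P → ∀ {y a c} → lin 1# y (- a) x ∈ P → lin 1# y (- c) x ∈ P → a ≡ c
    adjoin-unique x∉P {y} {a} {c} p p′ with a ≟ c
    ... | yes e = e
    ... | no a≢c = ⊥-elim (x∉P (subst (_∈ P) eq (lin∈ P (- s) s p p′)))
      where
      a-c≢0 : a - c ≢ 0#
      a-c≢0 = a≢c ∘ a-b≡0⇒a≡b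
      s = proj₁ (inverse (a - c) a-c≢0)
      eq : lin (- s) (lin 1# y (- a) x) s (lin 1# y (- c) x) ≡ x
      eq = trans (lin-lin (- s) 1# (- a) s 1# (- c)) (trans (cong₂ (λ u v → lin u y v x)
        (solve 1 (λ s → (:- s) :* 𝟙 :+ s :* 𝟙 := 𝟘) refl s)
        (trans (solve 3 (λ s a c → (:- s) :* (:- a) :+ s :* (:- c) := (a :- c) :* s) refl s a c)
               (proj₂ (inverse (a - c) a-c≢0)))) lin-01)

    size-adjoin : ¬ x ∈ P → size (adjoin P x) ≡ q ℕ.* size P
    size-adjoin x∉P = begin
      size (adjoin P x)                                       ≡⟨ ∑-cong fibre ⟩
      ∑ (λ y → ∑ (λ a → [ mem? P (lin 1# y (- a) x) ]))       ≡⟨ ∑-swap _ ⟩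
      ∑ (λ a → ∑ (λ y → [ mem? P (lin 1# y (- a) x) ]))       ≡⟨ ∑-cong translate ⟩
      ∑ {F} (λ _ → size P)                                    ≡⟨ ∑-const (size P) ⟩
      q ℕ.* size P                                            ∎
      where
      open ≡-Reasoning
      fibre : ∀ y → [ mem? (adjoin P x) y ] ≡ ∑ (λ a → [ mem? P (lin 1# y (- a) x) ])
      fibre y with mem? (adjoin P x) y
      ... | yes (a , p) = sym (#-one (λ a → mem? P (lin 1# y (- a) x)) a p λ c p′ → adjoin-unique x∉P p′ p)
      ... | no none     = sym (#-none (λ a → mem? P (lin 1# y (- a) x)) λ a p → none (a , p))
      translate : ∀ a → # (λ y → mem? P (lin 1# y (- a) x)) ≡ size P
      translate a = #-bij (λ y → mem? P (lin 1# y (- a) x)) (mem? P) (λ y → lin 1# y (- a) x) (λ y → lin 1# y a x)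
        (λ _ p → p) (λ _ p → subst (_∈ P) (sym (lin-cancel a)) p) (λ _ _ → lin-cancel′ a) (λ _ _ → lin-cancel a)

  span₁ : V → Subspace
  span₁ x = adjoin zeroSpace x

  span₂ : V → V → Subspace
  span₂ x y = adjoin (span₁ x) y

  size-span₁ : ∀ {x} → x ≢ 𝟎 → size (span₁ x) ≡ q
  size-span₁ {x} x≢0 = trans (size-adjoin zeroSpace x≢0)
    (trans (cong (q ℕ.*_) (#-one (mem? zeroSpace) 𝟎 refl (λ _ e → e))) (ℕ.*-identityʳ q))

  lin-0ˡ : ∀ a {x} → lin 1# 𝟎 a x ≡ lin a x 0# x
  lin-0ˡ a {x} = ext λ i → trans (lookup-lin 1# 𝟎 a x i) (trans (cong (λ s → 1# * s + a * lookup x i) (lookup-𝟎 i))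
    (trans (solve 2 (λ a x → 𝟙 :* 𝟘 :+ a :* x := a :* x :+ 𝟘 :* x) refl a (lookup x i)) (sym (lookup-lin a x 0# x i))))

  -- Scalar multiples are written `lin a x 0# x`, since `lin` is the only operation.
  span₁-elim : ∀ {x y} → y ∈ span₁ x → ∃[ a ] (y ≡ lin a x 0# x)
  span₁-elim {x} y∈ = let (a , p , p≡0 , e) = adjoin-elim zeroSpace y∈
    in a , trans e (trans (cong (λ z → lin 1# z a x) p≡0) (lin-0ˡ a))

  span₁-intro : ∀ a {x} → lin a x 0# x ∈ span₁ x
  span₁-intro a {x} = subst (_∈ span₁ x) (lin-0ˡ a) (adjoin-intro zeroSpace a refl)

  span₂-elim : ∀ {x y z} → z ∈ span₂ x y → ∃[ a ] ∃[ c ] (z ≡ lin a x c y)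
  span₂-elim {x} {y} z∈ =
    let (c , p , p∈ , e) = adjoin-elim (span₁ x) z∈
        (a , e′) = span₁-elim p∈
    in a , c , trans e (trans (cong (λ w → lin 1# w c y) e′) (lin-scale a c x y))
    where
    lin-scale : ∀ a c x y → lin 1# (lin a x 0# x) c y ≡ lin a x c y
    lin-scale a c x y = ext λ i → trans (lookup-lin 1# _ c y i)
      (trans (cong (λ s → 1# * s + c * lookup y i) (lookup-lin a x 0# x i))
      (trans (solve 4 (λ a c x y → 𝟙 :* (a :* x :+ 𝟘 :* x) :+ c :* y := a :* x :+ c :* y) refl a c (lookup x i) (lookup y i))
      (sym (lookup-lin a x c y i))))

  span₂-∋ˡ : ∀ {x y} → x ∈ span₂ x y
  span₂-∋ˡ {x} = adjoin-⊇ (span₁ x) (adjoin-∋ zeroSpace)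

  span₂-∋ʳ : ∀ {x y} → y ∈ span₂ x y
  span₂-∋ʳ {x} = adjoin-∋ (span₁ x)

  size-span₂ : ∀ {x y} → x ≢ 𝟎 → ¬ y ∈ span₁ x → size (span₂ x y) ≡ q ℕ.* q
  size-span₂ {x} x≢0 y∉ = trans (size-adjoin (span₁ x) y∉) (cong (q ℕ.*_) (size-span₁ x≢0))

  adjoin-least : ∀ P Q {x} → P ⊆ Q → x ∈ Q → adjoin P x ⊆ Q
  adjoin-least P Q P⊆Q x∈Q y∈ =
    let (a , p , p∈ , e) = adjoin-elim P y∈ in subst (_∈ Q) (sym e) (lin∈ Q 1# a (P⊆Q p∈) x∈Q)

  span₁-least : ∀ Q {x} → x ∈ Q → span₁ x ⊆ Q
  span₁-least Q x∈Q = adjoin-least zeroSpace Q (λ { refl → zero∈ Q }) x∈Q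

  span₂-least : ∀ Q {x y} → x ∈ Q → y ∈ Q → span₂ x y ⊆ Q
  span₂-least Q {x} x∈Q y∈Q = adjoin-least (span₁ x) Q (span₁-least Q x∈Q) y∈Q

-- Quadratic forms in odd characteristic

field-size : ∀ {q} (𝔽 : FiniteField q) → ∃[ p ] (q ≡ suc (suc p))
field-size {zero} 𝔽 with Function.Bundles.Inverse.from (FiniteField.enumeration 𝔽) (FiniteField.0# 𝔽)
  where import Function.Bundles
... | ()
field-size {suc zero} 𝔽 = ⊥-elim (0≢1 (from-injective (all-equal _ _)))
  where
  open FieldProperties 𝔽
  all-equal : (i j : Fin 1) → i ≡ j
  all-equal zero zero = refl
field-size {suc (suc p)} 𝔽 = p , refl

-- The field `η-lin` holds both the homogeneity of η and the fact that b is its polar form.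
-- Nondegeneracy concerns b alone: in odd characteristic b(x, x) = 2η(x), so a vector orthogonal to
-- everything is automatically singular.
record QuadraticSpace {q : ℕ} (𝔽 : FiniteField q) (m : ℕ) : Set where
  open FieldProperties 𝔽 renaming (Carrier to F)
  open VectorSpace 𝔽 m
  field
    η      : V → F
    b      : V → V → F
    b-sym  : ∀ x y → b x y ≡ b y x
    b-lin  : ∀ z → Linear (b z)
    η-lin  : ∀ a x c y → η (lin a x c y) ≡ a * a * η x + a * c * b x y + c * c * η y
    nondegenerate : ∀ x → (∀ y → b x y ≡ 0#) → x ≡ 𝟎
    2≢0    : 1# + 1# ≢ 0#

module Forms {q : ℕ} {𝔽 : FiniteField q} {m : ℕ} (S : QuadraticSpace 𝔽 m) where
  open FieldProperties 𝔽 renaming (Carrier to F)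
  open VectorSpace 𝔽 m
  open QuadraticSpace S

  p : ℕ
  p = suc (proj₁ (field-size 𝔽))

  q≡ : q ≡ suc p
  q≡ = proj₂ (field-size 𝔽)

  instance
    q-nonZero : ℕ.NonZero q
    q-nonZero = ℕ.>-nonZero (subst (1 ℕ.≤_) (sym q≡) (ℕ.s≤s ℕ.z≤n))

  b-linˡ : ∀ a x c y z → b (lin a x c y) z ≡ a * b x z + c * b y z
  b-linˡ a x c y z = trans (b-sym _ z) (trans (b-lin z a x c y)
    (cong₂ (λ s t → a * s + c * t) (b-sym z x) (b-sym z y)))

  η-0 : η 𝟎 ≡ 0#
  η-0 = trans (cong η (sym (lin-00 {𝟎} {𝟎}))) (trans (η-lin 0# 𝟎 0# 𝟎)
    (solve 2 (λ x y → 𝟘 :* 𝟘 :* x :+ 𝟘 :* 𝟘 :* y :+ 𝟘 :* 𝟘 :* x := 𝟘) refl (η 𝟎) (b 𝟎 𝟎)))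

  -- Obtained by expanding η(x - x) = 0.
  b-diag : ∀ x → b x x ≡ 2# * η x
  b-diag x = sym (a-b≡0⇒a≡b (trans
    (solve 2 (λ e t → (𝟙 :+ 𝟙) :* e :- t := 𝟙 :* 𝟙 :* e :+ 𝟙 :* (:- 𝟙) :* t :+ (:- 𝟙) :* (:- 𝟙) :* e) refl (η x) (b x x))
    (trans (sym (η-lin 1# x (- 1#) x)) (trans (cong η (trans (lin-collapse 1# (- 1#))
      (trans (cong (λ s → lin s x 0# x) (-‿inverseʳ 1#)) lin-00))) η-0))))

  b-diag⇒η : ∀ {x} → b x x ≡ 0# → η x ≡ 0#
  b-diag⇒η {x} e = no-zero-divisors (trans (sym (b-diag x)) e) 2≢0

  infixl 8 _⊥
  _⊥ : Subspace → Subspace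
  W ⊥ = record
    { Mem   = λ y → ∀ w → w ∈ W → b w y ≡ 0#
    ; mem?  = λ y → all? (λ w → mem? W w →-dec b w y ≟ 0#)
    ; zero∈ = λ w _ → linear-0 (b-lin w)
    ; lin∈  = λ a c {x} {y} p p′ w w∈ → lin∈ (kernel (b w) (b-lin w)) a c {x} {y} (p w w∈) (p′ w w∈)
    }

  rad : Subspace → Subspace
  rad P = P ∩ P ⊥

  zeros? : ∀ P → Decidable (λ x → x ∈ P × η x ≡ 0#)
  zeros? P x = mem? P x ×-dec η x ≟ 0#

  zeros : Subspace → ℕ
  zeros P = # (zeros? P)

  zeros-mono : ∀ P Q → P ⊆ Q → zeros P ℕ.≤ zeros Q
  zeros-mono P Q h = #-mono (zeros? P) (zeros? Q) λ x (x∈ , e) → h x∈ , e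

  zeros-cong : ∀ P Q → P ⊆ Q → Q ⊆ P → zeros P ≡ zeros Q
  zeros-cong P Q h k = ℕ.≤-antisym (zeros-mono P Q h) (zeros-mono Q P k)

  ¬⊥⇒witness : ∀ P {y} → ¬ y ∈ P ⊥ → ∃[ x ] (x ∈ P × b y x ≢ 0#)
  ¬⊥⇒witness P {y} y∉ = search (λ x → mem? P x ×-dec ¬? (b y x ≟ 0#)) λ none →
    y∉ λ w w∈ → trans (b-sym w y) (decidable-stable (b y w ≟ 0#) λ ne → none w (w∈ , ne))

  level-⊥ : ∀ P {y} → ¬ y ∈ P ⊥ → ∀ t → q ℕ.* # (level? P (b-lin y) t) ≡ size P
  level-⊥ P {y} y∉ t = let (x , x∈ , ne) = ¬⊥⇒witness P y∉ in functional-levels P (b-lin y) x∈ ne t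

  -- The shared evaluation in `pairing` and `second-moment`: there f w is the size of a level set of
  -- `b w` on P, which is all of P when w is orthogonal to P and a q-th part of it otherwise.
  split-sum : ∀ W P (f : V → ℕ) → (∀ w → w ∈ W → w ∈ P ⊥ → f w ≡ size P) →
    (∀ w → w ∈ W → ¬ w ∈ P ⊥ → q ℕ.* f w ≡ size P) →
    q ℕ.* ∑∈ (mem? W) f ≡ size (W ∩ P ⊥) ℕ.* (q ℕ.* size P)
                          ℕ.+ # (λ w → mem? W w ×-dec ¬? (mem? (P ⊥) w)) ℕ.* size P
  split-sum W P f in⊥ out⊥ = begin
    q ℕ.* ∑∈ (mem? W) f                          ≡⟨ ∑∈-* (mem? W) q f ⟨
    ∑∈ (mem? W) (λ w → q ℕ.* f w)                ≡⟨ ∑∈-split (mem? W) (mem? (P ⊥)) _ ⟩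
    ∑∈ (mem? (W ∩ P ⊥)) (λ w → q ℕ.* f w) ℕ.+ ∑∈ (λ w → mem? W w ×-dec ¬? (mem? (P ⊥) w)) (λ w → q ℕ.* f w)
      ≡⟨ cong₂ ℕ._+_ (∑∈-const (mem? (W ∩ P ⊥)) λ w (w∈ , w⊥) → cong (q ℕ.*_) (in⊥ w w∈ w⊥))
                     (∑∈-const _ λ w (w∈ , ¬w⊥) → out⊥ w w∈ ¬w⊥) ⟩
    size (W ∩ P ⊥) ℕ.* (q ℕ.* size P) ℕ.+ # (λ w → mem? W w ×-dec ¬? (mem? (P ⊥) w)) ℕ.* size P ∎
    where open ≡-Reasoning

  size-split : ∀ W P → size W ≡ size (W ∩ P ⊥) ℕ.+ # (λ w → mem? W w ×-dec ¬? (mem? (P ⊥) w))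
  size-split W P = #-split (mem? W) (mem? (P ⊥))

  -- Counts the orthogonal pairs in W × P from either side. It stands in for the dimension formula
  -- of orthogonal complements relative to P, with the radical accounted for.
  pairing : ∀ W P → size W ℕ.* size (P ∩ W ⊥) ≡ size P ℕ.* size (W ∩ P ⊥)
  pairing W P = conclude-pairing (size-split W P) (size-split P W) (begin
      A₀ ℕ.* (q ℕ.* size P) ℕ.+ A₁ ℕ.* size P    ≡⟨ sum-over W P ⟨
      q ℕ.* ∑∈ (mem? W) (λ w → # (λ y → mem? P y ×-dec b w y ≟ 0#))
        ≡⟨ cong (q ℕ.*_) (double-count (mem? W) (mem? P) (λ w y → b w y ≟ 0#)) ⟩
      q ℕ.* ∑∈ (mem? P) (λ y → # (λ w → mem? W w ×-dec b w y ≟ 0#))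
        ≡⟨ cong (q ℕ.*_) (∑-cong λ y → cong ([ mem? P y ] ℕ.*_) (#-cong (λ w → mem? W w ×-dec b w y ≟ 0#) (λ w → mem? W w ×-dec b y w ≟ 0#)
             (λ w (w∈ , e) → w∈ , trans (b-sym y w) e) (λ w (w∈ , e) → w∈ , trans (b-sym w y) e))) ⟩
      q ℕ.* ∑∈ (mem? P) (λ y → # (λ w → mem? W w ×-dec b y w ≟ 0#))  ≡⟨ sum-over P W ⟩
      B₀ ℕ.* (q ℕ.* size W) ℕ.+ B₁ ℕ.* size W    ∎)
    where
    open ≡-Reasoning
    A₀ = size (W ∩ P ⊥)
    A₁ = # (λ w → mem? W w ×-dec ¬? (mem? (P ⊥) w))
    B₀ = size (P ∩ W ⊥)
    B₁ = # (λ w → mem? P w ×-dec ¬? (mem? (W ⊥) w))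
    sum-over : ∀ W P → q ℕ.* ∑∈ (mem? W) (λ w → # (λ y → mem? P y ×-dec b w y ≟ 0#))
      ≡ size (W ∩ P ⊥) ℕ.* (q ℕ.* size P) ℕ.+ # (λ w → mem? W w ×-dec ¬? (mem? (P ⊥) w)) ℕ.* size P
    sum-over W P = split-sum W P _
      (λ w _ w⊥ → #-cong (λ y → mem? P y ×-dec b w y ≟ 0#) (mem? P) (λ _ → proj₁) (λ y y∈ → y∈ , trans (b-sym w y) (w⊥ y y∈)))
      (λ w _ ¬w⊥ → level-⊥ P ¬w⊥ 0#)
    conclude-pairing : ∀ {A B} → A ≡ A₀ ℕ.+ A₁ → B ≡ B₀ ℕ.+ B₁ →
      A₀ ℕ.* (q ℕ.* B) ℕ.+ A₁ ℕ.* B ≡ B₀ ℕ.* (q ℕ.* A) ℕ.+ B₁ ℕ.* A → A ℕ.* B₀ ≡ B ℕ.* A₀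
    conclude-pairing refl refl e = pairing-arithmetic (proj₁ (field-size 𝔽)) A₀ A₁ B₀ B₁
      (subst (λ r → A₀ ℕ.* (r ℕ.* (B₀ ℕ.+ B₁)) ℕ.+ A₁ ℕ.* (B₀ ℕ.+ B₁) ≡ B₀ ℕ.* (r ℕ.* (A₀ ℕ.+ A₁)) ℕ.+ B₁ ℕ.* (A₀ ℕ.+ A₁)) q≡ e)

  -- For d in P, the x in P with η(x + d) = η(x) form a level set of b d.
  second-moment : ∀ P → q ℕ.* ∑ (λ t → # (λ x → mem? P x ×-dec η x ≟ t) ℕ.* # (λ x → mem? P x ×-dec η x ≟ t))
    ≡ p ℕ.* (size (rad P) ℕ.* size P) ℕ.+ size P ℕ.* size P
  second-moment P = begin
    q ℕ.* ∑ (λ t → L t ℕ.* L t)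
      ≡⟨ cong (q ℕ.*_) (∑-cong λ t → square t) ⟩
    q ℕ.* ∑ (λ t → ∑ (λ x → [ mem? P x ×-dec η x ≟ t ] ℕ.* L t))
      ≡⟨ cong (q ℕ.*_) (∑-swap _) ⟩
    q ℕ.* ∑ (λ x → ∑ (λ t → [ mem? P x ×-dec η x ≟ t ] ℕ.* L t))
      ≡⟨ cong (q ℕ.*_) (∑-cong collapse) ⟩
    q ℕ.* ∑∈ (mem? P) (λ x → L (η x))
      ≡⟨ cong (q ℕ.*_) (∑∈-cong (mem? P) λ x x∈ → translate x x∈) ⟩
    q ℕ.* ∑∈ (mem? P) (λ x → # (λ d → mem? P d ×-dec b d x ≟ - η d))
      ≡⟨ cong (q ℕ.*_) (double-count (mem? P) (mem? P) (λ x d → b d x ≟ - η d)) ⟩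
    q ℕ.* ∑∈ (mem? P) (λ d → # (λ x → mem? P x ×-dec b d x ≟ - η d))
      ≡⟨ split-sum P P _ in-rad (λ d _ d∉ → level-⊥ P d∉ (- η d)) ⟩
    size (rad P) ℕ.* (q ℕ.* size P) ℕ.+ R₁ ℕ.* size P
      ≡⟨ arithmetic (size-split P P) ⟩
    p ℕ.* (size (rad P) ℕ.* size P) ℕ.+ size P ℕ.* size P ∎
    where
    open ≡-Reasoning
    R₁ = # (λ w → mem? P w ×-dec ¬? (mem? (P ⊥) w))
    L : F → ℕ
    L t = # (λ x → mem? P x ×-dec η x ≟ t)
    square : ∀ t → L t ℕ.* L t ≡ ∑ (λ x → [ mem? P x ×-dec η x ≟ t ] ℕ.* L t)
    square t = sym (trans (∑-cong λ x → ℕ.*-comm _ (L t)) (∑-* (L t) _))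
    collapse : ∀ x → ∑ (λ t → [ mem? P x ×-dec η x ≟ t ] ℕ.* L t) ≡ [ mem? P x ] ℕ.* L (η x)
    collapse x = trans (∑-single _ (η x) λ t t≢ → cong (ℕ._* L t) ([]-no (mem? P x ×-dec η x ≟ t) λ (_ , e) → t≢ (sym e)))
      (cong (ℕ._* L (η x)) ([]-cong (mem? P x ×-dec η x ≟ η x) (mem? P x) proj₁ (λ x∈ → x∈ , refl)))
    expand : ∀ x d → η (lin 1# d 1# x) ≡ η d + b d x + η x
    expand x d = trans (η-lin 1# d 1# x) (solve 3 (λ x t d → 𝟙 :* 𝟙 :* d :+ 𝟙 :* 𝟙 :* t :+ 𝟙 :* 𝟙 :* x := d :+ t :+ x) refl (η x) (b d x) (η d))
    translate : ∀ x → x ∈ P → L (η x) ≡ # (λ d → mem? P d ×-dec b d x ≟ - η d)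
    translate x x∈ = #-bij (λ y → mem? P y ×-dec η y ≟ η x) (λ d → mem? P d ×-dec b d x ≟ - η d)
      (λ y → lin 1# y (- 1#) x) (λ d → lin 1# d 1# x)
      (λ y (y∈ , e) → lin∈ P _ _ y∈ x∈ , diff (lin 1# y (- 1#) x) (trans (cong η (lin-cancel′ 1#)) e))
      (λ d (d∈ , e) → lin∈ P _ _ d∈ x∈ , trans (expand x d) (trans (cong (λ s → η d + s + η x) e)
        (solve 2 (λ x d → d :+ (:- d) :+ x := x) refl (η x) (η d))))
      (λ _ _ → lin-cancel′ 1#) (λ _ _ → lin-cancel 1#)
      where
      diff : ∀ d → η (lin 1# d 1# x) ≡ η x → b d x ≡ - η d
      diff d e = a-b≡0⇒a≡b (trans (solve 3 (λ x t d → t :- (:- d) := d :+ t :+ x :- x) refl (η x) (b d x) (η d))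
        (trans (cong (_- η x) (trans (sym (expand x d)) e)) (-‿inverseʳ (η x))))
    -- For d in the radical both sides of b(d, x) = -η(d) vanish, as 2η(d) = b(d, d) = 0, so every x
    -- of P qualifies.
    in-rad : ∀ d → d ∈ P → d ∈ P ⊥ → # (λ x → mem? P x ×-dec b d x ≟ - η d) ≡ size P
    in-rad d d∈ d⊥ = #-cong (λ x → mem? P x ×-dec b d x ≟ - η d) (mem? P) (λ _ → proj₁) λ x x∈ → x∈ ,
      trans (b-sym d x) (trans (d⊥ x x∈) (sym (trans (cong -_ (b-diag⇒η (d⊥ d d∈))) (solve 0 (:- 𝟘 := 𝟘) refl))))
    arithmetic : ∀ {A} → A ≡ size (rad P) ℕ.+ R₁ → size (rad P) ℕ.* (q ℕ.* A) ℕ.+ R₁ ℕ.* A ≡ p ℕ.* (size (rad P) ℕ.* A) ℕ.+ A ℕ.* A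
    arithmetic refl = trans (cong (λ z → size (rad P) ℕ.* (z ℕ.* (size (rad P) ℕ.+ R₁)) ℕ.+ R₁ ℕ.* (size (rad P) ℕ.+ R₁)) q≡)
                            (lem p (size (rad P)) R₁)
      where
      lem : ∀ p r s → r ℕ.* (suc p ℕ.* (r ℕ.+ s)) ℕ.+ s ℕ.* (r ℕ.+ s) ≡ p ℕ.* (r ℕ.* (r ℕ.+ s)) ℕ.+ (r ℕ.+ s) ℕ.* (r ℕ.+ s)
      lem = solve-∀

  -- (q Z(P) − |P|)² ≤ (q − 1)² |rad P| |P|, without subtraction
  zeros-variance : ∀ P → (suc p ℕ.* zeros P) ℕ.* (suc p ℕ.* zeros P) ℕ.+ size P ℕ.* size P
    ℕ.≤ 2 ℕ.* (suc p ℕ.* zeros P) ℕ.* size P ℕ.+ p ℕ.* p ℕ.* (size (rad P) ℕ.* size P)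
  zeros-variance P = variance-arithmetic p (size (rad P)) (zeros P) X Y (size P)
    (trans (ℕ.+-comm X (zeros P)) (sym (trans (#-fibres (mem? P) η) (split-0 L))))
    (trans (cong (suc p ℕ.*_) (trans (ℕ.+-comm Y _) (sym (split-0 (λ t → L t ℕ.* L t)))))
      (trans (cong (ℕ._* ∑ (λ t → L t ℕ.* L t)) (sym q≡)) (second-moment P)))
    (subst (λ k → X ℕ.* X ℕ.≤ k ℕ.* Y) nonzero-count (cauchy-schwarz nz? L))
    where
    L : F → ℕ
    L t = # (λ x → mem? P x ×-dec η x ≟ t)
    nz? : Decidable (λ t → ¬ (t ≡ 0#))
    nz? t = ¬? (t ≟ 0#)
    X = ∑∈ nz? L
    Y = ∑∈ nz? (λ t → L t ℕ.* L t)
    nonzero-count : # nz? ≡ p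
    nonzero-count = ℕ.suc-injective (trans (cong (ℕ._+ # nz?) (sym (#-one (_≟ 0#) 0# refl (λ _ e → e))))
      (trans (sym (trans (#-subset (λ _ → yes tt) (_≟ 0#) (λ _ _ → tt))
         (cong (# (_≟ 0#) ℕ.+_) (#-cong (λ x → yes tt ×-dec nz? x) nz? (λ _ → proj₂) (λ _ e → tt , e)))))
        (trans (#-all {X = F} (λ _ → yes tt) (λ _ → tt)) q≡)))
    split-0 : ∀ (f : F → ℕ) → ∑ f ≡ f 0# ℕ.+ ∑∈ nz? f
    split-0 f = trans (∑-cong λ t → sym (pointwise t (t ≟ 0#))) (trans (∑-+ _ _) (cong (ℕ._+ ∑∈ nz? f)
      (trans (∑-single (λ t → [ t ≟ 0# ] ℕ.* f t) 0# (λ t t≢ → cong (ℕ._* f t) ([]-no (t ≟ 0#) t≢)))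
        (trans (cong (ℕ._* f 0#) ([]-yes (0# ≟ 0#) refl)) (ℕ.*-identityˡ (f 0#))))))
      where
      pointwise : ∀ t (d : Dec (t ≡ 0#)) → [ d ] ℕ.* f t ℕ.+ [ ¬? d ] ℕ.* f t ≡ f t
      pointwise t (yes _) = trans (ℕ.+-identityʳ _) (ℕ.*-identityˡ (f t))
      pointwise t (no _)  = ℕ.*-identityˡ (f t)

  TotSing : Subspace → Set
  TotSing W = ∀ x → x ∈ W → η x ≡ 0#

  polarise : ∀ {x y} → η x ≡ 0# → η y ≡ 0# → η (lin 1# x 1# y) ≡ 0# → b x y ≡ 0#
  polarise {x} {y} ex ey exy = trans (sym (trans (η-lin 1# x 1# y) (trans
    (cong₂ (λ s t → 1# * 1# * s + 1# * 1# * b x y + 1# * 1# * t) ex ey)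
    (solve 1 (λ t → 𝟙 :* 𝟙 :* 𝟘 :+ 𝟙 :* 𝟙 :* t :+ 𝟙 :* 𝟙 :* 𝟘 := t) refl (b x y))))) exy

  TotSing⇒⊥ : ∀ W → TotSing W → W ⊆ W ⊥
  TotSing⇒⊥ W ts {x} x∈ w w∈ = polarise (ts w w∈) (ts x x∈) (ts _ (lin∈ W _ _ w∈ x∈))

  -- Outside W^⊥, each coset of W meets the quadric in |W|/q points.
  zeros-⊥ : ∀ P W → W ⊆ P → TotSing W → q ℕ.* zeros P ℕ.+ size (P ∩ W ⊥) ≡ size P ℕ.+ q ℕ.* zeros (P ∩ W ⊥)
  zeros-⊥ P W W⊆P ts = begin
    q ℕ.* zeros P ℕ.+ B
      ≡⟨ cong (λ z → q ℕ.* z ℕ.+ B) (trans (#-split (zeros? P) (mem? (W ⊥)))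
           (cong₂ ℕ._+_ (#-cong (λ x → zeros? P x ×-dec mem? (W ⊥) x) (zeros? (P ∩ W ⊥))
                                (λ _ ((x∈ , e) , x⊥) → (x∈ , x⊥) , e) (λ _ ((x∈ , x⊥) , e) → (x∈ , e) , x⊥))
                        (#-cong (λ x → zeros? P x ×-dec ¬? (mem? (W ⊥) x)) (λ x → out? x ×-dec η x ≟ 0#)
                                (λ _ ((x∈ , e) , x⊥) → (x∈ , x⊥) , e) (λ _ ((x∈ , x⊥) , e) → (x∈ , e) , x⊥)))) ⟩
    q ℕ.* (zeros (P ∩ W ⊥) ℕ.+ O) ℕ.+ B        ≡⟨ lem q (zeros (P ∩ W ⊥)) O B ⟩
    (B ℕ.+ q ℕ.* O) ℕ.+ q ℕ.* zeros (P ∩ W ⊥)  ≡⟨ cong (λ z → B ℕ.+ z ℕ.+ q ℕ.* zeros (P ∩ W ⊥)) outside ⟩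
    (B ℕ.+ # out?) ℕ.+ q ℕ.* zeros (P ∩ W ⊥)   ≡⟨ cong (ℕ._+ q ℕ.* zeros (P ∩ W ⊥)) (size-split P W) ⟨
    size P ℕ.+ q ℕ.* zeros (P ∩ W ⊥)           ∎
    where
    open ≡-Reasoning
    B = size (P ∩ W ⊥)
    out? : Decidable (λ x → x ∈ P × ¬ x ∈ W ⊥)
    out? x = mem? P x ×-dec ¬? (mem? (W ⊥) x)
    O = # (λ x → out? x ×-dec η x ≟ 0#)
    lem : ∀ q z o b → q ℕ.* (z ℕ.+ o) ℕ.+ b ≡ (b ℕ.+ q ℕ.* o) ℕ.+ q ℕ.* z
    lem = solve-∀
    shift-out : ∀ c {x w} → w ∈ W → x ∈ P × ¬ x ∈ W ⊥ → lin 1# x c w ∈ P × ¬ lin 1# x c w ∈ W ⊥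
    shift-out c {x} {w} w∈ (x∈ , x∉) = lin∈ P _ _ x∈ (W⊆P w∈) , λ s∈ →
      x∉ (subst (_∈ W ⊥) (lin-cancel c) (lin∈ (W ⊥) 1# (- c) s∈ (TotSing⇒⊥ W ts w∈)))
    -η : ∀ x → F
    -η x = - η x
    expand : ∀ x w → w ∈ W → η (lin 1# x 1# w) ≡ b x w - (-η x)
    expand x w w∈ = trans (η-lin 1# x 1# w) (trans (cong (λ s → 1# * 1# * η x + 1# * 1# * b x w + 1# * 1# * s) (ts w w∈))
      (solve 2 (λ x t → 𝟙 :* 𝟙 :* x :+ 𝟙 :* 𝟙 :* t :+ 𝟙 :* 𝟙 :* 𝟘 := t :- (:- x)) refl (η x) (b x w)))
    translate : ∀ w → w ∈ W → # (λ x → out? x ×-dec b x w ≟ -η x) ≡ O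
    translate w w∈ = #-bij (λ x → out? x ×-dec b x w ≟ -η x) (λ x → out? x ×-dec η x ≟ 0#)
      (λ x → lin 1# x 1# w) (λ x → lin 1# x (- 1#) w)
      (λ x (o , e) → shift-out 1# w∈ o , trans (expand x w w∈) (trans (cong (_- (-η x)) e) (-‿inverseʳ _)))
      (λ x (o , e) → shift-out (- 1#) w∈ o , a-b≡0⇒a≡b (trans (sym (expand (lin 1# x (- 1#) w) w w∈)) (trans (cong η (lin-cancel′ 1#)) e)))
      (λ _ _ → lin-cancel 1#) (λ _ _ → lin-cancel′ 1#)
    -- Double count of the pairs (w, x) with w in W, x in P outside W^⊥ and x + w singular. For
    -- fixed w, translation by w gives O of them; for fixed x, the condition is a level of `b x` on
    -- W, of size |W|/q.
    outside : q ℕ.* O ≡ # out?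
    outside = ℕ.*-cancelˡ-≡ _ _ (size W) {{ℕ.>-nonZero (size-pos W)}} (begin
      size W ℕ.* (q ℕ.* O)  ≡⟨ lem₂ (size W) q O ⟩
      q ℕ.* (size W ℕ.* O)  ≡⟨ cong (q ℕ.*_) (∑∈-const (mem? W) translate) ⟨
      q ℕ.* ∑∈ (mem? W) (λ w → # (λ x → out? x ×-dec b x w ≟ -η x))
        ≡⟨ cong (q ℕ.*_) (double-count (mem? W) out? (λ w x → b x w ≟ -η x)) ⟩
      q ℕ.* ∑∈ out? (λ x → # (λ w → mem? W w ×-dec b x w ≟ -η x))
        ≡⟨ ∑∈-* out? q _ ⟨
      ∑∈ out? (λ x → q ℕ.* # (λ w → mem? W w ×-dec b x w ≟ -η x))
        ≡⟨ ∑∈-const out? (λ x (_ , x∉) → level-⊥ W x∉ (-η x)) ⟩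
      # out? ℕ.* size W     ≡⟨ ℕ.*-comm (# out?) (size W) ⟩
      size W ℕ.* # out?     ∎)
      where
      lem₂ : ∀ w q o → w ℕ.* (q ℕ.* o) ≡ q ℕ.* (w ℕ.* o)
      lem₂ = solve-∀

  adjoin-TotSing : ∀ W {y} → TotSing W → y ∈ W ⊥ → η y ≡ 0# → TotSing (adjoin W y)
  adjoin-TotSing W {y} ts y⊥ ey z z∈ = let (a , w , w∈ , e) = adjoin-elim W z∈ in
    trans (cong η e) (trans (η-lin 1# w a y) (trans
      (cong₂ (λ s t → 1# * 1# * s + 1# * a * t + a * a * η y) (ts w w∈) (y⊥ w w∈))
      (trans (cong (λ s → 1# * 1# * 0# + 1# * a * 0# + a * a * s) ey)
      (solve 1 (λ a → 𝟙 :* 𝟙 :* 𝟘 :+ 𝟙 :* a :* 𝟘 :+ a :* a :* 𝟘 := 𝟘) refl a))))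

  zeroSpace-TotSing : TotSing zeroSpace
  zeroSpace-TotSing x e = trans (cong η e) η-0

  record MaximalTotSing (P : Subspace) : Set₁ where
    field
      W       : Subspace
      W⊆P     : W ⊆ P
      totSing : TotSing W
      maximal : ∀ {y} → y ∈ P → y ∈ W ⊥ → η y ≡ 0# → y ∈ W

  -- Singular vectors of P ∩ W^⊥ are adjoined to W until none is left outside, at which point η is
  -- anisotropic on (P ∩ W^⊥)/W. Each step enlarges W, so |W| + `fuel` never falls below |P|.
  maximalTotSing : ∀ P → MaximalTotSing P
  maximalTotSing P = grow (size P) zeroSpace (λ e → subst (_∈ P) (sym e) (zero∈ P)) zeroSpace-TotSing
    (ℕ.m≤n+m (size P) (size zeroSpace))
    where
    grow : ∀ fuel W → W ⊆ P → TotSing W → size P ℕ.≤ size W ℕ.+ fuel → MaximalTotSing P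
    grow fuel W W⊆P ts le with any? (λ y → (mem? P y ×-dec ¬? (mem? W y)) ×-dec (mem? (W ⊥) y ×-dec η y ≟ 0#))
    ... | no none = record { W = W ; W⊆P = W⊆P ; totSing = ts ; maximal = λ {y} y∈ y⊥ e →
            decidable-stable (mem? W y) λ y∉ → none (y , (y∈ , y∉) , y⊥ , e) }
    grow zero W W⊆P ts le | yes (y , (y∈ , y∉) , _) = ⊥-elim (y∉ (#-full (mem? P) (mem? W) (λ _ → W⊆P)
            (subst (size P ℕ.≤_) (ℕ.+-identityʳ _) le) y y∈))
    grow (suc fuel) W W⊆P ts le | yes (y , (y∈ , y∉) , y⊥ , e) =
      grow fuel (adjoin W y) (adjoin-least W P W⊆P y∈) (adjoin-TotSing W ts y⊥ e)
        (ℕ.≤-trans le (ℕ.≤-trans (ℕ.≤-reflexive (ℕ.+-suc (size W) fuel)) (ℕ.+-monoˡ-≤ fuel larger)))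
      where
      larger : suc (size W) ℕ.≤ size (adjoin W y)
      larger with suc (size W) ℕ.≤? size (adjoin W y)
      ... | yes h = h
      ... | no ¬h = ⊥-elim (y∉ (#-full (mem? (adjoin W y)) (mem? W) (λ _ → adjoin-⊇ W)
                      (ℕ.≤-pred (ℕ.≰⇒> ¬h)) y (adjoin-∋ W)))

  1<q : 1 ℕ.< q
  1<q = subst (1 ℕ.<_) (sym q≡) (ℕ.s≤s (ℕ.s≤s ℕ.z≤n))

  exponent-≤ : ∀ {a c} → q ℕ.^ a ℕ.≤ q ℕ.^ c → a ℕ.≤ c
  exponent-≤ {a} {c} le with a ℕ.≤? c
  ... | yes h = h
  ... | no ¬h = ⊥-elim (ℕ.<-irrefl refl (ℕ.<-≤-trans (ℕ.^-monoʳ-< q 1<q (ℕ.≰⇒> ¬h)) le))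

  exponent-≡ : ∀ {a c} → q ℕ.^ a ≡ q ℕ.^ c → a ≡ c
  exponent-≡ e = ℕ.≤-antisym (exponent-≤ (ℕ.≤-reflexive e)) (exponent-≤ (ℕ.≤-reflexive (sym e)))

  -- If zeros(P) ≠ |P|/q, then W^⊥/W inside P is anisotropic of odd dimension at least 3,
  -- and its lack of zeros contradicts zeros-variance.
  zeros-odd : ∀ P k → size P ℕ.* size (rad P) ≡ q ℕ.^ suc (2 ℕ.* k) → q ℕ.* zeros P ≡ size P
  zeros-odd P k sizes = conclude (proj₁ split) (proj₂ split)
    where
    open MaximalTotSing (maximalTotSing P)
    B = size (P ∩ W ⊥)
    rad⊆W : rad P ⊆ W
    rad⊆W (x∈ , x⊥) = maximal x∈ (λ w w∈ → x⊥ w (W⊆P w∈)) (b-diag⇒η (x⊥ _ x∈))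
    product : size W ℕ.* B ≡ size (rad P) ℕ.* size P
    product = trans (pairing W P) (trans (ℕ.*-comm (size P) _) (cong (ℕ._* size P)
      (size-cong (W ∩ P ⊥) (rad P) (λ (x∈ , x⊥) → W⊆P x∈ , x⊥) (λ x∈ → rad⊆W x∈ , proj₂ x∈))))
    zeros-B : zeros (P ∩ W ⊥) ≡ size W
    zeros-B = #-cong (zeros? (P ∩ W ⊥)) (mem? W) (λ _ ((x∈ , x⊥) , e) → maximal x∈ x⊥ e)
      (λ x x∈ → (W⊆P x∈ , TotSing⇒⊥ W totSing x∈) , totSing x x∈)
    balance : q ℕ.* zeros P ℕ.+ B ≡ size P ℕ.+ q ℕ.* size W
    balance = trans (zeros-⊥ P W W⊆P totSing) (cong (λ z → size P ℕ.+ q ℕ.* z) zeros-B)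
    a = proj₁ (dimension W)
    c = proj₁ (dimension (P ∩ W ⊥))
    W≡ : size W ≡ q ℕ.^ a
    W≡ = proj₂ (dimension W)
    B≡ : B ≡ q ℕ.^ c
    B≡ = proj₂ (dimension (P ∩ W ⊥))
    a+c : a ℕ.+ c ≡ suc (2 ℕ.* k)
    a+c = exponent-≡ (trans (ℕ.^-distribˡ-+-* q a c) (trans (cong₂ ℕ._*_ (sym W≡) (sym B≡))
      (trans product (trans (ℕ.*-comm (size (rad P)) _) sizes))))
    a≤c : a ℕ.≤ c
    a≤c = exponent-≤ (ℕ.≤-trans (ℕ.≤-reflexive (sym W≡)) (ℕ.≤-trans
      (size-mono W (P ∩ W ⊥) (λ x∈ → W⊆P x∈ , TotSing⇒⊥ W totSing x∈)) (ℕ.≤-reflexive B≡)))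
    -- The exponents satisfy a ≤ c and a + c is odd, so (P ∩ W^⊥)/W has odd dimension c - a = 2j +
    -- 1. For j = 0 the balance equation is already the claim; j ≥ 1 has to be refuted.
    split : ∃[ j ] (c ≡ suc (2 ℕ.* j) ℕ.+ a)
    split = let (j , e) = ℕ.m≤n⇒∃[o]m+o≡n a≤k in
      j , ℕ.+-cancelˡ-≡ a _ _ (trans a+c (trans (cong (λ z → suc (2 ℕ.* z)) (sym e)) (lem a j)))
      where
      a≤k : a ℕ.≤ k
      a≤k = ℕ.*-cancelˡ-≤ 2 (ℕ.≤-pred (ℕ.≤∧≢⇒< (ℕ.≤-trans (ℕ.≤-reflexive (lem a)) (ℕ.≤-trans (ℕ.+-monoʳ-≤ a a≤c) (ℕ.≤-reflexive a+c))) (odd a k)))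
        where
        lem : ∀ a → 2 ℕ.* a ≡ a ℕ.+ a
        lem = solve-∀
        odd : ∀ a k → 2 ℕ.* a ≢ suc (2 ℕ.* k)
        odd a k e = ℕ.even≢odd a k e
      lem : ∀ a j → suc (2 ℕ.* (a ℕ.+ j)) ≡ a ℕ.+ (suc (2 ℕ.* j) ℕ.+ a)
      lem = solve-∀
    conclude : ∀ j → c ≡ suc (2 ℕ.* j) ℕ.+ a → q ℕ.* zeros P ≡ size P
    conclude zero e = ℕ.+-cancelʳ-≡ B _ _ (trans balance (cong (size P ℕ.+_)
      (sym (trans B≡ (trans (cong (q ℕ.^_) e) (cong (q ℕ.*_) (sym W≡)))))))
    conclude (suc i) e = ⊥-elim (anisotropic-arithmetic p (size W) B (size P) (zeros P) G (ℕ.s≤s ℕ.z≤n) (size-pos W)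
      2≤G (trans B≡ (trans (cong (q ℕ.^_) e) B-shape)) (subst (λ r → r ℕ.* zeros P ℕ.+ B ≡ size P ℕ.+ r ℕ.* size W) q≡ balance)
      (subst (λ r → (suc p ℕ.* zeros P) ℕ.* (suc p ℕ.* zeros P) ℕ.+ size P ℕ.* size P
        ℕ.≤ 2 ℕ.* (suc p ℕ.* zeros P) ℕ.* size P ℕ.+ p ℕ.* p ℕ.* r) (sym product) (zeros-variance P)))
      where
      -- Here |P ∩ W^⊥| = q^(2i + 3)|W| = q²G|W|. Only G ≥ 2 matters for the contradiction.
      G = q ℕ.* q ℕ.^ (2 ℕ.* i)
      2≤G : 2 ℕ.≤ G
      2≤G = ℕ.≤-trans 1<q (ℕ.m≤m*n q (q ℕ.^ (2 ℕ.* i)) {{ℕ.m^n≢0 q (2 ℕ.* i)}})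
      B-shape : q ℕ.^ (suc (2 ℕ.* suc i) ℕ.+ a) ≡ suc p ℕ.* (suc p ℕ.* G) ℕ.* size W
      B-shape = begin
        q ℕ.^ (suc (2 ℕ.* suc i) ℕ.+ a)            ≡⟨ cong (λ z → q ℕ.^ z) (lem i a) ⟩
        q ℕ.^ (suc (suc (suc (2 ℕ.* i ℕ.+ a))))    ≡⟨ cong (λ z → q ℕ.* (q ℕ.* (q ℕ.* z))) (ℕ.^-distribˡ-+-* q (2 ℕ.* i) a) ⟩
        q ℕ.* (q ℕ.* (q ℕ.* (q ℕ.^ (2 ℕ.* i) ℕ.* q ℕ.^ a))) ≡⟨ assoc q q q (q ℕ.^ (2 ℕ.* i)) (q ℕ.^ a) ⟩
        q ℕ.* (q ℕ.* G) ℕ.* q ℕ.^ a                ≡⟨ cong₂ (λ r s → r ℕ.* (r ℕ.* G) ℕ.* s) q≡ (sym W≡) ⟩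
        suc p ℕ.* (suc p ℕ.* G) ℕ.* size W         ∎
        where
        open ≡-Reasoning
        lem : ∀ i a → suc (2 ℕ.* suc i) ℕ.+ a ≡ suc (suc (suc (2 ℕ.* i ℕ.+ a)))
        lem = solve-∀
        assoc : ∀ a b c d e → a ℕ.* (b ℕ.* (c ℕ.* (d ℕ.* e))) ≡ a ℕ.* (b ℕ.* (c ℕ.* d)) ℕ.* e
        assoc = solve-∀

  full⊥ : ∀ {x} → x ∈ full ⊥ → x ≡ 𝟎
  full⊥ {x} x⊥ = nondegenerate x λ y → trans (b-sym x y) (x⊥ y tt)

  size-⊥ : ∀ W → size W ℕ.* size (W ⊥) ≡ q ℕ.^ m
  size-⊥ W = begin
    size W ℕ.* size (W ⊥)          ≡⟨ cong (size W ℕ.*_) (size-cong (W ⊥) (full ∩ W ⊥) (λ x∈ → tt , x∈) proj₂) ⟩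
    size W ℕ.* size (full ∩ W ⊥)   ≡⟨ pairing W full ⟩
    size full ℕ.* size (W ∩ full ⊥) ≡⟨ cong₂ ℕ._*_ size-full (#-one (mem? (W ∩ full ⊥)) 𝟎 (zero∈ (W ∩ full ⊥)) (λ _ x∈ → full⊥ (proj₂ x∈))) ⟩
    q ℕ.^ m ℕ.* 1                  ≡⟨ ℕ.*-identityʳ _ ⟩
    q ℕ.^ m                        ∎
    where open ≡-Reasoning

  -- W is contained in its double orthogonal, and both have size q^m / |W^⊥|.
  ⊥⊥ : ∀ W → W ⊥ ⊥ ⊆ W
  ⊥⊥ W {x} x∈ = #-full (mem? (W ⊥ ⊥)) (mem? W) (λ w w∈ v v∈ → trans (b-sym v w) (v∈ w w∈))
    (ℕ.≤-reflexive (ℕ.*-cancelʳ-≡ _ _ (size (W ⊥)) {{ℕ.>-nonZero (size-pos (W ⊥))}}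
      (trans (ℕ.*-comm (size (W ⊥ ⊥)) _) (trans (size-⊥ (W ⊥)) (sym (size-⊥ W)))))) x x∈

  span₁-⊥ : ∀ {x y} → b x y ≡ 0# → y ∈ span₁ x ⊥
  span₁-⊥ {x} {y} e w w∈ = let (a , eq) = span₁-elim w∈ in trans (cong (λ z → b z y) eq) (trans (b-linˡ a x 0# x y)
    (trans (cong (λ s → a * s + 0# * s) e) (solve 1 (λ a → a :* 𝟘 :+ 𝟘 :* 𝟘 := 𝟘) refl a)))

  span₂-⊥ : ∀ {x y z} → b x z ≡ 0# → b y z ≡ 0# → z ∈ span₂ x y ⊥
  span₂-⊥ {x} {y} {z} e e′ w w∈ = let (a , c , eq) = span₂-elim w∈ in trans (cong (λ u → b u z) eq) (trans (b-linˡ a x c y z)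
    (trans (cong₂ (λ s t → a * s + c * t) e e′) (solve 2 (λ a c → a :* 𝟘 :+ c :* 𝟘 := 𝟘) refl a c)))

  span₁-TotSing : ∀ {x} → η x ≡ 0# → TotSing (span₁ x)
  span₁-TotSing e = adjoin-TotSing zeroSpace zeroSpace-TotSing (λ { w refl → trans (b-sym 𝟎 _) (linear-0 (b-lin _)) }) e

  span₂-TotSing : ∀ {x y} → η x ≡ 0# → η y ≡ 0# → b x y ≡ 0# → TotSing (span₂ x y)
  span₂-TotSing {x} ex ey e = adjoin-TotSing (span₁ x) (span₁-TotSing ex) (span₁-⊥ e) ey

-- Dimension 2n + 1

-- The dimension is 2n + 1 with n = k + 1, and Q = q ^ (n − 1).
module Parabolic {q : ℕ} {𝔽 : FiniteField q} (k : ℕ) (S : QuadraticSpace 𝔽 (2 ℕ.* suc k ℕ.+ 1)) where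
  m : ℕ
  m = 2 ℕ.* suc k ℕ.+ 1

  open FieldProperties 𝔽 public renaming (Carrier to F)
  open VectorSpace 𝔽 (2 ℕ.* suc k ℕ.+ 1) public
  open QuadraticSpace S public
  open Forms S public

  Q : ℕ
  Q = q ℕ.^ k

  instance
    Q-nonZero : ℕ.NonZero Q
    Q-nonZero = ℕ.m^n≢0 q k

  q^2k : q ℕ.^ (2 ℕ.* k) ≡ Q ℕ.* Q
  q^2k = trans (cong (q ℕ.^_) (lem k)) (ℕ.^-distribˡ-+-* q k k)
    where
    lem : ∀ k → 2 ℕ.* k ≡ k ℕ.+ k
    lem = solve-∀

  m≡ : m ≡ suc (2 ℕ.* suc k)
  m≡ = ℕ.+-comm (2 ℕ.* suc k) 1

  q^m : q ℕ.^ m ≡ q ℕ.* (q ℕ.* (q ℕ.* (Q ℕ.* Q)))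
  q^m = trans (cong (q ℕ.^_) (lem k)) (cong (λ z → q ℕ.* (q ℕ.* (q ℕ.* z))) q^2k)
    where
    lem : ∀ k → 2 ℕ.* suc k ℕ.+ 1 ≡ suc (suc (suc (2 ℕ.* k)))
    lem = solve-∀

  q-cancel : ∀ {a c} → q ℕ.* a ≡ q ℕ.* c → a ≡ c
  q-cancel = ℕ.*-cancelˡ-≡ _ _ q

  q-zeros-full : q ℕ.* zeros full ≡ size full
  q-zeros-full = zeros-odd full (suc k) (trans (cong (size full ℕ.*_)
    (#-one (mem? (rad full)) 𝟎 (zero∈ (rad full)) (λ _ x∈ → full⊥ (proj₂ x∈))))
    (trans (ℕ.*-identityʳ _) (trans size-full (cong (q ℕ.^_) m≡))))

  zeros-full : zeros full ≡ q ℕ.* (q ℕ.* (Q ℕ.* Q))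
  zeros-full = q-cancel (trans q-zeros-full (trans size-full q^m))

  -- `zeros-⊥` with P the whole space compares the zeros inside W^⊥ with all zeros; the proportion
  -- 1/q of the whole space is thereby inherited by W^⊥.
  zeros-TotSing-⊥ : ∀ W → TotSing W → q ℕ.* zeros (W ⊥) ≡ size (W ⊥)
  zeros-TotSing-⊥ W ts = sym (ℕ.+-cancelˡ-≡ (size full) _ _ (begin
    size full ℕ.+ size (W ⊥)             ≡⟨ cong₂ ℕ._+_ (sym q-zeros-full) (size-cong (W ⊥) (full ∩ W ⊥) (λ x∈ → tt , x∈) proj₂) ⟩
    q ℕ.* zeros full ℕ.+ size (full ∩ W ⊥)  ≡⟨ zeros-⊥ full W (λ _ → tt) ts ⟩
    size full ℕ.+ q ℕ.* zeros (full ∩ W ⊥)  ≡⟨ cong (λ z → size full ℕ.+ q ℕ.* z) (zeros-cong (full ∩ W ⊥) (W ⊥) proj₂ (λ x∈ → tt , x∈)) ⟩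
    size full ℕ.+ q ℕ.* zeros (W ⊥)      ∎))
    where open ≡-Reasoning

  -- W lies in W^⊥, so |W|² ≤ |W| |W^⊥| = q^(2n + 1), and the even exponent of |W|² is at most 2n.
  size-TotSing : ∀ W → TotSing W → size W ℕ.≤ q ℕ.* Q
  size-TotSing W ts = ℕ.≤-trans (ℕ.≤-reflexive W≡) (ℕ.^-monoʳ-≤ q d≤)
    where
    d = proj₁ (dimension W)
    W≡ : size W ≡ q ℕ.^ d
    W≡ = proj₂ (dimension W)
    2d≤ : 2 ℕ.* d ℕ.≤ suc (2 ℕ.* suc k)
    2d≤ = exponent-≤ (ℕ.≤-trans (ℕ.≤-reflexive (trans (cong (q ℕ.^_) (lem d)) (trans (ℕ.^-distribˡ-+-* q d d) (cong₂ ℕ._*_ (sym W≡) (sym W≡)))))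
      (ℕ.≤-trans (ℕ.*-monoʳ-≤ (size W) (size-mono W (W ⊥) (TotSing⇒⊥ W ts)))
        (ℕ.≤-reflexive (trans (size-⊥ W) (cong (q ℕ.^_) m≡)))))
      where
      lem : ∀ d → 2 ℕ.* d ≡ d ℕ.+ d
      lem = solve-∀
    d≤ : d ℕ.≤ suc k
    d≤ = ℕ.*-cancelˡ-≤ 2 (ℕ.≤-pred (ℕ.≤∧≢⇒< 2d≤ (ℕ.even≢odd d (suc k))))

  size-span₁-⊥ : ∀ {x} → x ≢ 𝟎 → size (span₁ x ⊥) ≡ q ℕ.* (q ℕ.* (Q ℕ.* Q))
  size-span₁-⊥ {x} x≢0 = q-cancel (trans (cong (ℕ._* size (span₁ x ⊥)) (sym (size-span₁ x≢0))) (trans (size-⊥ (span₁ x)) q^m))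

  size-span₂-⊥ : ∀ {x y} → x ≢ 𝟎 → ¬ y ∈ span₁ x → size (span₂ x y ⊥) ≡ q ℕ.* (Q ℕ.* Q)
  size-span₂-⊥ {x} {y} x≢0 y∉ = q-cancel (q-cancel (trans (sym (ℕ.*-assoc q q _))
    (trans (cong (ℕ._* size (span₂ x y ⊥)) (sym (size-span₂ x≢0 y∉))) (trans (size-⊥ (span₂ x y)) q^m))))

  zeros-bound : ∀ P → size P ≡ q ℕ.* (Q ℕ.* Q) → size (rad P) ℕ.≤ q → zeros P ℕ.≤ maxZeros p Q
  zeros-bound P P≡ R≤ = zeros-bound-arithmetic p Q (size (rad P)) (zeros P) (subst (size (rad P) ℕ.≤_) q≡ R≤)
    (subst (λ N → (suc p ℕ.* zeros P) ℕ.* (suc p ℕ.* zeros P) ℕ.+ N ℕ.* N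
      ℕ.≤ 2 ℕ.* (suc p ℕ.* zeros P) ℕ.* N ℕ.+ p ℕ.* p ℕ.* (size (rad P) ℕ.* N)) (trans P≡ (cong (ℕ._* (Q ℕ.* Q)) q≡)) (zeros-variance P))

  common? : ∀ x w → Decidable (λ y → (b x y ≡ 0# × b w y ≡ 0#) × η y ≡ 0#)
  common? x w y = (b x y ≟ 0# ×-dec b w y ≟ 0#) ×-dec η y ≟ 0#

  -- With w = T x this is the number of partners y of a singular x in the pair count, the multiples
  -- of x included.
  common : V → V → ℕ
  common x w = # (common? x w)

  common-span₂ : ∀ x w → common x w ≡ zeros (span₂ x w ⊥)
  common-span₂ x w = #-cong (common? x w) (zeros? (span₂ x w ⊥)) (λ _ ((e , e′) , z) → span₂-⊥ e e′ , z)
    (λ y (y⊥ , z) → (y⊥ x span₂-∋ˡ , y⊥ w span₂-∋ʳ) , z)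

  common-dependent : ∀ {x w} → x ≢ 𝟎 → η x ≡ 0# → w ∈ span₁ x → common x w ≡ q ℕ.* (Q ℕ.* Q)
  common-dependent {x} {w} x≢0 ex w∈ = q-cancel (begin
    q ℕ.* common x w            ≡⟨ cong (q ℕ.*_) (trans (common-span₂ x w) (zeros-cong (span₂ x w ⊥) (span₁ x ⊥)
                                     (λ y⊥ v v∈ → y⊥ v (adjoin-⊇ (span₁ x) v∈))
                                     (λ y⊥ v v∈ → y⊥ v (adjoin-least (span₁ x) (span₁ x) (λ z → z) w∈ v∈)))) ⟩
    q ℕ.* zeros (span₁ x ⊥)     ≡⟨ zeros-TotSing-⊥ (span₁ x) (span₁-TotSing ex) ⟩
    size (span₁ x ⊥)            ≡⟨ size-span₁-⊥ x≢0 ⟩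
    q ℕ.* (q ℕ.* (Q ℕ.* Q))     ∎)
    where open ≡-Reasoning

  common-singular : ∀ {x w} → x ≢ 𝟎 → η x ≡ 0# → η w ≡ 0# → b x w ≡ 0# → ¬ w ∈ span₁ x → common x w ≡ Q ℕ.* Q
  common-singular {x} {w} x≢0 ex ew e w∉ = q-cancel (begin
    q ℕ.* common x w             ≡⟨ cong (q ℕ.*_) (common-span₂ x w) ⟩
    q ℕ.* zeros (span₂ x w ⊥)    ≡⟨ zeros-TotSing-⊥ (span₂ x w) (span₂-TotSing ex ew e) ⟩
    size (span₂ x w ⊥)           ≡⟨ size-span₂-⊥ x≢0 w∉ ⟩
    q ℕ.* (Q ℕ.* Q)              ∎)
    where open ≡-Reasoning

  -- The radical of ⟨x, w⟩^⊥ lies in ⟨x, w⟩; orthogonality to w together with b(w, w) ≠ 0 removes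
  -- the w-component. So the radical has at most q elements and the variance bound applies.
  common-nonsingular : ∀ {x w} → x ≢ 𝟎 → η x ≡ 0# → η w ≢ 0# → b x w ≡ 0# → common x w ℕ.≤ maxZeros p Q
  common-nonsingular {x} {w} x≢0 ex ew e = subst (ℕ._≤ maxZeros p Q) (sym (common-span₂ x w))
    (zeros-bound (span₂ x w ⊥) (size-span₂-⊥ x≢0 w∉) (subst (size (rad (span₂ x w ⊥)) ℕ.≤_) (size-span₁ x≢0)
      (size-mono (rad (span₂ x w ⊥)) (span₁ x) rad⊆)))
    where
    w∉ : ¬ w ∈ span₁ x
    w∉ w∈ = ew (span₁-TotSing ex w w∈)
    rad⊆ : rad (span₂ x w ⊥) ⊆ span₁ x
    rad⊆ {y} (y⊥ , y⊥⊥) = let (a , c , eq) = span₂-elim (⊥⊥ (span₂ x w) y⊥⊥) in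
      subst (_∈ span₁ x) (sym (trans eq (reduce a c (c≡0 a c (trans (cong (b w) (sym eq)) (y⊥ w span₂-∋ʳ)))))) (span₁-intro a)
      where
      c≡0 : ∀ a c → b w (lin a x c w) ≡ 0# → c ≡ 0#
      c≡0 a c h = no-zero-divisors {b w w} (trans (*-comm _ c) (trans (solve 3 (λ a c t → c :* t := a :* 𝟘 :+ c :* t) refl a c (b w w))
        (trans (cong (λ s → a * s + c * b w w) (sym (trans (b-sym w x) e))) (trans (sym (b-lin w a x c w)) h))))
        (λ z → ew (b-diag⇒η z))
      reduce : ∀ a c → c ≡ 0# → lin a x c w ≡ lin a x 0# x
      reduce a c refl = ext λ i → trans (lookup-lin a x 0# w i) (trans
        (solve 3 (λ a x w → a :* x :+ 𝟘 :* w := a :* x :+ 𝟘 :* x) refl a (lookup x i) (lookup w i)) (sym (lookup-lin a x 0# x i)))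

  Singular? : Decidable (λ x → x ≢ 𝟎 × η x ≡ 0#)
  Singular? x = ¬? (x ≟ 𝟎) ×-dec η x ≟ 0#

  Q₁ : ℕ
  Q₁ = ℕ.pred Q

  Q≡ : Q ≡ suc Q₁
  Q≡ = sym (ℕ.suc-pred Q)

  -- The zero vector is a zero of η but is excluded by `Singular?`; this accounts for the shifts by
  -- one in the later counts.
  singular-nonzero : ∀ {A : V → Set} (A? : Decidable A) → A 𝟎 → # (λ x → A? x ×-dec η x ≟ 0#) ≡ suc (# (λ x → Singular? x ×-dec A? x))
  singular-nonzero A? a0 = trans (#-subset (λ x → A? x ×-dec η x ≟ 0#) (_≟ 𝟎) (λ { x refl → a0 , η-0 }))
    (cong₂ ℕ._+_ (#-one (_≟ 𝟎) 𝟎 refl (λ _ e → e))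
      (#-cong (λ x → (A? x ×-dec η x ≟ 0#) ×-dec ¬? (x ≟ 𝟎)) (λ x → Singular? x ×-dec A? x)
        (λ _ ((a , e) , ne) → (ne , e) , a) (λ _ ((ne , e) , a) → (a , e) , ne)))

  b-scale : ∀ a x y → b (lin a x 0# x) y ≡ a * b x y
  b-scale a x y = trans (b-linˡ a x 0# x y) (solve 2 (λ a t → a :* t :+ 𝟘 :* t := a :* t) refl a (b x y))

  b-scaleʳ : ∀ a x y → b y (lin a x 0# x) ≡ a * b y x
  b-scaleʳ a x y = trans (b-sym y _) (trans (b-scale a x y) (cong (a *_) (b-sym x y)))

  scale-zero : ∀ {a x} → a ≢ 0# → lin a x 0# x ≡ 𝟎 → x ≡ 𝟎
  scale-zero {a} {x} a≢0 e = let (c , ac) = inverse a a≢0 in begin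
    x                              ≡⟨ lin-10 ⟨
    lin 1# x 0# x                  ≡⟨ cong₂ (λ s t → lin s x t x) (trans (sym ac) (solve 2 (λ a c → a :* c := c :* a :+ 𝟘 :* 𝟘) refl a c)) (solve 1 (λ c → 𝟘 := c :* 𝟘 :+ 𝟘 :* 𝟘) refl c) ⟩
    lin (c * a + 0# * 0#) x (c * 0# + 0# * 0#) x    ≡⟨ lin-lin c a 0# 0# 0# 0# ⟨
    lin c (lin a x 0# x) 0# (lin 0# x 0# x)         ≡⟨ lin∈ zeroSpace c 0# e lin-00 ⟩
    𝟎                             ∎
    where open ≡-Reasoning

-- Skew maps and the upper bound

module _ {q : ℕ} {𝔽 : FiniteField q} (k : ℕ) (S : QuadraticSpace 𝔽 (2 ℕ.* suc k ℕ.+ 1)) where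
  open Parabolic k S

  module SkewMap
    (T : V → V)
    (T-lin : ∀ a x c y → T (lin a x c y) ≡ lin a (T x) c (T y))
    (T-alt : ∀ x → b (T x) x ≡ 0#)
    where

    T-skew : ∀ x y → b (T x) y ≡ - b x (T y)
    T-skew x y = a-b≡0⇒a≡b (begin
      b (T x) y - (- b x (T y))                  ≡⟨ cong (λ z → b (T x) y - (- z)) (b-sym x (T y)) ⟩
      b (T x) y - (- b (T y) x)
        ≡⟨ solve 2 (λ s t → s :- (:- t) := 𝟙 :* (𝟙 :* 𝟘 :+ 𝟙 :* t) :+ 𝟙 :* (𝟙 :* s :+ 𝟙 :* 𝟘)) refl (b (T x) y) (b (T y) x) ⟩
      1# * (1# * 0# + 1# * b (T y) x) + 1# * (1# * b (T x) y + 1# * 0#)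
        ≡⟨ cong₂ (λ s t → 1# * (1# * s + 1# * b (T y) x) + 1# * (1# * b (T x) y + 1# * t)) (T-alt x) (T-alt y) ⟨
      1# * (1# * b (T x) x + 1# * b (T y) x) + 1# * (1# * b (T x) y + 1# * b (T y) y)
        ≡⟨ cong₂ (λ s t → 1# * s + 1# * t) (b-linˡ 1# (T x) 1# (T y) x) (b-linˡ 1# (T x) 1# (T y) y) ⟨
      1# * b (lin 1# (T x) 1# (T y)) x + 1# * b (lin 1# (T x) 1# (T y)) y
        ≡⟨ b-lin _ 1# x 1# y ⟨
      b (lin 1# (T x) 1# (T y)) (lin 1# x 1# y)  ≡⟨ cong (λ z → b z (lin 1# x 1# y)) (T-lin 1# x 1# y) ⟨
      b (T (lin 1# x 1# y)) (lin 1# x 1# y)      ≡⟨ T-alt _ ⟩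
      0#                                         ∎)
      where open ≡-Reasoning

    lin-scale-scale : ∀ s a t c x y → lin s (lin a x 0# x) t (lin c y 0# y) ≡ lin (s * a) x (t * c) y
    lin-scale-scale s a t c x y = ext λ i → trans (lookup-lin s _ t _ i)
      (trans (cong₂ (λ u v → s * u + t * v) (lookup-lin a x 0# x i) (lookup-lin c y 0# y i))
      (trans (solve 6 (λ s a t c x y → s :* (a :* x :+ 𝟘 :* x) :+ t :* (c :* y :+ 𝟘 :* y) := s :* a :* x :+ t :* c :* y)
        refl s a t c (lookup x i) (lookup y i)) (sym (lookup-lin _ x _ y i))))
      where open import Data.Vec using (lookup)

    eigenspace : F → Subspace
    eigenspace μ = record
      { Mem   = λ x → T x ≡ lin μ x 0# x
      ; mem?  = λ x → T x ≟ lin μ x 0# x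
      ; zero∈ = trans (cong T (sym (lin-00 {𝟎} {𝟎}))) (trans (T-lin 0# 𝟎 0# 𝟎) (trans lin-00
          (trans (sym (lin∈ zeroSpace μ 0# refl refl)) refl)))
      ; lin∈  = λ a c {x} {y} e e′ → trans (T-lin a x c y) (trans (cong₂ (λ u v → lin a u c v) e e′)
          (trans (lin-scale-scale a μ c μ x y) (trans (cong₂ (λ u v → lin u x v y)
            (solve 2 (λ a μ → a :* μ := μ :* a :+ 𝟘 :* a) refl a μ) (solve 2 (λ a μ → a :* μ := μ :* a :+ 𝟘 :* a) refl c μ))
            (sym (lin-lin μ a c 0# a c)))))
      }

    K : Subspace
    K = eigenspace 0#

    K-elim : ∀ {x} → x ∈ K → T x ≡ 𝟎
    K-elim e = trans e lin-00

    K-intro : ∀ {x} → T x ≡ 𝟎 → x ∈ K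
    K-intro e = trans e (sym lin-00)

    -- Skewness moves T across b at the price of a sign. Two consequences are used: eigenspaces for
    -- μ ≠ 0 are totally singular (ν = μ), and the kernel is orthogonal to all other eigenspaces (μ
    -- = 0).
    eigenvectors-⊥ : ∀ {μ ν x y} → x ∈ eigenspace μ → y ∈ eigenspace ν → (μ + ν) * b x y ≡ 0#
    eigenvectors-⊥ {μ} {ν} {x} {y} x∈ y∈ = begin
      (μ + ν) * b x y            ≡⟨ distribʳ (b x y) μ ν ⟩
      μ * b x y + ν * b x y      ≡⟨ cong₂ _+_ (b-scale μ x y) (b-scaleʳ ν y x) ⟨
      b (lin μ x 0# x) y + b x (lin ν y 0# y)  ≡⟨ cong₂ (λ u v → b u y + b x v) x∈ y∈ ⟨
      b (T x) y + b x (T y)      ≡⟨ cong (_+ b x (T y)) (T-skew x y) ⟩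
      - b x (T y) + b x (T y)    ≡⟨ -‿inverseˡ _ ⟩
      0#                         ∎
      where open ≡-Reasoning

    eigenspace-TotSing : ∀ {μ} → μ ≢ 0# → TotSing (eigenspace μ)
    eigenspace-TotSing {μ} μ≢0 x x∈ = b-diag⇒η (no-zero-divisors (eigenvectors-⊥ {μ} {μ} {x} {x} x∈ x∈)
      λ e → 2≢0 (no-zero-divisors (trans (solve 1 (λ μ → μ :* (𝟙 :+ 𝟙) := μ :+ μ) refl μ) e) μ≢0))

    eigen-combination : ∀ {μ ν x y} → x ∈ eigenspace μ → y ∈ eigenspace ν → ∀ a c → T (lin a x c y) ≡ lin (a * μ) x (c * ν) y
    eigen-combination {μ} {ν} {x} {y} x∈ y∈ a c = trans (T-lin a x c y) (trans (cong₂ (λ u v → lin a u c v) x∈ y∈) (lin-scale-scale a μ c ν x y))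

    -- Applying T - μ to the relation kills the x-term and leaves c(ν - μ)y = 0.
    eigen-independent : ∀ {μ ν x y} → μ ≢ ν → x ∈ eigenspace μ → y ∈ eigenspace ν → ∀ {a c} → lin a x c y ≡ 𝟎 → c ≢ 0# → y ≡ 𝟎
    eigen-independent {μ} {ν} {x} {y} μ≢ν x∈ y∈ {a} {c} e c≢0 = scale-zero {c * (ν - μ)} {y}
      (λ z → μ≢ν (sym (a-b≡0⇒a≡b (no-zero-divisors z c≢0)))) (begin
        lin (c * (ν - μ)) y 0# y                                   ≡⟨ step ⟩
        lin 1# (lin (a * μ) x (c * ν) y) (- μ) (lin a x c y)       ≡⟨ lin∈ zeroSpace 1# (- μ) (trans (sym (eigen-combination x∈ y∈ a c)) (trans (cong T e) T-0)) e ⟩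
        𝟎                                                         ∎)
      where
      open ≡-Reasoning
      T-0 : T 𝟎 ≡ 𝟎
      T-0 = K-elim (zero∈ K)
      step : lin (c * (ν - μ)) y 0# y ≡ lin 1# (lin (a * μ) x (c * ν) y) (- μ) (lin a x c y)
      step = sym (trans (lin-lin 1# (a * μ) (c * ν) (- μ) a c) (ext λ i → trans (lookup-lin _ x _ y i)
        (trans (solve 6 (λ a c μ ν x y → (𝟙 :* (a :* μ) :+ (:- μ) :* a) :* x :+ (𝟙 :* (c :* ν) :+ (:- μ) :* c) :* y
             := c :* (ν :- μ) :* y :+ 𝟘 :* y) refl a c μ ν (lookup x i) (lookup y i))
          (sym (lookup-lin _ y 0# y i)))))

    -- The zero vector is included; `suc-E` later separates it from the non-zero eigenvectors.
    Eigen : V → Set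
    Eigen x = T x ∈ span₁ x

    Eigen? : Decidable Eigen
    Eigen? x = mem? (span₁ x) (T x)

    Eigen⇒eigenspace : ∀ {x} → Eigen x → ∃[ μ ] (x ∈ eigenspace μ)
    Eigen⇒eigenspace = span₁-elim

    eigenspace⇒Eigen : ∀ {μ x} → x ∈ eigenspace μ → Eigen x
    eigenspace⇒Eigen {μ} {x} e = subst (_∈ span₁ x) (sym e) (span₁-intro μ)

    Tangent : V → Set
    Tangent x = (x ≢ 𝟎 × η x ≡ 0#) × (¬ Eigen x × η (T x) ≡ 0#)

    Tangent? : Decidable Tangent
    Tangent? x = Singular? x ×-dec (¬? (Eigen? x) ×-dec η (T x) ≟ 0#)

    SingularEigen? : Decidable (λ x → η x ≡ 0# × Eigen x)
    SingularEigen? x = η x ≟ 0# ×-dec Eigen? x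

    module _ (μ : F) where
      private M = eigenspace μ

      Outside : V → Set
      Outside x = (η x ≡ 0# × Eigen x) × ¬ x ∈ M

      Outside? : Decidable Outside
      Outside? x = SingularEigen? x ×-dec ¬? (mem? M x)

      orthogonal? : ∀ v → Decidable (λ w → (w ∈ M × η w ≡ 0#) × b w v ≡ 0#)
      orthogonal? v w = zeros? M w ×-dec b w v ≟ 0#

      -- Makes a decomposition z = w + v with w in M and v outside unique, so no tangent vector is
      -- produced from two different v. With equal eigenvalues v - v′ would lie in two eigenspaces;
      -- with different ones v, v′ and v - v′ would be dependent eigenvectors for three eigenvalues.
      outside-unique : ∀ {v v′} → Outside v → Outside v′ → lin 1# v (- 1#) v′ ∈ M → v ≡ v′
      outside-unique {v} {v′} ((_ , v-eig) , v∉) ((_ , v′-eig) , v′∉) d∈ =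
        let (ν , v∈) = Eigen⇒eigenspace v-eig
            (ν′ , v′∈) = Eigen⇒eigenspace v′-eig in go ν ν′ v∈ v′∈ (ν ≟ ν′)
        where
        d = lin 1# v (- 1#) v′
        go : ∀ ν ν′ → v ∈ eigenspace ν → v′ ∈ eigenspace ν′ → Dec (ν ≡ ν′) → v ≡ v′
        go ν .ν v∈ v′∈ (yes refl) = difference-zero (eigen-independent {μ = ν} {ν = μ} {x = d} {y = d} ν≢μ
            (lin∈ (eigenspace ν) 1# (- 1#) v∈ v′∈) d∈ {a = - 1#} {c = 1#}
            (trans (lin-collapse (- 1#) 1#) (trans (cong (λ s → lin s d 0# d) (-‿inverseˡ 1#)) lin-00)) (0≢1 ∘ sym))
          where
          ν≢μ : ν ≢ μ
          ν≢μ refl = v∉ v∈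
        -- Applying T − μ to v − v′ gives a relation between eigenvectors for ν ≠ ν′.
        go ν ν′ v∈ v′∈ (no ν≢ν′) = ⊥-elim (v∉ (subst (_∈ M) (sym v≡0) (zero∈ M)))
          where
          ν≢μ : ν ≢ μ
          ν≢μ refl = v∉ v∈
          relation : lin (ν - μ) v (μ - ν′) v′ ≡ 𝟎
          relation = begin
            lin (ν - μ) v (μ - ν′) v′
              ≡⟨ cong₂ (λ s t → lin s v t v′) (solve 2 (λ ν μ → ν :- μ := 𝟙 :* (𝟙 :* ν) :+ (:- μ) :* 𝟙) refl ν μ)
                                              (solve 2 (λ ν′ μ → μ :- ν′ := 𝟙 :* ((:- 𝟙) :* ν′) :+ (:- μ) :* (:- 𝟙)) refl ν′ μ) ⟩
            lin (1# * (1# * ν) + - μ * 1#) v (1# * (- 1# * ν′) + - μ * - 1#) v′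
              ≡⟨ lin-lin 1# (1# * ν) (- 1# * ν′) (- μ) 1# (- 1#) ⟨
            lin 1# (lin (1# * ν) v (- 1# * ν′) v′) (- μ) d
              ≡⟨ cong (λ z → lin 1# z (- μ) d) (trans (sym (eigen-combination v∈ v′∈ 1# (- 1#))) d∈) ⟩
            lin 1# (lin μ d 0# d) (- μ) d
              ≡⟨ lin-linˡ 1# μ 0# (- μ) ⟩
            lin (1# * μ) d (1# * 0# + - μ) d
              ≡⟨ lin-collapse _ _ ⟩
            lin (1# * μ + (1# * 0# + - μ)) d 0# d
              ≡⟨ cong (λ s → lin s d 0# d) (solve 1 (λ μ → 𝟙 :* μ :+ (𝟙 :* 𝟘 :+ (:- μ)) := 𝟘) refl μ) ⟩
            lin 0# d 0# d
              ≡⟨ lin-00 ⟩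
            𝟎 ∎
            where open ≡-Reasoning
          v≡0 : v ≡ 𝟎
          v≡0 = eigen-independent (ν≢ν′ ∘ sym) v′∈ v∈ (trans (lin-comm _ v′ _ v) relation) (ν≢μ ∘ a-b≡0⇒a≡b)

      -- The plane ⟨w, v⟩ is totally singular and contains both z = w + v and T z = μw + νv. As w
      -- and v are non-zero and μ ≠ ν, T z is not a multiple of z.
      sum-tangent : ∀ {v w} → Outside v → (w ∈ M × η w ≡ 0#) × b w v ≡ 0# → w ≢ 𝟎 → Tangent (lin 1# w 1# v)
      sum-tangent {v} {w} ((ev , v-eig) , v∉) ((w∈ , ew) , wv) w≢0 = (z≢0 , ez) , not-eigen , eTz
        where
        z = lin 1# w 1# v
        ν = proj₁ (Eigen⇒eigenspace v-eig)
        v∈ : v ∈ eigenspace ν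
        v∈ = proj₂ (Eigen⇒eigenspace v-eig)
        μ≢ν : μ ≢ ν
        μ≢ν e = v∉ (subst (λ t → v ∈ eigenspace t) (sym e) v∈)
        Tz : T z ≡ lin (1# * μ) w (1# * ν) v
        Tz = eigen-combination w∈ v∈ 1# 1#
        isotropic : ∀ a c → η (lin a w c v) ≡ 0#
        isotropic a c = trans (η-lin a w c v) (trans (cong₂ (λ s t → a * a * s + a * c * b w v + c * c * t) ew ev)
          (trans (cong (λ s → a * a * 0# + a * c * s + c * c * 0#) wv) (solve 2 (λ a c → a :* a :* 𝟘 :+ a :* c :* 𝟘 :+ c :* c :* 𝟘 := 𝟘) refl a c)))
        ez : η z ≡ 0#
        ez = isotropic 1# 1#
        eTz : η (T z) ≡ 0#
        eTz = trans (cong η Tz) (isotropic _ _)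
        v≢0 : v ≢ 𝟎
        v≢0 e = v∉ (subst (_∈ M) (sym e) (zero∈ M))
        z≢0 : z ≢ 𝟎
        z≢0 e = v≢0 (eigen-independent μ≢ν w∈ v∈ e (0≢1 ∘ sym))
        not-eigen : ¬ Eigen z
        not-eigen z-eig = let (ρ , z∈) = Eigen⇒eigenspace z-eig in contradict ρ z∈
          where
          difference : ∀ ρ → z ∈ eigenspace ρ → lin (μ - ρ) w (ν - ρ) v ≡ 𝟎
          difference ρ z∈ = begin
            lin (μ - ρ) w (ν - ρ) v
              ≡⟨ cong₂ (λ s t → lin s w t v) (solve 2 (λ μ ρ → μ :- ρ := 𝟙 :* (𝟙 :* μ) :+ (:- ρ) :* 𝟙) refl μ ρ)
                                             (solve 2 (λ ν ρ → ν :- ρ := 𝟙 :* (𝟙 :* ν) :+ (:- ρ) :* 𝟙) refl ν ρ) ⟩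
            lin (1# * (1# * μ) + - ρ * 1#) w (1# * (1# * ν) + - ρ * 1#) v
              ≡⟨ lin-lin 1# (1# * μ) (1# * ν) (- ρ) 1# 1# ⟨
            lin 1# (lin (1# * μ) w (1# * ν) v) (- ρ) z
              ≡⟨ cong (λ y → lin 1# y (- ρ) z) (trans (sym Tz) z∈) ⟩
            lin 1# (lin ρ z 0# z) (- ρ) z
              ≡⟨ lin-linˡ 1# ρ 0# (- ρ) ⟩
            lin (1# * ρ) z (1# * 0# + - ρ) z
              ≡⟨ lin-collapse _ _ ⟩
            lin (1# * ρ + (1# * 0# + - ρ)) z 0# z
              ≡⟨ cong (λ s → lin s z 0# z) (solve 1 (λ μ → 𝟙 :* μ :+ (𝟙 :* 𝟘 :+ (:- μ)) := 𝟘) refl ρ) ⟩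
            lin 0# z 0# z
              ≡⟨ lin-00 ⟩
            𝟎 ∎
            where open ≡-Reasoning
          contradict : ∀ ρ → z ∈ eigenspace ρ → _
          contradict ρ z∈ with ν ≟ ρ
          ... | no ν≢ρ = v≢0 (eigen-independent μ≢ν w∈ v∈ (difference ρ z∈) (ν≢ρ ∘ a-b≡0⇒a≡b))
          ... | yes refl = w≢0 (eigen-independent (μ≢ν ∘ sym) v∈ w∈ (trans (lin-comm _ v _ w) (difference ν z∈)) (μ≢ν ∘ a-b≡0⇒a≡b))

      -- Every outside v has at least N partners w. The sum w + v is tangent if w ≠ 0 and is v
      -- itself if w = 0, whence the second term on the right; by `outside-unique` no sum is hit
      -- twice.
      outside-tangents : ∀ N → (∀ v → Outside v → N ℕ.≤ # (orthogonal? v)) → # Outside? ℕ.* N ℕ.≤ # Tangent? ℕ.+ # Outside?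
      outside-tangents N lower = begin
        # Outside? ℕ.* N                                    ≡⟨ ∑∈-const Outside? (λ _ _ → refl) ⟨
        ∑∈ Outside? (λ _ → N)                               ≤⟨ ∑∈-mono Outside? lower ⟩
        ∑∈ Outside? (λ v → # (orthogonal? v))               ≡⟨ ∑-cong (λ v → cong ([ Outside? v ] ℕ.*_) (translate v)) ⟩
        ∑∈ Outside? (λ v → # (λ z → yes tt ×-dec sum? v z)) ≡⟨ double-count Outside? (λ _ → yes tt) sum? ⟩
        ∑∈ (λ _ → yes tt) (λ z → # (λ v → Outside? v ×-dec sum? v z)) ≤⟨ ∑-mono (λ z → ℕ.≤-trans (ℕ.≤-reflexive (ℕ.*-identityˡ _)) (fibre z)) ⟩
        ∑ (λ z → [ Tangent? z ] ℕ.+ [ Outside? z ])         ≡⟨ ∑-+ _ _ ⟩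
        # Tangent? ℕ.+ # Outside?                           ∎
        where
        open ℕ.≤-Reasoning
        sum? : ∀ v z → Dec ((lin 1# z (- 1#) v ∈ M × η (lin 1# z (- 1#) v) ≡ 0#) × b (lin 1# z (- 1#) v) v ≡ 0#)
        sum? v z = orthogonal? v (lin 1# z (- 1#) v)
        translate : ∀ v → # (orthogonal? v) ≡ # (λ z → yes tt ×-dec sum? v z)
        translate v = #-bij (orthogonal? v) (λ z → yes tt ×-dec sum? v z) (λ w → lin 1# w 1# v) (λ z → lin 1# z (- 1#) v)
          (λ w h → tt , subst (λ u → (u ∈ M × η u ≡ 0#) × b u v ≡ 0#) (sym (lin-cancel 1#)) h)
          (λ z (_ , h) → h) (λ _ _ → lin-cancel 1#) (λ _ _ → lin-cancel′ 1#)
        fibre : ∀ z → # (λ v → Outside? v ×-dec sum? v z) ℕ.≤ [ Tangent? z ] ℕ.+ [ Outside? z ]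
        fibre z with any? (λ v → Outside? v ×-dec sum? v z)
        ... | no none = ℕ.≤-trans (ℕ.≤-reflexive (#-none (λ v → Outside? v ×-dec sum? v z) λ v h → none (v , h))) ℕ.z≤n
        ... | yes (v , out , h) = ℕ.≤-trans (ℕ.≤-reflexive (#-one (λ v → Outside? v ×-dec sum? v z) v (out , h) unique))
                (covered (lin 1# z (- 1#) v ≟ 𝟎))
          where
          unique : ∀ v′ → Outside v′ × _ → v′ ≡ v
          unique v′ (out′ , h′) = outside-unique out′ out (subst (_∈ M) eq (lin∈ M 1# (- 1#) (proj₁ (proj₁ h)) (proj₁ (proj₁ h′))))
            where
            eq : lin 1# (lin 1# z (- 1#) v) (- 1#) (lin 1# z (- 1#) v′) ≡ lin 1# v′ (- 1#) v
            eq = ext λ i → trans (lookup-lin 1# _ (- 1#) _ i) (trans (cong₂ (λ s t → 1# * s + - 1# * t) (lookup-lin 1# z (- 1#) v i) (lookup-lin 1# z (- 1#) v′ i))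
              (trans (solve 3 (λ z v v′ → 𝟙 :* (𝟙 :* z :+ (:- 𝟙) :* v) :+ (:- 𝟙) :* (𝟙 :* z :+ (:- 𝟙) :* v′) := 𝟙 :* v′ :+ (:- 𝟙) :* v)
                refl (lookup z i) (lookup v i) (lookup v′ i)) (sym (lookup-lin 1# v′ (- 1#) v i))))
          covered : Dec (lin 1# z (- 1#) v ≡ 𝟎) → 1 ℕ.≤ [ Tangent? z ] ℕ.+ [ Outside? z ]
          covered (yes e) = ℕ.≤-trans (ℕ.≤-reflexive (sym ([]-yes (Outside? z) (subst Outside (sym (difference-zero e)) out)))) (ℕ.m≤n+m _ _)
          covered (no ne) = ℕ.≤-trans (ℕ.≤-reflexive (sym ([]-yes (Tangent? z) (subst Tangent (lin-cancel′ 1#) (sum-tangent out h ne))))) (ℕ.m≤m+n _ _)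

      singularEigen-split : # SingularEigen? ≡ zeros M ℕ.+ # Outside?
      singularEigen-split = trans (#-split SingularEigen? (mem? M)) (cong (ℕ._+ # Outside?)
        (#-cong (λ x → SingularEigen? x ×-dec mem? M x) (zeros? M) (λ _ ((e , _) , x∈) → x∈ , e)
          (λ _ (x∈ , e) → (e , eigenspace⇒Eigen x∈) , x∈)))

      -- e is the excess of singular eigenvectors over Q².
      excess-from-eigenspace : zeros M ℕ.≤ Q ℕ.* Q → (∀ v → Outside v → Q ℕ.≤ # (orthogonal? v)) →
        ∃[ e ] (# SingularEigen? ℕ.≤ Q ℕ.* Q ℕ.+ e × e ℕ.* Q ℕ.≤ # Tangent? ℕ.+ e)
      excess-from-eigenspace small lower = # Outside? ,
        ℕ.≤-trans (ℕ.≤-reflexive singularEigen-split) (ℕ.+-monoˡ-≤ _ small) , outside-tangents Q lower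

-- Tangent vectors against surplus eigenvectors, and the resulting bound

module _ {q : ℕ} {𝔽 : FiniteField q} (k : ℕ) (k≥1 : 1 ℕ.≤ k) (S : QuadraticSpace 𝔽 (2 ℕ.* suc k ℕ.+ 1)) where
  open Parabolic k S

  module UpperBound
    (T : V → V)
    (T-lin : ∀ a x c y → T (lin a x c y) ≡ lin a (T x) c (T y))
    (T-alt : ∀ x → b (T x) x ≡ 0#)
    (x₀ : V) (Tx₀≢0 : T x₀ ≢ 𝟎)
    where
    open SkewMap k S T T-lin T-alt

    -- The condition n ≥ 2 enters the estimates of this part here. It makes both a totally singular
    -- subspace of size q^n and the union of q sets of size Q fit into the allowance Q².
    q≤Q : q ℕ.≤ Q
    q≤Q = ℕ.≤-trans (ℕ.≤-reflexive (sym (ℕ.^-identityʳ q))) (ℕ.^-monoʳ-≤ q k≥1)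

    -- e bounds the surplus of singular eigenvectors, zero included, over Q². The second inequality
    -- is e(Q - 1) ≤ number of tangent vectors, written without subtraction.
    Excess : Set
    Excess = ∃[ e ] (# SingularEigen? ℕ.≤ Q ℕ.* Q ℕ.+ e × e ℕ.* Q ℕ.≤ # Tangent? ℕ.+ e)

    -- M is totally singular, hence of size at most qQ ≤ Q². An outside v need not be orthogonal to
    -- M, as its eigenvalue may be -μ, but v^⊥ still cuts out at least |M|/q ≥ Q singular vectors.
    excess-large-eigenspace : ∀ {μ} → μ ≢ 0# → q ℕ.* Q ℕ.≤ size (eigenspace μ) → Excess
    excess-large-eigenspace {μ} μ≢0 large = excess-from-eigenspace μ
      (ℕ.≤-trans (#-mono (zeros? M) (mem? M) (λ _ → proj₁)) (ℕ.≤-trans (size-TotSing M ts) (ℕ.*-monoˡ-≤ Q q≤Q)))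
      (λ v _ → lower v (mem? (M ⊥) v))
      where
      M = eigenspace μ
      ts = eigenspace-TotSing μ≢0
      lower : ∀ v → Dec (v ∈ M ⊥) → Q ℕ.≤ # (orthogonal? μ v)
      lower v (yes v⊥) = ℕ.≤-trans (ℕ.≤-trans (ℕ.m≤n*m Q q) large)
        (#-mono (mem? M) (orthogonal? μ v) (λ w w∈ → (w∈ , ts w w∈) , v⊥ w w∈))
      lower v (no v∉) = ℕ.*-cancelˡ-≤ q (ℕ.≤-trans large (ℕ.≤-trans (ℕ.≤-reflexive (sym (level-⊥ M v∉ 0#)))
        (ℕ.*-monoʳ-≤ q (#-mono (level? M (b-lin v) 0#) (orthogonal? μ v) (λ w (w∈ , e) → (w∈ , ts w w∈) , trans (b-sym w v) e)))))

    -- Eigenvectors for non-zero eigenvalues are orthogonal to all of K, so every zero of η in K is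
    -- a partner and no factor q is lost.
    excess-medium-kernel : Q ℕ.≤ zeros K → zeros K ℕ.≤ Q ℕ.* Q → Excess
    excess-medium-kernel lower upper = excess-from-eigenspace 0# upper λ v out →
      ℕ.≤-trans lower (#-mono (zeros? K) (orthogonal? 0# v) (λ w (w∈ , e) → (w∈ , e) , ortho v out w w∈))
      where
      ortho : ∀ v → Outside 0# v → ∀ w → w ∈ K → b w v ≡ 0#
      ortho v ((_ , v-eig) , v∉) w w∈ = let (ν , v∈) = Eigen⇒eigenspace v-eig in
        no-zero-divisors (eigenvectors-⊥ w∈ v∈) (λ e → v∉ (subst (λ t → v ∈ eigenspace t) (trans (sym (+-identityˡ ν)) e) v∈))

    small-power : ∀ P → ¬ q ℕ.* Q ℕ.≤ size P → size P ℕ.≤ Q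
    small-power P ¬large = let (d , e) = dimension P in go d e
      where
      go : ∀ d → size P ≡ q ℕ.^ d → size P ℕ.≤ Q
      go d e = ℕ.≤-trans (ℕ.≤-reflexive e) (ℕ.^-monoʳ-≤ q {d} {k} (ℕ.≤-pred (ℕ.≰⇒> λ k<d →
        ¬large (ℕ.≤-trans (ℕ.^-monoʳ-≤ q {suc k} {d} k<d) (ℕ.≤-reflexive (sym e))))))

    -- With at most Q zeros in each of the q eigenspaces there are at most qQ ≤ Q² singular
    -- eigenvectors, so there is no surplus.
    excess-small : zeros K ℕ.≤ Q → (∀ μ → μ ≢ 0# → ¬ q ℕ.* Q ℕ.≤ size (eigenspace μ)) → Excess
    excess-small K≤ small = 0 , ℕ.≤-trans (begin
        # SingularEigen?                                    ≤⟨ ∑-mono cover ⟩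
        ∑ (λ x → ∑ (λ μ → [ zeros? (eigenspace μ) x ]))     ≡⟨ ∑-swap _ ⟩
        ∑ (λ μ → zeros (eigenspace μ))                      ≤⟨ ∑-mono (λ μ → each μ (μ ≟ 0#)) ⟩
        ∑ {F} (λ _ → Q)                                     ≡⟨ ∑-const Q ⟩
        q ℕ.* Q                                             ≤⟨ ℕ.*-monoˡ-≤ Q q≤Q ⟩
        Q ℕ.* Q                                             ∎) (ℕ.m≤m+n _ 0) , ℕ.z≤n
      where
      open ℕ.≤-Reasoning
      cover : ∀ x → [ SingularEigen? x ] ℕ.≤ ∑ (λ μ → [ zeros? (eigenspace μ) x ])
      cover x = go (SingularEigen? x)
        where
        go : (d : Dec _) → [ d ] ℕ.≤ ∑ (λ μ → [ zeros? (eigenspace μ) x ])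
        go (no _)          = ℕ.z≤n
        go (yes (e , eig)) = let (μ , x∈) = Eigen⇒eigenspace eig in #-pos (λ μ → zeros? (eigenspace μ) x) μ (x∈ , e)
      each : ∀ μ → Dec (μ ≡ 0#) → zeros (eigenspace μ) ℕ.≤ Q
      each μ (yes refl) = K≤
      each μ (no μ≢0)   = ℕ.≤-trans (#-mono (zeros? (eigenspace μ)) (mem? (eigenspace μ)) (λ _ → proj₁))
                            (small-power (eigenspace μ) (small μ μ≢0))

    image⊆K⊥ : ∀ x → T x ∈ K ⊥
    image⊆K⊥ x w w∈ = trans (b-sym w (T x)) (trans (T-skew x w) (trans (cong (λ z → - b x z) (K-elim w∈))
      (trans (cong -_ (linear-0 (b-lin x))) (solve 0 (:- 𝟘 := 𝟘) refl))))

    -- An alternating form has rank at least 2 if it is non-zero.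
    K⊥-large : q ℕ.* q ℕ.≤ size (K ⊥)
    K⊥-large = let (z , _ , yz≢0) = ¬⊥⇒witness full (λ y∈ → Tx₀≢0 (full⊥ y∈)) in
      ℕ.≤-trans (ℕ.≤-reflexive (sym (size-span₂ {T x₀} {T z} Tx₀≢0 (independent z yz≢0))))
        (size-mono (span₂ (T x₀) (T z)) (K ⊥) (span₂-least (K ⊥) (image⊆K⊥ x₀) (image⊆K⊥ z)))
      where
      independent : ∀ z → b (T x₀) z ≢ 0# → ¬ T z ∈ span₁ (T x₀)
      independent z yz≢0 Tz∈ = let (c , e) = span₁-elim Tz∈ in
        yz≢0 (trans (b-sym _ z) (image⊆K⊥ x₀ z (K-intro (Tz≡0 c e))))
        where
        Tz≡0 : ∀ c → T z ≡ lin c (T x₀) 0# (T x₀) → T z ≡ 𝟎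
        Tz≡0 c e = trans e (trans (cong (λ s → lin s (T x₀) 0# (T x₀)) c≡0) lin-00)
          where
          c≡0 : c ≡ 0#
          c≡0 = no-zero-divisors (trans (*-comm _ c) (trans (sym (b-scale c (T x₀) z)) (trans (cong (λ u → b u z) (sym e)) (T-alt z)))) yz≢0

    module LargeKernel (large : ¬ zeros K ℕ.≤ Q ℕ.* Q) where

      Q²<K : Q ℕ.* Q ℕ.< zeros K
      Q²<K = ℕ.≰⇒> large

      qqQQ : ∀ {a} → q ℕ.* q ℕ.* (q ℕ.* a) ≡ q ℕ.* (q ℕ.* (q ℕ.* a))
      qqQQ {a} = ℕ.*-assoc q q (q ℕ.* a)

      -- |K| is a power of q above Q² = q^(2k), hence at least the next power.
      size-K≥ : q ℕ.* (Q ℕ.* Q) ℕ.≤ size K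
      size-K≥ = let (d , e) = dimension K in go d e
        where
        go : ∀ d → size K ≡ q ℕ.^ d → q ℕ.* (Q ℕ.* Q) ℕ.≤ size K
        go d e = ℕ.≤-trans (ℕ.≤-reflexive (cong (q ℕ.*_) (sym q^2k))) (ℕ.≤-trans (ℕ.^-monoʳ-≤ q 2k<d) (ℕ.≤-reflexive (sym e)))
          where
          2k<d : 2 ℕ.* k ℕ.< d
          2k<d = ℕ.≰⇒> λ d≤ → ℕ.<-irrefl refl (ℕ.<-≤-trans Q²<K (ℕ.≤-trans (#-mono (zeros? K) (mem? K) (λ _ → proj₁))
            (ℕ.≤-trans (ℕ.≤-reflexive e) (ℕ.≤-trans (ℕ.^-monoʳ-≤ q d≤) (ℕ.≤-reflexive q^2k)))))

      -- T has rank exactly 2: `K⊥-large` is the lower bound, and `size-K≥` with |K| |K^⊥| = q^m the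
      -- upper one.
      size-K⊥ : size (K ⊥) ≡ q ℕ.* q
      size-K⊥ = ℕ.≤-antisym (ℕ.*-cancelʳ-≤ _ _ (q ℕ.* (Q ℕ.* Q)) {{ℕ.m*n≢0 q (Q ℕ.* Q) {{q-nonZero}} {{ℕ.m*n≢0 Q Q}}}} (begin
          size (K ⊥) ℕ.* (q ℕ.* (Q ℕ.* Q))  ≤⟨ ℕ.*-monoʳ-≤ (size (K ⊥)) size-K≥ ⟩
          size (K ⊥) ℕ.* size K             ≡⟨ ℕ.*-comm (size (K ⊥)) (size K) ⟩
          size K ℕ.* size (K ⊥)             ≡⟨ trans (size-⊥ K) q^m ⟩
          q ℕ.* (q ℕ.* (q ℕ.* (Q ℕ.* Q)))   ≡⟨ qqQQ ⟨
          q ℕ.* q ℕ.* (q ℕ.* (Q ℕ.* Q))     ∎)) K⊥-large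
        where open ℕ.≤-Reasoning

      size-K : size K ≡ q ℕ.* (Q ℕ.* Q)
      size-K = q-cancel (q-cancel (trans (sym (ℕ.*-assoc q q (size K))) (trans (cong (ℕ._* size K) (sym size-K⊥))
        (trans (ℕ.*-comm (size (K ⊥)) (size K)) (trans (size-⊥ K) q^m)))))

      R : Subspace
      R = rad K

      size-K^ : size K ≡ q ℕ.^ suc (2 ℕ.* k)
      size-K^ = trans size-K (cong (q ℕ.*_) (sym q^2k))

      not-odd : ∀ j → ¬ (size K ℕ.* size R ≡ q ℕ.^ suc (2 ℕ.* j))
      not-odd j e = ℕ.<-irrefl (sym (q-cancel (trans (zeros-odd K j e) size-K))) Q²<K

      -- R lies in K^⊥, so |R| is 1, q or q². Since |K| = q^(2k + 1), the first and last cases leave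
      -- the odd exponent required by `zeros-odd`, which would give K only Q² zeros.
      size-R : size R ≡ q
      size-R = let (r , e) = dimension R in trans e (go r e (exponent-≤ (ℕ.≤-trans (ℕ.≤-reflexive (sym e))
                 (ℕ.≤-trans (size-mono R (K ⊥) proj₂) (ℕ.≤-reflexive (trans size-K⊥ (cong (q ℕ.*_) (sym (ℕ.*-identityʳ q)))))))))
        where
        go : ∀ r → size R ≡ q ℕ.^ r → r ℕ.≤ 2 → q ℕ.^ r ≡ q
        go 0 e _ = ⊥-elim (not-odd k (trans (cong₂ ℕ._*_ size-K^ e) (ℕ.*-identityʳ _)))
        go 1 e _ = ℕ.*-identityʳ q
        go 2 e _ = ⊥-elim (not-odd (suc k) (trans (cong₂ ℕ._*_ size-K^ e) (trans (sym (ℕ.^-distribˡ-+-* q (suc (2 ℕ.* k)) 2)) (cong (q ℕ.^_) (lem k)))))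
          where
          lem : ∀ k → suc (2 ℕ.* k) ℕ.+ 2 ≡ suc (2 ℕ.* suc k)
          lem = solve-∀
        go (suc (suc (suc _))) e (ℕ.s≤s (ℕ.s≤s ()))

      zeros-K≤ : zeros K ℕ.≤ maxZeros p Q
      zeros-K≤ = zeros-bound K size-K (ℕ.≤-reflexive size-R)

      -- K^⊥ ∩ x^⊥ has size q and contains R, hence equals R.
      T-R⊥ : ∀ {x} → x ∈ R ⊥ → ¬ x ∈ K → T x ∈ R
      T-R⊥ {x} x∈ x∉ = #-full (level? (K ⊥) (b-lin x) 0#) (mem? R)
        (λ y y∈ → proj₂ y∈ , trans (b-sym x y) (x∈ y y∈))
        (ℕ.≤-reflexive (trans (q-cancel (trans (level-⊥ (K ⊥) (x∉ ∘ ⊥⊥ K) 0#) size-K⊥)) (sym size-R)))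
        (T x) (image⊆K⊥ x , trans (b-sym x (T x)) (T-alt x))

      R-TotSing : TotSing R
      R-TotSing x (x∈ , x⊥) = b-diag⇒η (x⊥ x x∈)

      K⊆R⊥ : K ⊆ R ⊥
      K⊆R⊥ {x} x∈ w w∈ = trans (b-sym w x) (proj₂ w∈ x x∈)

      zeros-R⊥ : zeros (R ⊥) ≡ q ℕ.* (Q ℕ.* Q)
      zeros-R⊥ = q-cancel (trans (zeros-TotSing-⊥ R R-TotSing) (q-cancel (trans (cong (ℕ._* size (R ⊥)) (sym size-R)) (trans (size-⊥ R) q^m))))

      -- T x lies in R and hence in K, so T²x = 0. A non-zero eigenvalue would force x = 0, and the
      -- eigenvalue 0 means x in K.
      not-eigen : ∀ {x} → x ∈ R ⊥ → ¬ x ∈ K → ¬ Eigen x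
      not-eigen {x} x∈ x∉ eig = let (μ , e) = Eigen⇒eigenspace eig in go μ e
        where
        TTx : T (T x) ≡ 𝟎
        TTx = K-elim (proj₁ (T-R⊥ x∈ x∉))
        go : ∀ μ → ¬ x ∈ eigenspace μ
        go μ e with μ ≟ 0#
        ... | yes refl = x∉ e
        ... | no μ≢0 = x∉ (K-intro (trans e (trans (cong (λ z → lin μ z 0# z) x≡0) (lin∈ zeroSpace μ 0# refl refl))))
          where
          x≡0 : x ≡ 𝟎
          x≡0 = scale-zero μ≢0 (trans (sym e) (scale-zero μ≢0 (trans (sym (trans (cong T e) (trans (T-lin μ x 0# x) refl))) TTx)))

      tangents : q ℕ.* (Q ℕ.* Q) ℕ.≤ zeros K ℕ.+ # Tangent?
      tangents = begin
        q ℕ.* (Q ℕ.* Q)  ≡⟨ zeros-R⊥ ⟨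
        zeros (R ⊥)      ≡⟨ #-subset (zeros? (R ⊥)) (zeros? K) (λ _ (x∈ , e) → K⊆R⊥ x∈ , e) ⟩
        zeros K ℕ.+ # (λ x → zeros? (R ⊥) x ×-dec ¬? (zeros? K x))
          ≤⟨ ℕ.+-monoʳ-≤ (zeros K) (#-mono (λ x → zeros? (R ⊥) x ×-dec ¬? (zeros? K x)) Tangent? tangent) ⟩
        zeros K ℕ.+ # Tangent? ∎
        where
        open ℕ.≤-Reasoning
        tangent : ∀ x → (x ∈ R ⊥ × η x ≡ 0#) × ¬ (x ∈ K × η x ≡ 0#) → Tangent x
        tangent x ((x∈ , e) , ¬z) = ((λ x≡0 → x∉ (subst (_∈ K) (sym x≡0) (zero∈ K))) , e) , not-eigen x∈ x∉ , R-TotSing (T x) (T-R⊥ x∈ x∉)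
          where
          x∉ : ¬ x ∈ K
          x∉ x∈K = ¬z (x∈K , e)

      -- An eigenvector outside K has a non-zero eigenvalue, hence is orthogonal to K and in
      -- particular to R; then `not-eigen` excludes it.
      eigen-in-K : ∀ x → η x ≡ 0# × Eigen x → x ∈ K × η x ≡ 0#
      eigen-in-K x (e , eig) = decidable-stable (mem? K x) (λ x∉ → not-eigen (x∈R⊥ x∉) x∉ eig) , e
        where
        x∈R⊥ : ¬ x ∈ K → x ∈ R ⊥
        x∈R⊥ x∉ w (w∈ , _) = let (ν , x∈) = Eigen⇒eigenspace eig in
          no-zero-divisors (eigenvectors-⊥ w∈ x∈) (λ e → x∉ (subst (λ t → x ∈ eigenspace t) (trans (sym (+-identityˡ ν)) e) x∈))

      -- Take e = `zeros K` - Q², which is at most pQ by `zeros-K≤`. The tangent vectors number at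
      -- least qQ² - `zeros K` = pQ² - e, so eQ ≤ pQ² is covered.
      excess : Excess
      excess = let (e , eq) = ℕ.m≤n⇒∃[o]m+o≡n (ℕ.<⇒≤ Q²<K) in e ,
        ℕ.≤-trans (#-mono SingularEigen? (zeros? K) eigen-in-K) (ℕ.≤-reflexive (sym eq)) , bound e eq
        where
        open ℕ.≤-Reasoning
        bound : ∀ e → Q ℕ.* Q ℕ.+ e ≡ zeros K → e ℕ.* Q ℕ.≤ # Tangent? ℕ.+ e
        bound e eq = ℕ.≤-trans (ℕ.*-monoˡ-≤ Q e≤) (ℕ.+-cancelˡ-≤ (Q ℕ.* Q) _ _ (begin
          Q ℕ.* Q ℕ.+ p ℕ.* Q ℕ.* Q     ≡⟨ lem₁ p Q ⟩
          suc p ℕ.* (Q ℕ.* Q)           ≡⟨ cong (ℕ._* (Q ℕ.* Q)) q≡ ⟨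
          q ℕ.* (Q ℕ.* Q)               ≤⟨ tangents ⟩
          zeros K ℕ.+ # Tangent?        ≡⟨ cong (ℕ._+ # Tangent?) eq ⟨
          Q ℕ.* Q ℕ.+ e ℕ.+ # Tangent?  ≡⟨ lem₂ (Q ℕ.* Q) e (# Tangent?) ⟩
          Q ℕ.* Q ℕ.+ (# Tangent? ℕ.+ e) ∎))
          where
          e≤ : e ℕ.≤ p ℕ.* Q
          e≤ = ℕ.+-cancelˡ-≤ (Q ℕ.* Q) _ _ (ℕ.≤-trans (ℕ.≤-reflexive eq) zeros-K≤)
          lem₁ : ∀ p Q → Q ℕ.* Q ℕ.+ p ℕ.* Q ℕ.* Q ≡ suc p ℕ.* (Q ℕ.* Q)
          lem₁ = solve-∀
          lem₂ : ∀ a e t → a ℕ.+ e ℕ.+ t ≡ a ℕ.+ (t ℕ.+ e)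
          lem₂ = solve-∀

    excess : Excess
    excess = kernel-case (zeros K ℕ.≤? Q ℕ.* Q) (any? (λ μ → ¬? (μ ≟ 0#) ×-dec (q ℕ.* Q ℕ.≤? size (eigenspace μ)))) (Q ℕ.≤? zeros K)
      where
      kernel-case : Dec (zeros K ℕ.≤ Q ℕ.* Q) → Dec (∃[ μ ] (μ ≢ 0# × q ℕ.* Q ℕ.≤ size (eigenspace μ))) → Dec (Q ℕ.≤ zeros K) → Excess
      kernel-case (no large)  _ _                   = LargeKernel.excess large
      kernel-case (yes small) (yes (μ , μ≢0 , le)) _ = excess-large-eigenspace μ≢0 le
      kernel-case (yes small) (no _)    (yes Q≤)     = excess-medium-kernel Q≤ small
      kernel-case (yes small) (no none) (no ¬Q≤)     = excess-small (ℕ.<⇒≤ (ℕ.≰⇒> ¬Q≤)) (λ μ μ≢0 le → none (μ , μ≢0 , le))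

    E : ℕ
    E = # (λ x → Singular? x ×-dec Eigen? x)

    suc-E : # SingularEigen? ≡ suc E
    suc-E = trans (#-cong SingularEigen? (λ x → Eigen? x ×-dec η x ≟ 0#) (λ _ (a , c) → c , a) (λ _ (a , c) → c , a))
      (singular-nonzero Eigen? (eigenspace⇒Eigen (zero∈ K)))

    total : ℕ
    total = ∑∈ Singular? (λ x → common x (T x))

    h : ℕ
    h = p ℕ.* suc Q₁

    -- One inequality for the three kinds of x. Against the baseline `maxZeros`, an eigenvector is
    -- credited hQ₁ = qQ² - (Q² + pQ), and a tangent vector is charged h, its shortfall.
    pointwise : ∀ x → x ≢ 𝟎 × η x ≡ 0# →
      common x (T x) ℕ.+ h ℕ.* [ Tangent? x ] ℕ.≤ (suc Q₁ ℕ.* suc Q₁ ℕ.+ h) ℕ.+ (h ℕ.* Q₁) ℕ.* [ Eigen? x ]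
    pointwise x sing@(x≢0 , ex) = go (Eigen? x) (η (T x) ≟ 0#)
      where
      Goal = common x (T x) ℕ.+ h ℕ.* [ Tangent? x ] ℕ.≤ (suc Q₁ ℕ.* suc Q₁ ℕ.+ h) ℕ.+ (h ℕ.* Q₁) ℕ.* [ Eigen? x ]
      xTx : b x (T x) ≡ 0#
      xTx = trans (b-sym x (T x)) (T-alt x)
      go : Dec (Eigen x) → Dec (η (T x) ≡ 0#) → Goal
      go (yes eig) _ = ℕ.≤-reflexive (begin
        common x (T x) ℕ.+ h ℕ.* [ Tangent? x ]    ≡⟨ cong₂ (λ s t → s ℕ.+ h ℕ.* t) (common-dependent x≢0 ex eig) ([]-no (Tangent? x) (λ t → proj₁ (proj₂ t) eig)) ⟩
        q ℕ.* (Q ℕ.* Q) ℕ.+ h ℕ.* 0                ≡⟨ cong₂ (λ s t → s ℕ.* (t ℕ.* t) ℕ.+ h ℕ.* 0) q≡ Q≡ ⟩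
        suc p ℕ.* (suc Q₁ ℕ.* suc Q₁) ℕ.+ h ℕ.* 0  ≡⟨ lem p Q₁ ⟩
        (suc Q₁ ℕ.* suc Q₁ ℕ.+ h) ℕ.+ (h ℕ.* Q₁) ℕ.* 1  ≡⟨ cong (λ s → (suc Q₁ ℕ.* suc Q₁ ℕ.+ h) ℕ.+ (h ℕ.* Q₁) ℕ.* s) ([]-yes (Eigen? x) eig) ⟨
        (suc Q₁ ℕ.* suc Q₁ ℕ.+ h) ℕ.+ (h ℕ.* Q₁) ℕ.* [ Eigen? x ] ∎)
        where
        open ≡-Reasoning
        lem : ∀ p Q₁ → suc p ℕ.* (suc Q₁ ℕ.* suc Q₁) ℕ.+ p ℕ.* suc Q₁ ℕ.* 0 ≡ (suc Q₁ ℕ.* suc Q₁ ℕ.+ p ℕ.* suc Q₁) ℕ.+ (p ℕ.* suc Q₁ ℕ.* Q₁) ℕ.* 1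
        lem = solve-∀
      go (no ¬eig) (yes eTx) = ℕ.≤-trans (ℕ.≤-reflexive (trans
          (cong₂ (λ s t → s ℕ.+ h ℕ.* t) (trans (common-singular x≢0 ex eTx xTx ¬eig) (cong (λ s → s ℕ.* s) Q≡)) ([]-yes (Tangent? x) (sing , ¬eig , eTx)))
          (cong (suc Q₁ ℕ.* suc Q₁ ℕ.+_) (ℕ.*-identityʳ h)))) (ℕ.m≤m+n _ _)
      go (no ¬eig) (no eTx) = ℕ.≤-trans (ℕ.≤-trans (ℕ.≤-reflexive
          (trans (cong (λ t → common x (T x) ℕ.+ h ℕ.* t) ([]-no (Tangent? x) (λ t → eTx (proj₂ (proj₂ t)))))
            (trans (cong (common x (T x) ℕ.+_) (ℕ.*-zeroʳ h)) (ℕ.+-identityʳ _))))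
        (ℕ.≤-trans (common-nonsingular x≢0 ex eTx xTx) (ℕ.≤-reflexive (cong (λ s → s ℕ.* s ℕ.+ p ℕ.* s) Q≡)))) (ℕ.m≤m+n _ _)

    summed : total ℕ.+ # Tangent? ℕ.* h ℕ.≤ # Singular? ℕ.* (suc Q₁ ℕ.* suc Q₁ ℕ.+ h) ℕ.+ E ℕ.* (h ℕ.* Q₁)
    summed = begin
      total ℕ.+ # Tangent? ℕ.* h
        ≡⟨ cong (total ℕ.+_) (trans (ℕ.*-comm (# Tangent?) h) (cong (h ℕ.*_) (sym (trans (∑∈-# Singular? Tangent?)
             (#-cong (λ x → Singular? x ×-dec Tangent? x) Tangent? (λ _ → proj₂) (λ _ t → proj₁ t , t)))))) ⟩
      total ℕ.+ h ℕ.* ∑∈ Singular? (λ x → [ Tangent? x ])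
        ≡⟨ cong (total ℕ.+_) (∑∈-* Singular? h _) ⟨
      total ℕ.+ ∑∈ Singular? (λ x → h ℕ.* [ Tangent? x ])
        ≡⟨ ∑∈-+ Singular? _ _ ⟨
      ∑∈ Singular? (λ x → common x (T x) ℕ.+ h ℕ.* [ Tangent? x ])
        ≤⟨ ∑∈-mono Singular? pointwise ⟩
      ∑∈ Singular? (λ x → (suc Q₁ ℕ.* suc Q₁ ℕ.+ h) ℕ.+ (h ℕ.* Q₁) ℕ.* [ Eigen? x ])
        ≡⟨ ∑∈-+ Singular? _ _ ⟩
      ∑∈ Singular? (λ _ → suc Q₁ ℕ.* suc Q₁ ℕ.+ h) ℕ.+ ∑∈ Singular? (λ x → (h ℕ.* Q₁) ℕ.* [ Eigen? x ])
        ≡⟨ cong₂ ℕ._+_ (∑∈-const Singular? (λ _ _ → refl)) (trans (∑∈-* Singular? (h ℕ.* Q₁) _)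
             (trans (cong (h ℕ.* Q₁ ℕ.*_) (∑∈-# Singular? Eigen?)) (ℕ.*-comm (h ℕ.* Q₁) E))) ⟩
      # Singular? ℕ.* (suc Q₁ ℕ.* suc Q₁ ℕ.+ h) ℕ.+ E ℕ.* (h ℕ.* Q₁) ∎
      where open ℕ.≤-Reasoning

    total-bound : total ℕ.≤ maxTotal p Q₁ (# Singular?)
    total-bound = let (e , E≤ , e≤) = excess in
      total-arithmetic p Q₁ (# Singular?) E (# Tangent?) e total summed
        (subst (λ s → suc E ℕ.≤ s ℕ.* s ℕ.+ e) Q≡ (subst (ℕ._≤ Q ℕ.* Q ℕ.+ e) suc-E E≤))
        (subst (λ s → e ℕ.* s ℕ.≤ # Tangent? ℕ.+ e) Q≡ e≤)

-- A form attaining the bound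

module Extremal {q : ℕ} {𝔽 : FiniteField q} (k : ℕ) (S : QuadraticSpace 𝔽 (2 ℕ.* suc k ℕ.+ 1)) where
  open Parabolic k S
  open MaximalTotSing (maximalTotSing full) hiding (W⊆P)

  -- By maximality W is exactly the zero set of η on W^⊥, and that set is a q-th part of W^⊥.
  qW : q ℕ.* size W ≡ size (W ⊥)
  qW = trans (cong (q ℕ.*_) (#-cong (mem? W) (zeros? (W ⊥)) (λ x x∈ → TotSing⇒⊥ W totSing x∈ , totSing x x∈)
    (λ _ (x⊥ , e) → maximal tt x⊥ e))) (zeros-TotSing-⊥ W totSing)

  size-W : size W ≡ q ℕ.* Q
  size-W = square-injective (q-cancel (trans (lem q (size W)) (trans (cong (size W ℕ.*_) qW) (trans (size-⊥ W) (trans q^m (lem₂ q Q))))))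
    where
    lem : ∀ q w → q ℕ.* (w ℕ.* w) ≡ w ℕ.* (q ℕ.* w)
    lem = solve-∀
    lem₂ : ∀ q Q → q ℕ.* (q ℕ.* (q ℕ.* (Q ℕ.* Q))) ≡ q ℕ.* ((q ℕ.* Q) ℕ.* (q ℕ.* Q))
    lem₂ = solve-∀
    square-injective : ∀ {a c} → a ℕ.* a ≡ c ℕ.* c → a ≡ c
    square-injective {a} {c} e = ℕ.≤-antisym (ℕ.≮⇒≥ λ c<a → ℕ.<-irrefl (sym e) (ℕ.*-mono-< c<a c<a))
                                             (ℕ.≮⇒≥ λ a<c → ℕ.<-irrefl e (ℕ.*-mono-< a<c a<c))

  u-exists : ∃[ u ] (u ∈ W × u ≢ 𝟎)
  u-exists = search (λ u → mem? W u ×-dec ¬? (u ≟ 𝟎)) λ none →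
    ℕ.<-irrefl (sym (trans (sym size-W) (#-one (mem? W) 𝟎 (zero∈ W)
      (λ x x∈ → decidable-stable (x ≟ 𝟎) λ ne → none x (x∈ , ne))))) (ℕ.≤-trans 1<q (ℕ.m≤m*n q Q))

  v-exists : ∃[ v ] (v ∈ W ⊥ × ¬ v ∈ W)
  v-exists = search (λ v → mem? (W ⊥) v ×-dec ¬? (mem? W v)) λ none →
    ℕ.<-irrefl refl (ℕ.<-≤-trans (ℕ.<-≤-trans
      (ℕ.m<m*n (size W) q {{ℕ.>-nonZero (size-pos W)}} 1<q) (ℕ.≤-reflexive (trans (ℕ.*-comm (size W) q) qW)))
      (size-mono (W ⊥) W (λ {x} x∈ → decidable-stable (mem? W x) λ ne → none x (x∈ , ne))))

  u = proj₁ u-exists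
  u∈W : u ∈ W
  u∈W = proj₁ (proj₂ u-exists)
  u≢0 : u ≢ 𝟎
  u≢0 = proj₂ (proj₂ u-exists)
  v = proj₁ v-exists
  v∈W⊥ : v ∈ W ⊥
  v∈W⊥ = proj₁ (proj₂ v-exists)
  v∉W : ¬ v ∈ W
  v∉W = proj₂ (proj₂ v-exists)

  ηu : η u ≡ 0#
  ηu = totSing u u∈W
  buu : b u u ≡ 0#
  buu = TotSing⇒⊥ W totSing u∈W u u∈W
  buv : b u v ≡ 0#
  buv = v∈W⊥ u u∈W
  bvv : b v v ≢ 0#
  bvv e = v∉W (maximal tt v∈W⊥ (b-diag⇒η e))

  -- The kernel of the map `T` below, since u and v are independent.
  P : Subspace
  P = span₂ u v ⊥

  P-intro : ∀ {x} → b u x ≡ 0# → b v x ≡ 0# → x ∈ P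
  P-intro = span₂-⊥

  size-P : size P ≡ q ℕ.* (Q ℕ.* Q)
  size-P = size-span₂-⊥ u≢0 (λ v∈ → v∉W (span₁-least W u∈W v∈))

  W⊆P : W ⊆ P
  W⊆P {w} w∈ = P-intro (TotSing⇒⊥ W totSing w∈ u u∈W) (trans (b-sym v w) (v∈W⊥ w w∈))

  -- W lies in W^⊥ ∩ v^⊥. The latter is a proper hyperplane of W^⊥ because b(v, v) ≠ 0, so it has
  -- size |W^⊥|/q = |W|.
  P∩W⊥⊆W : P ∩ W ⊥ ⊆ W
  P∩W⊥⊆W {x} (x∈ , x⊥) = #-full (mem? (W ⊥ ∩ kernel (b v) (b-lin v))) (mem? W)
    (λ w w∈ → TotSing⇒⊥ W totSing w∈ , trans (b-sym v w) (v∈W⊥ w w∈))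
    (ℕ.≤-reflexive (q-cancel (trans (size-kernel (W ⊥) (b-lin v) v∈W⊥ bvv) (sym qW)))) x (x⊥ , x∈ v span₂-∋ʳ)

  -- As P ∩ W^⊥ = W, the balance `zeros-⊥` reads q `zeros P` + qQ = qQ² + q(qQ): the kernel attains
  -- the variance bound.
  zeros-P : zeros P ≡ maxZeros p Q
  zeros-P = q-cancel (ℕ.+-cancelʳ-≡ (q ℕ.* Q) _ _ (begin
    q ℕ.* zeros P ℕ.+ q ℕ.* Q                  ≡⟨ cong (q ℕ.* zeros P ℕ.+_) (trans (sym size-W) (size-cong W (P ∩ W ⊥) W⊆ P∩W⊥⊆W)) ⟩
    q ℕ.* zeros P ℕ.+ size (P ∩ W ⊥)           ≡⟨ zeros-⊥ P W W⊆P totSing ⟩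
    size P ℕ.+ q ℕ.* zeros (P ∩ W ⊥)           ≡⟨ cong₂ (λ s t → s ℕ.+ q ℕ.* t) size-P (trans (#-cong (zeros? (P ∩ W ⊥)) (mem? W)
                                                    (λ _ z → P∩W⊥⊆W (proj₁ z)) (λ x x∈ → W⊆ x∈ , totSing x x∈)) size-W) ⟩
    q ℕ.* (Q ℕ.* Q) ℕ.+ q ℕ.* (q ℕ.* Q)        ≡⟨ cong (λ z → q ℕ.* (Q ℕ.* Q) ℕ.+ q ℕ.* (z ℕ.* Q)) q≡ ⟩
    q ℕ.* (Q ℕ.* Q) ℕ.+ q ℕ.* (suc p ℕ.* Q)    ≡⟨ lem q p Q ⟩
    q ℕ.* maxZeros p Q ℕ.+ q ℕ.* Q    ∎))
    where
    open ≡-Reasoning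
    W⊆ : W ⊆ P ∩ W ⊥
    W⊆ w∈ = W⊆P w∈ , TotSing⇒⊥ W totSing w∈
    lem : ∀ q p Q → q ℕ.* (Q ℕ.* Q) ℕ.+ q ℕ.* (suc p ℕ.* Q) ≡ q ℕ.* (Q ℕ.* Q ℕ.+ p ℕ.* Q) ℕ.+ q ℕ.* Q
    lem = solve-∀

  T : V → V
  T x = lin (b u x) v (- b v x) u

  b-T : ∀ x y → b (T x) y ≡ b u x * b v y - b v x * b u y
  b-T x y = trans (b-linˡ _ v _ u y) (solve 4 (λ a c d e → a :* c :+ (:- d) :* e := a :* c :- d :* e) refl (b u x) (b v y) (b v x) (b u y))

  T-lin : ∀ a x c y → T (lin a x c y) ≡ lin a (T x) c (T y)
  T-lin a x c y = sym (trans (lin-lin a _ _ c _ _) (cong₂ (λ s t → lin s v t u) (sym (b-lin u a x c y))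
    (trans (solve 4 (λ a c s t → a :* (:- s) :+ c :* (:- t) := :- (a :* s :+ c :* t)) refl a c (b v x) (b v y)) (cong -_ (sym (b-lin v a x c y))))))

  T-alt : ∀ x → b (T x) x ≡ 0#
  T-alt x = trans (b-T x x) (solve 2 (λ s t → s :* t :- t :* s := 𝟘) refl (b u x) (b v x))

  Tv≢0 : T v ≢ 𝟎
  Tv≢0 e = u≢0 (scale-zero {a = - b v v} (λ z → bvv (trans (solve 1 (λ t → t := :- (:- t)) refl (b v v)) (trans (cong -_ z) (solve 0 (:- 𝟘 := 𝟘) refl))))
    (trans (sym (trans (cong (λ s → lin s v (- b v v) u) buv) (drop (- b v v)))) e))
    where
    drop : ∀ c → lin 0# v c u ≡ lin c u 0# u
    drop c = trans (lin-comm 0# v c u) (ext λ i → trans (lookup-lin c u 0# v i) (trans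
      (solve 3 (λ c u v → c :* u :+ 𝟘 :* v := c :* u :+ 𝟘 :* u) refl c (lookup u i) (lookup v i)) (sym (lookup-lin c u 0# u i))))

  -- The isometry of ⟨x, y⟩ exchanging x and y, extended by the identity on ⟨x, y⟩^⊥.
  module _ {x y : V} (ex : η x ≡ 0#) (ey : η y ≡ 0#) (xy≢0 : b x y ≢ 0#) where
    private
      s = proj₁ (inverse (b x y) xy≢0)
      xy*s : b x y * s ≡ 1#
      xy*s = proj₂ (inverse (b x y) xy≢0)

    exchange : V → V
    -- This is the reflection along y - x, for which η(y - x) = -b(x, y), with its b(x, z) term
    -- omitted: `common-exchange` applies it only to z orthogonal to x.
    exchange z = lin 1# z (b y z * s) (lin 1# y (- 1#) x)

    b-exchange : ∀ t z → b t (exchange z) ≡ b t z + b y z * s * (b t y - b t x)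
    b-exchange t z = trans (b-lin t _ z _ _) (trans (cong (λ r → 1# * b t z + b y z * s * r) (b-lin t 1# y (- 1#) x))
      (solve 4 (λ z c y x → 𝟙 :* z :+ c :* (𝟙 :* y :+ (:- 𝟙) :* x) := z :+ c :* (y :- x)) refl (b t z) (b y z * s) (b t y) (b t x)))

    bxx : b x x ≡ 0#
    bxx = trans (b-diag x) (trans (cong (2# *_) ex) (zeroʳ 2#))
    byy : b y y ≡ 0#
    byy = trans (b-diag y) (trans (cong (2# *_) ey) (zeroʳ 2#))

    b-y-exchange : ∀ z → b y (exchange z) ≡ 0#
    b-y-exchange z = trans (b-exchange y z) (trans (cong₂ (λ r t → b y z + b y z * s * (r - t)) byy (b-sym y x))
      (trans (solve 3 (λ c s t → c :+ c :* s :* (𝟘 :- t) := c :- c :* (t :* s)) refl (b y z) s (b x y))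
        (trans (cong (λ r → b y z - b y z * r) xy*s) (solve 1 (λ c → c :- c :* 𝟙 := 𝟘) refl (b y z)))))

    b-x-exchange : ∀ z → b x z ≡ 0# → b x (exchange z) ≡ b y z
    b-x-exchange z e = trans (b-exchange x z) (trans (cong₂ (λ r t → r + b y z * s * (b x y - t)) e bxx)
      (trans (solve 3 (λ c s t → 𝟘 :+ c :* s :* (t :- 𝟘) := c :* (t :* s)) refl (b y z) s (b x y))
        (trans (cong (b y z *_) xy*s) (*-identityʳ _))))

    η-exchange : ∀ z → b x z ≡ 0# → η (exchange z) ≡ η z
    η-exchange z e = trans (η-lin 1# z c d) (trans (cong₂ (λ r t → 1# * 1# * η z + 1# * c * r + c * c * t) bzd ηd)
      (trans (solve 4 (λ n y s t → 𝟙 :* 𝟙 :* n :+ 𝟙 :* (y :* s) :* y :+ (y :* s) :* (y :* s) :* (:- t) := n :+ y :* s :* y :- y :* y :* s :* (t :* s)) refl (η z) (b y z) s (b x y))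
        (trans (cong (λ r → η z + b y z * s * b y z - b y z * b y z * s * r) xy*s)
          (solve 3 (λ n y s → n :+ y :* s :* y :- y :* y :* s :* 𝟙 := n) refl (η z) (b y z) s))))
      where
      c = b y z * s
      d = lin 1# y (- 1#) x
      bzd : b z d ≡ b y z
      bzd = trans (b-lin z 1# y (- 1#) x) (trans (cong₂ (λ r t → 1# * r + - 1# * t) (b-sym z y) (trans (b-sym z x) e))
        (solve 1 (λ t → 𝟙 :* t :+ (:- 𝟙) :* 𝟘 := t) refl (b y z)))
      ηd : η d ≡ - b x y
      ηd = trans (η-lin 1# y (- 1#) x) (trans (cong₂ (λ r t → 1# * 1# * r + 1# * - 1# * b y x + - 1# * - 1# * t) ey ex)
        (trans (cong (λ r → 1# * 1# * 0# + 1# * - 1# * r + - 1# * - 1# * 0#) (b-sym y x))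
          (solve 1 (λ t → 𝟙 :* 𝟙 :* 𝟘 :+ 𝟙 :* (:- 𝟙) :* t :+ (:- 𝟙) :* (:- 𝟙) :* 𝟘 := :- t) refl (b x y))))

    exchange-common : ∀ w → b x w ≡ 0# → b y w ≡ 0# → ∀ z → (b x z ≡ 0# × b w z ≡ 0#) × η z ≡ 0# →
      (b y (exchange z) ≡ 0# × b w (exchange z) ≡ 0#) × η (exchange z) ≡ 0#
    exchange-common w xw yw z ((xz , wz) , ez) = (b-y-exchange z ,
      trans (b-exchange w z) (trans (cong₂ (λ r t → r + b y z * s * t) wz (trans (cong₂ _-_ (trans (b-sym w y) yw) (trans (b-sym w x) xw)) (-‿inverseʳ 0#)))
        (solve 1 (λ c → 𝟘 :+ c :* 𝟘 := 𝟘) refl (b y z * s)))) , trans (η-exchange z xz) ez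

  inverse-unique : ∀ {a c d} → a * c ≡ 1# → a * d ≡ 1# → c ≡ d
  inverse-unique {a} {c} {d} e e′ = trans (sym (*-identityʳ c)) (trans (cong (c *_) (sym e′))
    (trans (solve 3 (λ a c d → c :* (a :* d) := (a :* c) :* d) refl a c d) (trans (cong (_* d) e) (*-identityˡ d))))

  exchange-inverse : ∀ {x y} (ex : η x ≡ 0#) (ey : η y ≡ 0#) (xy≢0 : b x y ≢ 0#) (yx≢0 : b y x ≢ 0#) →
    ∀ z → b x z ≡ 0# → exchange ey ex yx≢0 (exchange ex ey xy≢0 z) ≡ z
  exchange-inverse {x} {y} ex ey xy≢0 yx≢0 z xz = ext λ i → begin
    lookup (lin 1# z′ (b x z′ * s′) (lin 1# x (- 1#) y)) i
      ≡⟨ trans (lookup-lin _ z′ _ _ i) (cong₂ (λ r t → 1# * r + b x z′ * s′ * t)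
           (trans (lookup-lin _ z _ _ i) (cong (λ r → 1# * lookup z i + b y z * s * r) (lookup-lin _ y _ x i))) (lookup-lin _ x _ y i)) ⟩
    1# * (1# * lookup z i + b y z * s * (1# * lookup y i + - 1# * lookup x i)) + b x z′ * s′ * (1# * lookup x i + - 1# * lookup y i)
      ≡⟨ cong (λ r → 1# * (1# * lookup z i + b y z * s * (1# * lookup y i + - 1# * lookup x i)) + r * (1# * lookup x i + - 1# * lookup y i))
           (cong₂ _*_ (b-x-exchange ex ey xy≢0 z xz) (inverse-unique {b x y} (trans (cong (_* s′) (b-sym x y)) (proj₂ (inverse (b y x) yx≢0))) (proj₂ (inverse (b x y) xy≢0)))) ⟩
    1# * (1# * lookup z i + b y z * s * (1# * lookup y i + - 1# * lookup x i)) + b y z * s * (1# * lookup x i + - 1# * lookup y i)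
      ≡⟨ solve 4 (λ z c x y → 𝟙 :* (𝟙 :* z :+ c :* (𝟙 :* y :+ (:- 𝟙) :* x)) :+ c :* (𝟙 :* x :+ (:- 𝟙) :* y) := z) refl (lookup z i) (b y z * s) (lookup x i) (lookup y i) ⟩
    lookup z i ∎
    where
    open ≡-Reasoning
    z′ = exchange ex ey xy≢0 z
    s = proj₁ (inverse (b x y) xy≢0)
    s′ = proj₁ (inverse (b y x) yx≢0)

  -- The exchange of x and y fixes w, which is orthogonal to both, and so carries the zeros of η on
  -- ⟨x, w⟩^⊥ to those on ⟨y, w⟩^⊥.
  common-exchange : ∀ {x y w} → η x ≡ 0# → η y ≡ 0# → b x y ≢ 0# → b x w ≡ 0# → b y w ≡ 0# → common x w ≡ common y w
  common-exchange {x} {y} {w} ex ey xy≢0 xw yw = #-bij (common? x w) (common? y w)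
    (exchange ex ey xy≢0) (exchange ey ex yx≢0) (exchange-common ex ey xy≢0 w xw yw) (exchange-common ey ex yx≢0 w yw xw)
    (λ z ((xz , _) , _) → exchange-inverse ex ey xy≢0 yx≢0 z xz) (λ z ((yz , _) , _) → exchange-inverse ey ex yx≢0 xy≢0 z yz)
    where
    yx≢0 : b y x ≢ 0#
    yx≢0 e = xy≢0 (trans (b-sym x y) e)

  u⊥ : Subspace
  u⊥ = span₁ u ⊥

  u⊥? : Decidable (λ x → b u x ≡ 0#)
  u⊥? x = b u x ≟ 0#

  P⊆u⊥ : ∀ {x} → x ∈ P → b u x ≡ 0#
  P⊆u⊥ x∈ = x∈ u span₂-∋ˡ

  common-P : ∀ x → (x ≢ 𝟎 × η x ≡ 0#) × x ∈ P → common x (T x) ≡ suc p ℕ.* (suc Q₁ ℕ.* suc Q₁)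
  common-P x ((x≢0 , ex) , x∈) = trans (common-dependent x≢0 ex (subst (_∈ span₁ x) (sym Tx≡0) (zero∈ (span₁ x))))
    (cong₂ (λ s t → s ℕ.* (t ℕ.* t)) q≡ Q≡)
    where
    Tx≡0 : T x ≡ 𝟎
    Tx≡0 = trans (cong₂ (λ s t → lin s v (- t) u) (P⊆u⊥ x∈) (x∈ v span₂-∋ʳ)) (trans (cong (λ t → lin 0# v t u) (solve 0 (:- 𝟘 := 𝟘) refl)) lin-00)

  -- These x are tangent: T x is a non-zero multiple of u.
  common-u⊥ : ∀ x → ((x ≢ 𝟎 × η x ≡ 0#) × ¬ x ∈ P) × b u x ≡ 0# → common x (T x) ≡ suc Q₁ ℕ.* suc Q₁
  common-u⊥ x (((x≢0 , ex) , x∉) , ux) = trans (common-singular x≢0 ex (span₁-TotSing ηu (T x) Tx∈) (trans (b-sym x (T x)) (T-alt x)) Tx∉)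
    (cong (λ t → t ℕ.* t) Q≡)
    where
    c = - b v x
    vx≢0 : b v x ≢ 0#
    vx≢0 e = x∉ (P-intro ux e)
    Tx≡ : T x ≡ lin c u 0# u
    Tx≡ = trans (cong (λ s → lin s v c u) ux) (trans (lin-comm 0# v c u) (ext λ i → trans (lookup-lin c u 0# v i) (trans
      (solve 3 (λ c u v → c :* u :+ 𝟘 :* v := c :* u :+ 𝟘 :* u) refl c (lookup u i) (lookup v i)) (sym (lookup-lin c u 0# u i)))))
    Tx∈ : T x ∈ span₁ u
    Tx∈ = subst (_∈ span₁ u) (sym Tx≡) (span₁-intro c)
    -- b v (T x) = 0 while b v x ≠ 0, and T x ≠ 0.
    Tx∉ : ¬ T x ∈ span₁ x
    Tx∉ Tx∈x = let (a , e) = span₁-elim Tx∈x in u≢0 (scale-zero {c} c≢0 (trans (sym Tx≡) (trans e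
        (trans (cong (λ s → lin s x 0# x) (no-zero-divisors (trans (*-comm (b v x) a) (trans (sym (b-scaleʳ a x v)) (trans (cong (b v) (sym e)) vTx))) vx≢0)) lin-00))))
      where
      c≢0 : c ≢ 0#
      c≢0 e = vx≢0 (trans (solve 1 (λ t → t := :- (:- t)) refl (b v x)) (trans (cong -_ e) (solve 0 (:- 𝟘 := 𝟘) refl)))
      vTx : b v (T x) ≡ 0#
      vTx = trans (cong (b v) Tx≡) (trans (b-scaleʳ c u v) (trans (cong (c *_) (trans (b-sym v u) buv)) (zeroʳ c)))

  -- T x = b(u, x)v - b(v, x)u is orthogonal to x and to u, so x may be exchanged with u. Since b(u,
  -- x) ≠ 0, the plane ⟨u, T x⟩ is ⟨u, v⟩, whose orthogonal P has the maximal number of zeros.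
  common-generic : ∀ x → ((x ≢ 𝟎 × η x ≡ 0#) × ¬ x ∈ P) × b u x ≢ 0# → common x (T x) ≡ maxZeros p (suc Q₁)
  common-generic x (((x≢0 , ex) , x∉) , ux) = begin
    common x (T x)   ≡⟨ common-exchange ex ηu (λ e → ux (trans (b-sym u x) e)) (trans (b-sym x (T x)) (T-alt x)) uTx ⟩
    common u (T x)   ≡⟨ #-cong (common? u (T x)) (zeros? P)
                          (λ y ((uy , wy) , e) → P-intro uy (vy y uy wy) , e)
                          (λ y (y∈ , e) → (P⊆u⊥ y∈ , trans (b-T x y) (trans (cong₂ (λ s t → b u x * s - b v x * t) (y∈ v span₂-∋ʳ) (P⊆u⊥ y∈))
                             (solve 2 (λ s t → s :* 𝟘 :- t :* 𝟘 := 𝟘) refl (b u x) (b v x)))) , e) ⟩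
    zeros P          ≡⟨ trans zeros-P (cong (λ s → s ℕ.* s ℕ.+ p ℕ.* s) Q≡) ⟩
    maxZeros p (suc Q₁) ∎
    where
    open ≡-Reasoning
    uTx : b u (T x) ≡ 0#
    uTx = trans (b-sym u (T x)) (trans (b-T x u) (trans (cong₂ (λ s t → b u x * s - b v x * t) (trans (b-sym v u) buv) buu)
      (solve 2 (λ s t → s :* 𝟘 :- t :* 𝟘 := 𝟘) refl (b u x) (b v x))))
    vy : ∀ y → b u y ≡ 0# → b (T x) y ≡ 0# → b v y ≡ 0#
    vy y uy wy = no-zero-divisors (trans (solve 3 (λ a c d → a :* c := a :* c :- d :* 𝟘) refl (b u x) (b v y) (b v x))
      (trans (cong (λ s → b u x * b v y - b v x * s) (sym uy)) (trans (sym (b-T x y)) wy))) ux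

  total : ∑∈ Singular? (λ x → common x (T x)) ≡
    maxTotal p Q₁ (# Singular?)
  total = begin
    ∑∈ Singular? f  ≡⟨ ∑∈-split Singular? (mem? P) f ⟩
    ∑∈ A? f ℕ.+ ∑∈ A′? f  ≡⟨ cong (∑∈ A? f ℕ.+_) (∑∈-split A′? u⊥? f) ⟩
    ∑∈ A? f ℕ.+ (∑∈ B? f ℕ.+ ∑∈ C? f)  ≡⟨ cong₂ ℕ._+_ (∑∈-const A? common-P) (cong₂ ℕ._+_ (∑∈-const B? common-u⊥) (∑∈-const C? common-generic)) ⟩
    # A? ℕ.* (suc p ℕ.* (suc Q₁ ℕ.* suc Q₁)) ℕ.+ (# B? ℕ.* (suc Q₁ ℕ.* suc Q₁) ℕ.+ # C? ℕ.* maxZeros p (suc Q₁))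
      ≡⟨ example-arithmetic p Q₁ (# A?) (# B?) (# C?) count-A count-B ⟩
    maxTotal p Q₁ (# A? ℕ.+ (# B? ℕ.+ # C?))
      ≡⟨ cong (maxTotal p Q₁)
           (trans (#-split Singular? (mem? P)) (cong (# A? ℕ.+_) (#-split A′? u⊥?))) ⟨
    maxTotal p Q₁ (# Singular?) ∎
    where
    open ≡-Reasoning
    f : V → ℕ
    f x = common x (T x)
    A? : Decidable (λ x → (x ≢ 𝟎 × η x ≡ 0#) × x ∈ P)
    A? x = Singular? x ×-dec mem? P x
    A′? : Decidable (λ x → (x ≢ 𝟎 × η x ≡ 0#) × ¬ x ∈ P)
    A′? x = Singular? x ×-dec ¬? (mem? P x)
    B? : Decidable (λ x → ((x ≢ 𝟎 × η x ≡ 0#) × ¬ x ∈ P) × b u x ≡ 0#)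
    B? x = A′? x ×-dec u⊥? x
    C? : Decidable (λ x → ((x ≢ 𝟎 × η x ≡ 0#) × ¬ x ∈ P) × b u x ≢ 0#)
    C? x = A′? x ×-dec ¬? (u⊥? x)
    count-A : suc (# A?) ≡ maxZeros p (suc Q₁)
    count-A = trans (sym (singular-nonzero (mem? P) (zero∈ P))) (trans zeros-P (cong (λ s → s ℕ.* s ℕ.+ p ℕ.* s) Q≡))
    zeros-u⊥ : zeros u⊥ ≡ suc p ℕ.* (suc Q₁ ℕ.* suc Q₁)
    zeros-u⊥ = trans (q-cancel (trans (zeros-TotSing-⊥ (span₁ u) (span₁-TotSing ηu)) (size-span₁-⊥ u≢0))) (cong₂ (λ s t → s ℕ.* (t ℕ.* t)) q≡ Q≡)
    count-B : suc (# A? ℕ.+ # B?) ≡ suc p ℕ.* (suc Q₁ ℕ.* suc Q₁)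
    count-B = trans (cong suc (sym (trans (#-split (λ x → Singular? x ×-dec mem? u⊥ x) (mem? P)) (cong₂ ℕ._+_
        (#-cong (λ x → (Singular? x ×-dec mem? u⊥ x) ×-dec mem? P x) A? (λ _ ((s , _) , x∈) → s , x∈) (λ x (s , x∈) → (s , span₁-⊥ (P⊆u⊥ x∈)) , x∈))
        (#-cong (λ x → (Singular? x ×-dec mem? u⊥ x) ×-dec ¬? (mem? P x)) B? (λ _ ((s , h) , x∉) → (s , x∉) , h u (adjoin-∋ zeroSpace))
          (λ x ((s , x∉) , h) → (s , span₁-⊥ h) , x∉))))))
      (trans (sym (singular-nonzero (mem? u⊥) (zero∈ u⊥))) zeros-u⊥)

-- Lines

-- `Covered` limits the claim to the elements already scanned, which makes the record an induction
-- hypothesis over a list; for the lines it is instantiated to the whole type in the end.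
record Transversal {X : Set} (G : X → Set) (_∼_ : X → X → Set) (Covered : X → Set) : Set where
  field
    number   : ℕ
    rep      : Fin number → X
    rep-good : ∀ i → G (rep i)
    class    : ∀ x → Covered x → G x → ∃[ i ] (x ∼ rep i)
    distinct : ∀ i j → rep i ∼ rep j → i ≡ j

module _ {X : Set} {G : X → Set} {_∼_ : X → X → Set} (G? : Decidable G) (_∼?_ : ∀ x y → Dec (x ∼ y))
  (∼-refl : ∀ x → x ∼ x) (∼-sym : ∀ x y → x ∼ y → y ∼ x) where

  transversal : (xs : List X) → Transversal G _∼_ (List._∈ xs)
  transversal [] = record { number = 0 ; rep = λ () ; rep-good = λ () ; class = λ _ () ; distinct = λ () }
  transversal (x ∷ xs) = extend (transversal xs)
    where
    extend : Transversal G _∼_ (List._∈ xs) → Transversal G _∼_ (List._∈ (x ∷ xs))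
    extend t with G? x | Fin.any? (λ i → x ∼? Transversal.rep t i)
    ... | no ¬g | _ = record { Transversal t hiding (class)
                             ; class = λ { _ (here refl) g → ⊥-elim (¬g g) ; y (there y∈) g → Transversal.class t y y∈ g } }
    ... | yes g | yes found = record { Transversal t hiding (class)
                             ; class = λ { _ (here refl) _ → found ; y (there y∈) g → Transversal.class t y y∈ g } }
    ... | yes g | no new = record
      { number   = suc (Transversal.number t)
      ; rep      = λ { zero → x ; (suc i) → Transversal.rep t i }
      ; rep-good = λ { zero → g ; (suc i) → Transversal.rep-good t i }
      ; class    = λ { _ (here refl) _ → zero , ∼-refl x
                     ; y (there y∈) g → let (i , e) = Transversal.class t y y∈ g in suc i , e }
      ; distinct = λ { zero zero _ → refl
                     ; zero (suc j) e → ⊥-elim (new (j , e))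
                     ; (suc i) zero e → ⊥-elim (new (i , ∼-sym _ _ e))
                     ; (suc i) (suc j) e → cong suc (Transversal.distinct t i j e) }
      }

module _ {q : ℕ} {𝔽 : FiniteField q} (k : ℕ) (S : QuadraticSpace 𝔽 (2 ℕ.* suc k ℕ.+ 1)) where
  open Parabolic k S

  module IsotropicLines
    (T : V → V)
    (T-lin : ∀ a x c y → T (lin a x c y) ≡ lin a (T x) c (T y))
    (T-alt : ∀ x → b (T x) x ≡ 0#)
    where

    -- Ordered bases of the lines in question, split so that for fixed u the vectors v are those
    -- counted by `common u (T u)` outside ⟨u⟩.
    Good : V × V → Set
    Good (u , v) = (u ≢ 𝟎 × η u ≡ 0#) × (((b u v ≡ 0# × b (T u) v ≡ 0#) × η v ≡ 0#) × ¬ v ∈ span₁ u)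

    Good? : Decidable Good
    Good? (u , v) = Singular? u ×-dec (common? u (T u) v ×-dec ¬? (mem? (span₁ u) v))

    _∼_ : V × V → V × V → Set
    (u , v) ∼ (u′ , v′) = (u ∈ span₂ u′ v′ × v ∈ span₂ u′ v′) × (u′ ∈ span₂ u v × v′ ∈ span₂ u v)

    _∼?_ : ∀ x y → Dec (x ∼ y)
    (u , v) ∼? (u′ , v′) = (mem? (span₂ u′ v′) u ×-dec mem? (span₂ u′ v′) v) ×-dec (mem? (span₂ u v) u′ ×-dec mem? (span₂ u v) v′)

    ∼-refl : ∀ x → x ∼ x
    ∼-refl (u , v) = (span₂-∋ˡ , span₂-∋ʳ) , (span₂-∋ˡ , span₂-∋ʳ)

    ∼-sym : ∀ x y → x ∼ y → y ∼ x
    ∼-sym x y (p , q) = q , p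

    ∼-trans : ∀ x y z → x ∼ y → y ∼ z → x ∼ z
    ∼-trans (u , v) (u′ , v′) (u″ , v″) ((a₁ , a₂) , (a₃ , a₄)) ((c₁ , c₂) , (c₃ , c₄)) =
      (span₂-least (span₂ u″ v″) c₁ c₂ a₁ , span₂-least (span₂ u″ v″) c₁ c₂ a₂) ,
      (span₂-least (span₂ u v) a₃ a₄ c₃ , span₂-least (span₂ u v) a₃ a₄ c₄)

    vectors : List V
    vectors = List.map (Finite.to V-finite) (List.allFin (q ℕ.^ m))

    vectors-∋ : ∀ x → x List.∈ vectors
    vectors-∋ x = subst (List._∈ vectors) (to∘from x) (List.∈-map⁺ _ (List.∈-allFin (Finite.from V-finite x)))

    pairs : List (V × V)
    pairs = List.cartesianProduct vectors vectors

    abstract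
      lines : Transversal Good _∼_ (λ _ → ⊤)
      lines = record { Transversal t hiding (class)
                     ; class = λ { (u , v) _ g → Transversal.class t (u , v) (List.∈-cartesianProduct⁺ (vectors-∋ u) (vectors-∋ v)) g } }
        where
        t : Transversal Good _∼_ (List._∈ pairs)
        t = transversal Good? _∼?_ ∼-refl ∼-sym pairs

    open Transversal lines public

    good-∼ : ∀ {u₀ v₀ u v} → Good (u₀ , v₀) → u ∈ span₂ u₀ v₀ → u ≢ 𝟎 → v ∈ span₂ u₀ v₀ → ¬ v ∈ span₁ u → (u , v) ∼ (u₀ , v₀)
    good-∼ {u₀} {v₀} {u} {v} ((u₀≢0 , _) , _ , v₀∉) u∈ u≢0 v∈ v∉ = (u∈ , v∈) , (all span₂-∋ˡ , all span₂-∋ʳ)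
      where
      all : ∀ {x} → x ∈ span₂ u₀ v₀ → x ∈ span₂ u v
      all {x} = #-full (mem? (span₂ u₀ v₀)) (mem? (span₂ u v)) (λ _ → span₂-least (span₂ u₀ v₀) u∈ v∈)
        (ℕ.≤-reflexive (trans (size-span₂ u₀≢0 v₀∉) (sym (size-span₂ u≢0 v∉)))) x

    isotropic : ∀ {u v} → Good (u , v) → ∀ {x y} → x ∈ span₂ u v → y ∈ span₂ u v → b (T x) y ≡ 0#
    isotropic {u} {v} (_ , ((_ , Tuv) , _) , _) {x} {y} x∈ y∈ =
      let (a , c , e) = span₂-elim x∈ ; (a′ , c′ , e′) = span₂-elim y∈ in
      trans (cong₂ (λ s t → b (T s) t) e e′) (trans (cong (λ s → b s _) (T-lin a u c v)) (trans (b-linˡ a (T u) c (T v) _)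
        (trans (cong₂ (λ s t → a * s + c * t) (trans (b-lin (T u) a′ u c′ v) (cong₂ (λ s t → a′ * s + c′ * t) (T-alt u) Tuv))
                                              (trans (b-lin (T v) a′ u c′ v) (cong₂ (λ s t → a′ * s + c′ * t) Tvu (T-alt v))))
          (solve 4 (λ a c a′ c′ → a :* (a′ :* 𝟘 :+ c′ :* 𝟘) :+ c :* (a′ :* 𝟘 :+ c′ :* 𝟘) := 𝟘) refl a c a′ c′))))
      where
      -- Expand b(T(u + v), u + v) = 0; the other three terms vanish.
      Tvu : b (T v) u ≡ 0#
      Tvu = trans (solve 2 (λ s t → s := 𝟙 :* (𝟙 :* 𝟘 :+ 𝟙 :* s) :+ 𝟙 :* (𝟙 :* 𝟘 :+ 𝟙 :* 𝟘)) refl (b (T v) u) 0#)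
        (trans (cong₂ (λ s t → 1# * (1# * s + 1# * b (T v) u) + 1# * (1# * t + 1# * 0#)) (sym (T-alt u)) (sym Tuv))
        (trans (cong (λ s → 1# * (1# * b (T u) u + 1# * b (T v) u) + 1# * (1# * b (T u) v + 1# * s)) (sym (T-alt v)))
        (trans (sym (trans (b-lin (T (lin 1# u 1# v)) 1# u 1# v) (cong₂ (λ s t → 1# * s + 1# * t)
          (trans (cong (λ s → b s u) (T-lin 1# u 1# v)) (b-linˡ 1# (T u) 1# (T v) u))
          (trans (cong (λ s → b s v) (T-lin 1# u 1# v)) (b-linˡ 1# (T u) 1# (T v) v))))) (T-alt (lin 1# u 1# v)))))

    span-good : ∀ {u₀ v₀ u v} → Good (u₀ , v₀) → u ∈ span₂ u₀ v₀ → u ≢ 𝟎 → v ∈ span₂ u₀ v₀ → ¬ v ∈ span₁ u → Good (u , v)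
    span-good {u₀} {v₀} {u} {v} g@((_ , eu) , ((uv , _) , ev) , _) u∈ u≢0 v∈ v∉ =
      (u≢0 , ts u u∈) , ((TotSing⇒⊥ (span₂ u₀ v₀) ts v∈ u u∈ , isotropic g u∈ v∈) , ts v v∈) , v∉
      where
      ts : TotSing (span₂ u₀ v₀)
      ts = span₂-TotSing eu ev uv

    pair-count : {A : V × V → Set} → Decidable A → ℕ
    pair-count A? = ∑ (λ u → # (λ v → A? (u , v)))

    bases-per-line : ℕ
    bases-per-line = (q ℕ.* q ℕ.∸ 1) ℕ.* (q ℕ.* q ℕ.∸ q)

    -- By `span-good` every basis of the line is again `Good`: u is any non-zero vector of the line,
    -- then v any vector of it off ⟨u⟩.
    class-size : ∀ i → pair-count (λ x → Good? x ×-dec x ∼? rep i) ≡ bases-per-line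
    class-size i = begin
      ∑ (λ u → # (λ v → Good? (u , v) ×-dec (u , v) ∼? rep i))   ≡⟨ ∑-cong each ⟩
      ∑∈ U? (λ _ → q ℕ.* q ℕ.∸ q)                                ≡⟨ ∑∈-const U? (λ _ _ → refl) ⟩
      # U? ℕ.* (q ℕ.* q ℕ.∸ q)                                   ≡⟨ cong (ℕ._* (q ℕ.* q ℕ.∸ q)) count-U ⟩
      (q ℕ.* q ℕ.∸ 1) ℕ.* (q ℕ.* q ℕ.∸ q)                        ∎
      where
      open ≡-Reasoning
      u₀ = proj₁ (rep i)
      v₀ = proj₂ (rep i)
      L = span₂ u₀ v₀
      good₀ : Good (u₀ , v₀)
      good₀ = rep-good i
      size-L : size L ≡ q ℕ.* q
      size-L = size-span₂ (proj₁ (proj₁ good₀)) (proj₂ (proj₂ good₀))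
      U? : Decidable (λ u → u ∈ L × u ≢ 𝟎)
      U? u = mem? L u ×-dec ¬? (u ≟ 𝟎)
      ∸-from-+ : ∀ {a c d} → a ≡ c ℕ.+ d → d ≡ a ℕ.∸ c
      ∸-from-+ {a} {c} {d} e = sym (trans (cong (ℕ._∸ c) e) (ℕ.m+n∸m≡n c d))
      count-U : # U? ≡ q ℕ.* q ℕ.∸ 1
      count-U = ∸-from-+ (trans (sym size-L) (trans (#-subset (mem? L) (_≟ 𝟎) (λ { _ refl → zero∈ L }))
        (cong (ℕ._+ # U?) (#-one (_≟ 𝟎) 𝟎 refl (λ _ e → e)))))
      count-v : ∀ u → u ∈ L × u ≢ 𝟎 → # (λ v → Good? (u , v) ×-dec (u , v) ∼? rep i) ≡ q ℕ.* q ℕ.∸ q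
      count-v u (u∈ , u≢0) = trans
        (#-cong (λ v → Good? (u , v) ×-dec (u , v) ∼? rep i) (λ v → mem? L v ×-dec ¬? (mem? (span₁ u) v))
          (λ v ((_ , _ , v∉) , (_ , v∈) , _) → v∈ , v∉) (λ v (v∈ , v∉) → span-good good₀ u∈ u≢0 v∈ v∉ , good-∼ good₀ u∈ u≢0 v∈ v∉))
        (∸-from-+ (trans (sym size-L) (trans (#-subset (mem? L) (mem? (span₁ u)) (λ _ → span₁-least L u∈))
          (cong (ℕ._+ # (λ v → mem? L v ×-dec ¬? (mem? (span₁ u) v))) (size-span₁ u≢0)))))
      each : ∀ u → # (λ v → Good? (u , v) ×-dec (u , v) ∼? rep i) ≡ [ U? u ] ℕ.* (q ℕ.* q ℕ.∸ q)
      each u = go (U? u)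
        where
        go : (d : Dec (u ∈ L × u ≢ 𝟎)) → # (λ v → Good? (u , v) ×-dec (u , v) ∼? rep i) ≡ [ d ] ℕ.* (q ℕ.* q ℕ.∸ q)
        go (yes h) = trans (count-v u h) (sym (ℕ.*-identityˡ _))
        go (no ¬h) = #-none (λ v → Good? (u , v) ×-dec (u , v) ∼? rep i) λ v (((u≢0 , _) , _) , (u∈ , _) , _) → ¬h (u∈ , u≢0)

    good-count : pair-count Good? ≡ number ℕ.* bases-per-line
    good-count = begin
      ∑ (λ u → ∑ (λ v → [ Good? (u , v) ]))            ≡⟨ ∑-cong (λ u → ∑-cong (λ v → fibre (u , v))) ⟩
      ∑ (λ u → ∑ (λ v → ∑ (λ i → member i u v)))       ≡⟨ ∑-cong (λ u → ∑-swap _) ⟩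
      ∑ (λ u → ∑ (λ i → ∑ (λ v → member i u v)))       ≡⟨ ∑-swap _ ⟩
      ∑ (λ i → ∑ (λ u → ∑ (λ v → member i u v)))       ≡⟨ ∑-cong class-size ⟩
      ∑ {Fin number} (λ _ → bases-per-line)            ≡⟨ ∑-const bases-per-line ⟩
      number ℕ.* bases-per-line                        ∎
      where
      open ≡-Reasoning
      member : Fin number → V → V → ℕ
      member i u v = [ Good? (u , v) ×-dec (u , v) ∼? rep i ]
      fibre : ∀ x → [ Good? x ] ≡ # (λ i → Good? x ×-dec x ∼? rep i)
      fibre x = go (Good? x)
        where
        go : (d : Dec (Good x)) → [ d ] ≡ # (λ i → Good? x ×-dec x ∼? rep i)
        go (no ¬g) = sym (#-none (λ i → Good? x ×-dec x ∼? rep i) λ i (g , _) → ¬g g)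
        go (yes g) = let (i , e) = class x tt g in
          sym (#-one (λ i → Good? x ×-dec x ∼? rep i) i (g , e)
            λ j (_ , e′) → distinct j i (∼-trans (rep j) x (rep i) (∼-sym x (rep j) e′) e))

    total : ℕ
    total = ∑∈ Singular? (λ x → common x (T x))

    -- For singular u the q multiples of u satisfy all conditions on v except independence, which is
    -- the correction q per singular vector.
    total-lines : number ℕ.* bases-per-line ℕ.+ # Singular? ℕ.* q ≡ total
    total-lines = begin
      number ℕ.* bases-per-line ℕ.+ # Singular? ℕ.* q    ≡⟨ cong₂ ℕ._+_ (sym good-count) (sym (∑∈-const Singular? (λ _ _ → refl))) ⟩
      pair-count Good? ℕ.+ ∑∈ Singular? (λ _ → q)        ≡⟨ cong (ℕ._+ ∑∈ Singular? (λ _ → q)) (∑-cong each) ⟩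
      ∑∈ Singular? rest ℕ.+ ∑∈ Singular? (λ _ → q)       ≡⟨ ∑∈-+ Singular? rest (λ _ → q) ⟨
      ∑∈ Singular? (λ u → rest u ℕ.+ q)                  ≡⟨ ∑∈-cong Singular? split ⟩
      total                                              ∎
      where
      open ≡-Reasoning
      rest : V → ℕ
      rest u = # (λ v → common? u (T u) v ×-dec ¬? (mem? (span₁ u) v))
      each : ∀ u → # (λ v → Good? (u , v)) ≡ [ Singular? u ] ℕ.* rest u
      each u = trans (∑-cong λ v → []-× (Singular? u) (common? u (T u) v ×-dec ¬? (mem? (span₁ u) v))) (∑-* [ Singular? u ] _)
      split : ∀ u → u ≢ 𝟎 × η u ≡ 0# → rest u ℕ.+ q ≡ common u (T u)
      split u (u≢0 , eu) = trans (ℕ.+-comm (rest u) q) (sym (trans (#-subset (common? u (T u)) (mem? (span₁ u)) inside)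
        (cong (ℕ._+ rest u) (size-span₁ u≢0))))
        where
        inside : ∀ y → y ∈ span₁ u → (b u y ≡ 0# × b (T u) y ≡ 0#) × η y ≡ 0#
        inside y y∈ = (TotSing⇒⊥ (span₁ u) ts y∈ u (adjoin-∋ zeroSpace) ,
          (let (a , e) = span₁-elim y∈ in trans (cong (b (T u)) e) (trans (b-scaleʳ a u (T u)) (trans (cong (a *_) (T-alt u)) (zeroʳ a))))) , ts y y∈
          where
          ts : TotSing (span₁ u)
          ts = span₁-TotSing eu

-- Coordinates

odd-prime-power : ∀ {q} → OddPrimePower q → ¬ 2 ∣ q
odd-prime-power (p , k , p-prime , p≢2 , _ , refl) 2∣q = contradict (prime⇒irreducible p-prime (2∣p k 2∣q))
  where
  2∣p : ∀ k → 2 ∣ p ℕ.^ k → 2 ∣ p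
  2∣p zero 2∣1 with ∣1⇒≡1 2∣1
  ... | ()
  2∣p (suc k) d with euclidsLemma p (p ℕ.^ k) prime[2] d
  ... | inj₁ d′ = d′
  ... | inj₂ d′ = 2∣p k d′
  contradict : ¬ (2 ≡ 1 ⊎ 2 ≡ p)
  contradict (inj₁ ())
  contradict (inj₂ e) = p≢2 (sym e)

module _ {q : ℕ} (𝔽 : FiniteField q) where
  open FieldProperties 𝔽 renaming (Carrier to F)

  -- If 1 + 1 = 0 then x ↦ x + 1 is an involution without fixed points, so q is even.
  odd⇒2≢0 : ¬ 2 ∣ q → 1# + 1# ≢ 0#
  odd⇒2≢0 q-odd 1+1≡0 = q-odd (divides (# up?) (begin
    q                          ≡⟨ #-all any-scalar? (λ _ → tt) ⟨
    # any-scalar?              ≡⟨ #-split any-scalar? up? ⟩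
    # (λ x → any-scalar? x ×-dec up? x) ℕ.+ # down?
      ≡⟨ cong₂ ℕ._+_ (#-cong (λ x → any-scalar? x ×-dec up? x) up? (λ _ → proj₂) (λ _ h → tt , h)) (sym flip) ⟩
    # up? ℕ.+ # up?            ≡⟨ lem (# up?) ⟩
    # up? ℕ.* 2                ∎))
    where
    open ≡-Reasoning
    index : F → Fin q
    index = Finite.from F-finite
    up? : Decidable (λ x → index x Fin.< index (x + 1#))
    up? x = index x Fin.<? index (x + 1#)
    any-scalar? : Decidable {A = F} (λ _ → ⊤)
    any-scalar? _ = yes tt
    down? : Decidable (λ x → ⊤ × ¬ index x Fin.< index (x + 1#))
    down? x = any-scalar? x ×-dec ¬? (up? x)
    twice : ∀ x → x + 1# + 1# ≡ x
    twice x = trans (+-assoc x 1# 1#) (trans (cong (x +_) 1+1≡0) (+-identityʳ x))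
    moves : ∀ x → x + 1# ≢ x
    moves x e = 0≢1 (sym (trans (solve 1 (λ x → 𝟙 := x :+ 𝟙 :- x) refl x) (trans (cong (_- x) e) (-‿inverseʳ x))))
    flip : # up? ≡ # down?
    flip = #-bij up? down? (_+ 1#) (_+ 1#)
      (λ x h → tt , λ h′ → Fin.<-asym h (subst (index (x + 1#) Fin.<_) (cong index (twice x)) h′))
      (λ x (_ , h) → subst (index (x + 1#) Fin.<_) (cong index (sym (twice x)))
        (Fin.≤∧≢⇒< (ℕ.≮⇒≥ h) (λ e → moves x (from-injective e))))
      (λ x _ → twice x) (λ x _ → twice x)
    lem : ∀ a → a ℕ.+ a ≡ a ℕ.* 2
    lem = solve-∀

  sumF-cong : ∀ {n} {f g : Fin n → F} → (∀ i → f i ≡ g i) → sumF 𝔽 f ≡ sumF 𝔽 g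
  sumF-cong {zero}  e = refl
  sumF-cong {suc n} e = cong₂ _+_ (e zero) (sumF-cong (e ∘ suc))

  sumF-lin : ∀ {n} a c (f g : Fin n → F) → sumF 𝔽 (λ i → a * f i + c * g i) ≡ a * sumF 𝔽 f + c * sumF 𝔽 g
  sumF-lin {zero}  a c f g = solve 2 (λ a c → 𝟘 := a :* 𝟘 :+ c :* 𝟘) refl a c
  sumF-lin {suc n} a c f g = trans (cong (a * f zero + c * g zero +_) (sumF-lin a c (f ∘ suc) (g ∘ suc)))
    (solve 6 (λ a c f g s t → (a :* f :+ c :* g) :+ (a :* s :+ c :* t) := a :* (f :+ s) :+ c :* (g :+ t)) refl
      a c (f zero) (g zero) (sumF 𝔽 (f ∘ suc)) (sumF 𝔽 (g ∘ suc)))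

  sumF-0 : ∀ n → sumF 𝔽 {n} (λ _ → 0#) ≡ 0#
  sumF-0 zero    = refl
  sumF-0 (suc n) = trans (+-identityˡ _) (sumF-0 n)

  sumF-+ : ∀ {n} (f g : Fin n → F) → sumF 𝔽 (λ i → f i + g i) ≡ sumF 𝔽 f + sumF 𝔽 g
  sumF-+ f g = trans (sumF-cong λ i → sym (cong₂ _+_ (*-identityˡ (f i)) (*-identityˡ (g i))))
    (trans (sumF-lin 1# 1# f g) (cong₂ _+_ (*-identityˡ _) (*-identityˡ _)))

  sumF-* : ∀ {n} a (f : Fin n → F) → sumF 𝔽 (λ i → a * f i) ≡ a * sumF 𝔽 f
  sumF-* {n} a f = trans (sumF-cong λ i → solve 2 (λ a f → a :* f := a :* f :+ 𝟘 :* f) refl a (f i))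
    (trans (sumF-lin a 0# f f) (solve 2 (λ a f → a :* f :+ 𝟘 :* f := a :* f) refl a (sumF 𝔽 f)))

  sumF-swap : ∀ {n l} (f : Fin n → Fin l → F) →
    sumF 𝔽 (λ i → sumF 𝔽 (f i)) ≡ sumF 𝔽 (λ j → sumF 𝔽 (λ i → f i j))
  sumF-swap {zero}  {l} f = sym (sumF-0 l)
  sumF-swap {suc n} {l} f = trans (cong (sumF 𝔽 (f zero) +_) (sumF-swap (f ∘ suc))) (sym (sumF-+ (f zero) _))

  module _ {m : ℕ} where
    open VectorSpace 𝔽 m

    bilinear : (Fin m → Fin m → F) → V → V → F
    bilinear M x y = sumF 𝔽 (λ i → sumF 𝔽 (λ j → M i j * (lookup x i * lookup y j)))

    bilinear-linˡ : ∀ M a x c y z → bilinear M (lin a x c y) z ≡ a * bilinear M x z + c * bilinear M y z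
    bilinear-linˡ M a x c y z = trans (sumF-cong {m} λ i → trans (sumF-cong {m} λ j →
      trans (cong (λ s → M i j * (s * lookup z j)) (lookup-lin a x c y i))
        (solve 6 (λ M a x c y z → M :* ((a :* x :+ c :* y) :* z) := a :* (M :* (x :* z)) :+ c :* (M :* (y :* z))) refl
          (M i j) a (lookup x i) c (lookup y i) (lookup z j)))
      (sumF-lin {m} a c _ _)) (sumF-lin {m} a c _ _)

    bilinear-linʳ : ∀ M z → Linear (bilinear M z)
    bilinear-linʳ M z a x c y = trans (sumF-cong {m} λ i → trans (sumF-cong {m} λ j →
      trans (cong (λ s → M i j * (lookup z i * s)) (lookup-lin a x c y j))
        (solve 6 (λ M a x c y z → M :* (z :* (a :* x :+ c :* y)) := a :* (M :* (z :* x)) :+ c :* (M :* (z :* y))) refl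
          (M i j) a (lookup x j) c (lookup y j) (lookup z i)))
      (sumF-lin {m} a c _ _)) (sumF-lin {m} a c _ _)

    abstract
      vec : Defs.Vec 𝔽 m → V
      vec = tabulate

      lookup-vec : ∀ x i → lookup (vec x) i ≡ x i
      lookup-vec = Vec.lookup∘tabulate

      vec-lookup : ∀ x → vec (lookup x) ≡ x
      vec-lookup = Vec.tabulate∘lookup

    eval-vec : (φ : BilinearForm 𝔽 m) (x y : Defs.Vec 𝔽 m) → BilinearForm.eval φ x y ≡ bilinear (BilinearForm.matrix φ) (vec x) (vec y)
    eval-vec φ x y = sumF-cong {m} λ i → sumF-cong {m} λ j →
      cong₂ (λ s t → BilinearForm.matrix φ i j * (s * t)) (sym (lookup-vec x i)) (sym (lookup-vec y j))

    module _ (η : QuadraticForm 𝔽 m) where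

      upperCoeff : Fin m → Fin m → F
      upperCoeff i j with i Fin.≤? j
      ... | yes _ = QuadraticForm.coeff η i j
      ... | no  _ = 0#

      -- QuadraticForm.eval hides its coefficient function in a where block; this recovers it.
      record Coefficients (x : Defs.Vec 𝔽 m) : Set where
        field
          coefficient : Fin m → Fin m → F
          expansion   : QuadraticForm.eval η x ≡ sumF 𝔽 (λ i → sumF 𝔽 (λ j → coefficient i j * (x i * x j)))

      coefficients : ∀ x → Coefficients x
      coefficients x = record { coefficient = _ ; expansion = refl }

      coefficients-upper : ∀ x i j → Coefficients.coefficient (coefficients x) i j ≡ upperCoeff i j
      coefficients-upper x i j with i Fin.≤? j
      ... | yes _ = refl
      ... | no  _ = refl

      eval-upper : ∀ x → QuadraticForm.eval η x ≡ bilinear upperCoeff (vec x) (vec x)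
      eval-upper x = sumF-cong {m} λ i → sumF-cong {m} λ j → cong₂ _*_ (coefficients-upper x i j)
        (cong₂ _*_ (sym (lookup-vec x i)) (sym (lookup-vec x j)))

      quadratic : V → F
      quadratic x = bilinear upperCoeff x x

      polarForm : V → V → F
      polarForm x y = bilinear upperCoeff x y + bilinear upperCoeff y x

      quadratic-lin : ∀ a x c y → quadratic (lin a x c y) ≡ a * a * quadratic x + a * c * polarForm x y + c * c * quadratic y
      quadratic-lin a x c y = trans (bilinear-linˡ upperCoeff a x c y (lin a x c y)) (trans
        (cong₂ (λ s t → a * s + c * t) (bilinear-linʳ upperCoeff x a x c y) (bilinear-linʳ upperCoeff y a x c y))
        (solve 6 (λ a c xx xy yx yy → a :* (a :* xx :+ c :* xy) :+ c :* (a :* yx :+ c :* yy)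
            := a :* a :* xx :+ a :* c :* (xy :+ yx) :+ c :* c :* yy) refl a c
          (bilinear upperCoeff x x) (bilinear upperCoeff x y) (bilinear upperCoeff y x) (bilinear upperCoeff y y)))

      polarForm-lin : ∀ z → Linear (polarForm z)
      polarForm-lin z a x c y = trans (cong₂ _+_ (bilinear-linʳ upperCoeff z a x c y) (bilinear-linˡ upperCoeff a x c y z))
        (solve 6 (λ a c zx zy xz yz → (a :* zx :+ c :* zy) :+ (a :* xz :+ c :* yz) := a :* (zx :+ xz) :+ c :* (zy :+ yz)) refl a c
          (bilinear upperCoeff z x) (bilinear upperCoeff z y) (bilinear upperCoeff x z) (bilinear upperCoeff y z))

      eval-lookup : ∀ x → QuadraticForm.eval η (lookup x) ≡ quadratic x
      eval-lookup x = trans (eval-upper (lookup x)) (cong quadratic (vec-lookup x))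

      vec-+ : ∀ x y → vec (_+V_ 𝔽 x y) ≡ lin 1# (vec x) 1# (vec y)
      vec-+ x y = ext λ i → trans (lookup-vec _ i) (sym (trans (lookup-lin 1# (vec x) 1# (vec y) i)
        (trans (cong₂ (λ s t → 1# * s + 1# * t) (lookup-vec x i) (lookup-vec y i)) (cong₂ _+_ (*-identityˡ _) (*-identityˡ _)))))

      polar-vec : ∀ x y → QuadraticForm.polar η x y ≡ polarForm (vec x) (vec y)
      polar-vec x y = trans (cong₂ _-_ (cong₂ _-_ (trans (eval-upper _) (trans (cong quadratic (vec-+ x y)) (quadratic-lin 1# (vec x) 1# (vec y))))
          (eval-upper x)) (eval-upper y))
        (solve 3 (λ xx p yy → 𝟙 :* 𝟙 :* xx :+ 𝟙 :* 𝟙 :* p :+ 𝟙 :* 𝟙 :* yy :- xx :- yy := p) refl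
          (quadratic (vec x)) (polarForm (vec x) (vec y)) (quadratic (vec y)))

      quadraticSpace : 1# + 1# ≢ 0# → NonSingular 𝔽 η → QuadraticSpace 𝔽 m
      quadraticSpace 2≢0 nonsingular = record
        { η = quadratic ; b = polarForm ; b-sym = λ x y → +-comm _ _ ; b-lin = polarForm-lin ; η-lin = quadratic-lin
        ; nondegenerate = nondeg ; 2≢0 = 2≢0 }
        where
        nondeg : ∀ x → (∀ y → polarForm x y ≡ 0#) → x ≡ 𝟎
        nondeg x h = ext λ i → trans (nonsingular (lookup x) (trans (eval-lookup x) zero-form) polar-zero i) (sym (lookup-𝟎 i))
          where
          zero-form : quadratic x ≡ 0#
          zero-form = no-zero-divisors (trans (solve 1 (λ t → (𝟙 :+ 𝟙) :* t := t :+ t) refl (quadratic x)) (h x)) 2≢0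
          polar-zero : ∀ y → QuadraticForm.polar η (lookup x) y ≡ 0#
          polar-zero y = trans (polar-vec (lookup x) y) (trans (cong (λ z → polarForm z (vec y)) (vec-lookup x)) (h (vec y)))
    
      -- Coordinates of the functional `polarForm u`; the extremal form must be given by a matrix.
      dual : V → Fin m → F
      dual u i = sumF 𝔽 (λ j → upperCoeff j i * lookup u j + upperCoeff i j * lookup u j)

      polarForm-dual : ∀ u x → polarForm u x ≡ sumF 𝔽 (λ i → dual u i * lookup x i)
      polarForm-dual u x = sym (begin
        sumF 𝔽 (λ i → dual u i * lookup x i)
          ≡⟨ sumF-cong {m} (λ i → trans (*-comm _ _) (trans (sym (sumF-* {m} (lookup x i) _)) (trans (sumF-cong {m} λ j →
               solve 4 (λ x M N u → x :* (M :* u :+ N :* u) := M :* (u :* x) :+ N :* (x :* u)) refl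
                 (lookup x i) (upperCoeff j i) (upperCoeff i j) (lookup u j)) (sumF-+ {m} _ _)))) ⟩
        sumF 𝔽 (λ i → sumF 𝔽 (λ j → upperCoeff j i * (lookup u j * lookup x i)) + sumF 𝔽 (λ j → upperCoeff i j * (lookup x i * lookup u j)))
          ≡⟨ sumF-+ {m} _ _ ⟩
        sumF 𝔽 (λ i → sumF 𝔽 (λ j → upperCoeff j i * (lookup u j * lookup x i))) + bilinear upperCoeff x u
          ≡⟨ cong (_+ bilinear upperCoeff x u) (sumF-swap {m} {m} _) ⟩
        polarForm u x ∎)
        where open ≡-Reasoning

      wedge : V → V → BilinearForm 𝔽 m
      wedge u v = record { matrix = λ i j → dual u i * dual v j - dual v i * dual u j }

      wedge-eval : ∀ u v x y → bilinear (BilinearForm.matrix (wedge u v)) x y ≡ polarForm u x * polarForm v y - polarForm v x * polarForm u y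
      wedge-eval u v x y = begin
        bilinear (BilinearForm.matrix (wedge u v)) x y
          ≡⟨ sumF-cong {m} (λ i → trans (sumF-cong {m} λ j →
               solve 6 (λ a c d e x y → (a :* c :- d :* e) :* (x :* y) := (a :* x) :* (c :* y) :+ (:- (d :* x)) :* (e :* y)) refl
                 (dual u i) (dual v j) (dual v i) (dual u j) (lookup x i) (lookup y j))
               (sumF-lin {m} (dual u i * lookup x i) (- (dual v i * lookup x i)) (λ j → dual v j * lookup y j) (λ j → dual u j * lookup y j))) ⟩
        sumF 𝔽 (λ i → (dual u i * lookup x i) * sv + (- (dual v i * lookup x i)) * su)
          ≡⟨ sumF-cong {m} (λ i → solve 4 (λ a d s t → a :* s :+ (:- d) :* t := s :* a :+ (:- t) :* d) refl (dual u i * lookup x i) (dual v i * lookup x i) sv su) ⟩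
        sumF 𝔽 (λ i → sv * (dual u i * lookup x i) + (- su) * (dual v i * lookup x i))
          ≡⟨ sumF-lin {m} sv (- su) _ _ ⟩
        sv * sumF 𝔽 (λ i → dual u i * lookup x i) + (- su) * sumF 𝔽 (λ i → dual v i * lookup x i)
          ≡⟨ cong₂ _+_ (cong₂ _*_ (polarForm-dual v y) (polarForm-dual u x)) (cong₂ (λ s t → (- s) * t) (polarForm-dual u y) (polarForm-dual v x)) ⟨
        polarForm v y * polarForm u x + (- polarForm u y) * polarForm v x
          ≡⟨ solve 4 (λ a c d e → a :* c :+ (:- d) :* e := c :* a :- e :* d) refl (polarForm v y) (polarForm u x) (polarForm u y) (polarForm v x) ⟩
        polarForm u x * polarForm v y - polarForm v x * polarForm u y ∎
        where
        open ≡-Reasoning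
        su = sumF 𝔽 (λ j → dual u j * lookup y j)
        sv = sumF 𝔽 (λ j → dual v j * lookup y j)

-- Representation of linear functionals by the polar form

module Riesz {q : ℕ} {𝔽 : FiniteField q} {m : ℕ} (S : QuadraticSpace 𝔽 m) where
  open FieldProperties 𝔽 renaming (Carrier to F)
  open VectorSpace 𝔽 m
  open QuadraticSpace S
  open Forms S

  b-injective : ∀ {x y} → (∀ z → b x z ≡ b y z) → x ≡ y
  b-injective {x} {y} h = difference-zero (nondegenerate _ λ z → trans (b-linˡ 1# x (- 1#) y z)
    (trans (cong (λ s → 1# * s + - 1# * b y z) (h z)) (solve 1 (λ t → 𝟙 :* t :+ (:- 𝟙) :* t := 𝟘) refl (b y z))))

  -- The orthogonal of a hyperplane ker f is a line, and a suitable multiple of its generator represents f.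
  representable : ∀ {f} → Linear f → ∃[ w ] (∀ y → b w y ≡ f y)
  representable {f} f-lin = decide (any? (λ x → ¬? (f x ≟ 0#)))
    where
    H = full ∩ kernel f f-lin
    decide : Dec (∃[ x ] (f x ≢ 0#)) → ∃[ w ] (∀ y → b w y ≡ f y)
    decide (no none) = 𝟎 , λ y → trans (b-sym 𝟎 y) (trans (linear-0 (b-lin y)) (sym (decidable-stable (f y ≟ 0#) (λ ne → none (y , ne)))))
    decide (yes (x , fx≢0)) = lin c w 0# w , represents
      where
      qH : q ℕ.* size H ≡ q ℕ.^ m
      qH = trans (size-kernel full f-lin tt fx≢0) size-full
      size-H⊥ : size (H ⊥) ≡ q
      size-H⊥ = ℕ.*-cancelˡ-≡ _ _ (size H) {{ℕ.>-nonZero (size-pos H)}} (trans (size-⊥ H) (trans (sym qH) (ℕ.*-comm q (size H))))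
      generator : ∃[ w ] (w ∈ H ⊥ × w ≢ 𝟎)
      generator = search (λ w → mem? (H ⊥) w ×-dec ¬? (w ≟ 𝟎)) λ none →
        ℕ.<-irrefl (sym (trans (sym size-H⊥) (#-one (mem? (H ⊥)) 𝟎 (zero∈ (H ⊥)) (λ w w∈ → decidable-stable (w ≟ 𝟎) λ ne → none w (w∈ , ne))))) 1<q
      w = proj₁ generator
      w⊥ : w ∈ H ⊥
      w⊥ = proj₁ (proj₂ generator)
      s = proj₁ (inverse (f x) fx≢0)
      fx*s : f x * s ≡ 1#
      fx*s = proj₂ (inverse (f x) fx≢0)
      proportional : ∀ y → b w y ≡ f y * s * b w x
      proportional y = a-b≡0⇒a≡b (trans (solve 3 (λ wy k wx → wy :- k :* wx := 𝟙 :* wy :+ (:- k) :* wx) refl (b w y) (f y * s) (b w x))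
        (trans (sym (b-lin w 1# y (- (f y * s)) x)) (trans (b-sym w _) (w⊥ _ (tt , trans (f-lin 1# y (- (f y * s)) x)
          (trans (solve 3 (λ y s x → 𝟙 :* y :+ (:- (y :* s)) :* x := y :- y :* (x :* s)) refl (f y) s (f x))
            (trans (cong (λ t → f y - f y * t) fx*s) (solve 1 (λ y → y :- y :* 𝟙 := 𝟘) refl (f y)))))))))
      wx≢0 : b w x ≢ 0#
      wx≢0 e = proj₂ (proj₂ generator) (nondegenerate w λ y → trans (proportional y) (trans (cong (f y * s *_) e) (zeroʳ _)))
      r = proj₁ (inverse (b w x) wx≢0)
      c = f x * r
      represents : ∀ y → b (lin c w 0# w) y ≡ f y
      represents y = trans (b-linˡ c w 0# w y) (trans (cong (λ t → c * t + 0# * t) (proportional y))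
        (trans (solve 5 (λ x r y s t → x :* r :* (y :* s :* t) :+ 𝟘 :* (y :* s :* t) := y :* (x :* s) :* (t :* r)) refl (f x) r (f y) s (b w x))
          (trans (cong₂ (λ u v → f y * u * v) fx*s (proj₂ (inverse (b w x) wx≢0))) (solve 1 (λ y → y :* 𝟙 :* 𝟙 := y) refl (f y)))))

-- Translation between the forms and bases of the statement and quadratic spaces

module Bridge {q : ℕ} (𝔽 : FiniteField q) (k : ℕ) (η₀ : QuadraticForm 𝔽 (2 ℕ.* suc k ℕ.+ 1))
  (char≢2 : FiniteField._+_ 𝔽 (FiniteField.1# 𝔽) (FiniteField.1# 𝔽) ≢ FiniteField.0# 𝔽) (nonsingular : NonSingular 𝔽 η₀) where

  abstract
    space : QuadraticSpace 𝔽 (2 ℕ.* suc k ℕ.+ 1)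
    space = quadraticSpace 𝔽 η₀ char≢2 nonsingular

    η-space : ∀ x → QuadraticSpace.η space x ≡ quadratic 𝔽 η₀ x
    η-space x = refl

    b-space : ∀ x y → QuadraticSpace.b space x y ≡ polarForm 𝔽 η₀ x y
    b-space x y = refl

  open Parabolic k space
  open Riesz space

  vecₘ : Defs.Vec 𝔽 m → V
  vecₘ = vec 𝔽

  vec-lin : ∀ a c x y z → (∀ i → z i ≡ a * x i + c * y i) → vecₘ z ≡ lin a (vecₘ x) c (vecₘ y)
  vec-lin a c x y z e = ext λ i → trans (lookup-vec 𝔽 z i) (trans (e i) (sym (trans (lookup-lin a (vecₘ x) c (vecₘ y) i)
    (cong₂ (λ s t → a * s + c * t) (lookup-vec 𝔽 x i) (lookup-vec 𝔽 y i)))))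

  vec-lin⁻ : ∀ a c x y z → vecₘ z ≡ lin a (vecₘ x) c (vecₘ y) → ∀ i → z i ≡ a * x i + c * y i
  vec-lin⁻ a c x y z e i = trans (sym (lookup-vec 𝔽 z i)) (trans (cong (λ v → lookup v i) e) (trans (lookup-lin a (vecₘ x) c (vecₘ y) i)
    (cong₂ (λ s t → a * s + c * t) (lookup-vec 𝔽 x i) (lookup-vec 𝔽 y i))))

  ∈⟨⟩⇒span : ∀ {x u v} → _∈⟨_,_⟩ 𝔽 x u v → vecₘ x ∈ span₂ (vecₘ u) (vecₘ v)
  ∈⟨⟩⇒span {x} {u} {v} (a , c , e) = subst (_∈ span₂ (vecₘ u) (vecₘ v)) (sym (vec-lin a c u v x e))
    (lin∈ (span₂ (vecₘ u) (vecₘ v)) a c span₂-∋ˡ span₂-∋ʳ)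

  span⇒∈⟨⟩ : ∀ {x u v} → vecₘ x ∈ span₂ (vecₘ u) (vecₘ v) → _∈⟨_,_⟩ 𝔽 x u v
  span⇒∈⟨⟩ {x} {u} {v} x∈ = let (a , c , e) = span₂-elim x∈ in a , c , vec-lin⁻ a c u v x e

  module WithForm (φ : BilinearForm 𝔽 m) (T : V → V)
    (T-lin : ∀ a x c y → T (lin a x c y) ≡ lin a (T x) c (T y))
    (T-alt : ∀ x → b (T x) x ≡ 0#)
    (φ-T : ∀ x y → bilinear 𝔽 (BilinearForm.matrix φ) x y ≡ b (T x) y) where
    open IsotropicLines k space T T-lin T-alt

    vecs : Defs.Vec 𝔽 m × Defs.Vec 𝔽 m → V × V
    vecs (u , v) = vecₘ u , vecₘ v

    SameSpan⇒∼ : ∀ x y → SameSpan 𝔽 x y → vecs x ∼ vecs y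
    SameSpan⇒∼ (u , v) (u′ , v′) ((a₁ , a₂) , (a₃ , a₄)) = (∈⟨⟩⇒span a₃ , ∈⟨⟩⇒span a₄) , (∈⟨⟩⇒span a₁ , ∈⟨⟩⇒span a₂)

    ∼⇒SameSpan : ∀ x y → vecs x ∼ vecs y → SameSpan 𝔽 x y
    ∼⇒SameSpan (u , v) (u′ , v′) ((a₃ , a₄) , (a₁ , a₂)) = (span⇒∈⟨⟩ a₁ , span⇒∈⟨⟩ a₂) , (span⇒∈⟨⟩ a₃ , span⇒∈⟨⟩ a₄)

    good : (g : GoodBasis 𝔽 η₀ φ) → Good (vecs (proj₁ g))
    good ((u , v) , indep , ts , ti) = (u≢0 , ηu) , ((uv , Tuv) , ηv) , v∉
      where
      u∈ : _∈⟨_,_⟩ 𝔽 u u v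
      u∈ = 1# , 0# , λ i → solve 2 (λ x y → x := 𝟙 :* x :+ 𝟘 :* y) refl (u i) (v i)
      v∈ : _∈⟨_,_⟩ 𝔽 v u v
      v∈ = 0# , 1# , λ i → solve 2 (λ x y → y := 𝟘 :* x :+ 𝟙 :* y) refl (u i) (v i)
      sum : Defs.Vec 𝔽 m
      sum i = 1# * u i + 1# * v i
      η-vec : ∀ x → _∈⟨_,_⟩ 𝔽 x u v → η (vecₘ x) ≡ 0#
      η-vec x x∈ = trans (η-space (vecₘ x)) (trans (sym (eval-upper 𝔽 η₀ x)) (ts x x∈))
      ηu : η (vecₘ u) ≡ 0#
      ηu = η-vec u u∈
      ηv : η (vecₘ v) ≡ 0#
      ηv = η-vec v v∈
      uv : b (vecₘ u) (vecₘ v) ≡ 0#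
      uv = polarise ηu ηv (trans (cong η (sym (vec-lin 1# 1# u v sum (λ _ → refl)))) (η-vec sum (1# , 1# , λ _ → refl)))
      Tuv : b (T (vecₘ u)) (vecₘ v) ≡ 0#
      Tuv = trans (sym (φ-T (vecₘ u) (vecₘ v))) (trans (sym (eval-vec 𝔽 φ u v)) (ti u v u∈ v∈))
      entry : ∀ x i → lookup (vecₘ x) i ≡ x i
      entry x i = lookup-vec 𝔽 x i
      u≢0 : vecₘ u ≢ 𝟎
      u≢0 e = 0≢1 (sym (proj₁ (indep 1# 0# λ i → trans (solve 2 (λ x y → 𝟙 :* x :+ 𝟘 :* y := x) refl (u i) (v i))
        (trans (sym (entry u i)) (trans (cong (λ z → lookup z i) e) (lookup-𝟎 i))))))
      v∉ : ¬ vecₘ v ∈ span₁ (vecₘ u)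
      v∉ v∈u = let (a , e) = span₁-elim v∈u in 0≢1 (sym (proj₂ (indep (- a) 1# λ i →
        trans (cong (λ z → - a * u i + 1# * z) (vec-lin⁻ a 0# u u v e i))
          (solve 2 (λ a x → (:- a) :* x :+ 𝟙 :* (a :* x :+ 𝟘 :* x) := 𝟘) refl a (u i)))))

    vecₘ-lookup : (x : V) → vecₘ (lookup x) ≡ x
    vecₘ-lookup = vec-lookup 𝔽

    goodBasis : ∀ x → Good x → GoodBasis 𝔽 η₀ φ
    goodBasis (x , y) g@((x≢0 , ex) , ((xy , _) , ey) , y∉) = (lookup x , lookup y) , indep , ts , ti
      where
      transport : ∀ z → _∈⟨_,_⟩ 𝔽 z (lookup x) (lookup y) → vecₘ z ∈ span₂ x y
      transport z (a , c , e) = subst (_∈ span₂ x y)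
        (sym (ext λ i → trans (lookup-vec 𝔽 z i) (trans (e i) (sym (lookup-lin a x c y i)))))
        (lin∈ (span₂ x y) a c span₂-∋ˡ span₂-∋ʳ)
      indep : LinIndep 𝔽 (lookup x) (lookup y)
      indep a c e = a≡0 , c≡0
        where
        relation : lin a x c y ≡ 𝟎
        relation = ext λ i → trans (lookup-lin a x c y i) (trans (e i) (sym (lookup-𝟎 i)))
        c≡0 : c ≡ 0#
        c≡0 = decidable-stable (c ≟ 0#) λ c≢0 → let (d , cd) = inverse c c≢0 in y∉ (subst (_∈ span₁ x) (sym (solved d cd)) (span₁-intro (- (a * d))))
          where
          solved : ∀ d → c * d ≡ 1# → y ≡ lin (- (a * d)) x 0# x
          solved d cd = ext λ i → trans (trans (sym (*-identityˡ _)) (trans (cong (_* lookup y i) (sym cd))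
            (trans (solve 5 (λ a c d x y → c :* d :* y := d :* (a :* x :+ c :* y) :+ ((:- (a :* d)) :* x :+ 𝟘 :* x)) refl a c d (lookup x i) (lookup y i))
              (trans (cong (λ s → d * s + (- (a * d) * lookup x i + 0# * lookup x i)) (e i))
                (solve 2 (λ d t → d :* 𝟘 :+ t := t) refl d (- (a * d) * lookup x i + 0# * lookup x i))))))
            (sym (lookup-lin (- (a * d)) x 0# x i))
        a≡0 : a ≡ 0#
        a≡0 = decidable-stable (a ≟ 0#) λ a≢0 → x≢0 (scale-zero a≢0 (ext λ i → trans (lookup-lin a x 0# x i)
          (trans (solve 3 (λ a x y → a :* x :+ 𝟘 :* x := a :* x :+ 𝟘 :* y) refl a (lookup x i) (lookup y i))
            (trans (cong (λ s → a * lookup x i + s * lookup y i) (sym c≡0)) (trans (e i) (sym (lookup-𝟎 i)))))))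
      ts : TotallySingular 𝔽 η₀ (lookup x) (lookup y)
      ts z z∈ = trans (eval-upper 𝔽 η₀ z) (trans (sym (η-space (vecₘ z))) (span₂-TotSing ex ey xy (vecₘ z) (transport z z∈)))
      ti : TotallyIsotropic 𝔽 φ (lookup x) (lookup y)
      ti z w z∈ w∈ = trans (eval-vec 𝔽 φ z w) (trans (φ-T (vecₘ z) (vecₘ w)) (isotropic g (transport z z∈) (transport w w∈)))

    lineOf : GoodBasis 𝔽 η₀ φ → Fin number
    lineOf g = proj₁ (class (vecs (proj₁ g)) tt (good g))

    lineOf-∼ : ∀ g → vecs (proj₁ g) ∼ rep (lineOf g)
    lineOf-∼ g = proj₂ (class (vecs (proj₁ g)) tt (good g))

    lineOf-cong : ∀ g g′ → SameSpan 𝔽 (proj₁ g) (proj₁ g′) → lineOf g ≡ lineOf g′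
    lineOf-cong g g′ e = distinct (lineOf g) (lineOf g′) (∼-trans (rep (lineOf g)) _ _ (∼-sym _ (rep (lineOf g)) (lineOf-∼ g))
      (∼-trans (vecs (proj₁ g)) _ (rep (lineOf g′)) (SameSpan⇒∼ _ _ e) (lineOf-∼ g′)))

    lineOf-injective : ∀ g g′ → lineOf g ≡ lineOf g′ → SameSpan 𝔽 (proj₁ g) (proj₁ g′)
    lineOf-injective g g′ e = ∼⇒SameSpan _ _ (∼-trans (vecs (proj₁ g)) (rep (lineOf g′)) _
      (subst (λ i → vecs (proj₁ g) ∼ rep i) e (lineOf-∼ g)) (∼-sym (vecs (proj₁ g′)) (rep (lineOf g′)) (lineOf-∼ g′)))

    lineOf-surjective : ∀ i → ∃[ g ] (lineOf g ≡ i)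
    lineOf-surjective i = g , distinct (lineOf g) i (∼-sym (rep i) (rep (lineOf g))
        (subst (_∼ rep (lineOf g)) (cong₂ _,_ (vecₘ-lookup (proj₁ (rep i))) (vecₘ-lookup (proj₂ (rep i)))) (lineOf-∼ g)))
      where g = goodBasis (rep i) (rep-good i)

    atMost : ∀ {N} → number ℕ.≤ N → AtMost 𝔽 η₀ φ N
    atMost le = (λ g → Fin.inject≤ (lineOf g) le) , (λ g g′ e → cong (λ i → Fin.inject≤ i le) (lineOf-cong g g′ e)) ,
      (λ g g′ e → lineOf-injective g g′ (Fin.inject≤-injective le le _ _ e))

    exactly : ∀ {N} → number ≡ N → Exactly 𝔽 η₀ φ N
    exactly refl = lineOf , lineOf-cong , lineOf-injective , lineOf-surjective

  module FromForm (φ : BilinearForm 𝔽 m) (alternating : Alternating 𝔽 φ) where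
    private
      M = BilinearForm.matrix φ

    abstract
      T : V → V
      T x = proj₁ (representable (bilinear-linʳ 𝔽 M x))

      φ-T : ∀ x y → bilinear 𝔽 M x y ≡ b (T x) y
      φ-T x y = sym (proj₂ (representable (bilinear-linʳ 𝔽 M x)) y)

    T-alt : ∀ x → b (T x) x ≡ 0#
    T-alt x = trans (sym (φ-T x x)) (alternating (lookup x))

    -- T is chosen vector by vector; its linearity follows from the uniqueness of the representing
    -- vector.
    T-lin : ∀ a x c y → T (lin a x c y) ≡ lin a (T x) c (T y)
    T-lin a x c y = b-injective λ z → trans (sym (φ-T _ z)) (trans (bilinear-linˡ 𝔽 M a x c y z)
      (trans (cong₂ (λ s t → a * s + c * t) (φ-T x z) (φ-T y z)) (sym (b-linˡ a (T x) c (T y) z))))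

    T-nonzero : NonZeroForm 𝔽 φ → ∃[ x ] (T x ≢ 𝟎)
    T-nonzero (x , y , ne) = vecₘ x , λ e → ne (trans (eval-vec 𝔽 φ x y) (trans (φ-T (vecₘ x) (vecₘ y))
      (trans (cong (λ z → b z (vecₘ y)) e) (trans (b-sym 𝟎 _) (linear-0 (b-lin _))))))

-- From pair counts back to numbers of lines

module Conclusion {q : ℕ} (𝔽 : FiniteField q) (k : ℕ) (η₀ : QuadraticForm 𝔽 (2 ℕ.* suc (suc k) ℕ.+ 1))
  (char≢2 : FiniteField._+_ 𝔽 (FiniteField.1# 𝔽) (FiniteField.1# 𝔽) ≢ FiniteField.0# 𝔽) (nonsingular : NonSingular 𝔽 η₀)
  (fmax : ℕ) (fmax-eq : fmax ℕ.* fmax-denom q ≡ fmax-numer q (suc (suc k))) where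

  open Bridge 𝔽 (suc k) η₀ char≢2 nonsingular
  open Parabolic (suc k) space

  bound : ℕ
  bound = maxTotal p Q₁ (# Singular?)

  bases : ℕ
  bases = (q ℕ.* q ℕ.∸ 1) ℕ.* (q ℕ.* q ℕ.∸ q)

  fmax-bound : fmax ℕ.* bases ℕ.+ # Singular? ℕ.* q ≡ bound
  fmax-bound = go (field-size 𝔽) refl
    where
    sizes : suc (# Singular?) ≡ q ℕ.* (q ℕ.* (Q ℕ.* Q))
    sizes = trans (cong suc (#-cong Singular? (λ x → Singular? x ×-dec mem? full x) (λ _ s → s , tt) (λ _ → proj₁)))
      (trans (sym (singular-nonzero (mem? full) tt)) zeros-full)
    go : (s : ∃[ p ] (q ≡ suc (suc p))) → s ≡ field-size 𝔽 → fmax ℕ.* bases ℕ.+ # Singular? ℕ.* q ≡ bound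
    go (p′ , e) refl = generalise q e (# Singular?) sizes fmax-eq
      where
      -- The field 𝔽 depends on q, so q cannot be replaced by `suc (suc p′)` in place; the purely
      -- numerical claim is stated for a fresh q first.
      generalise : ∀ q → q ≡ suc (suc p′) → ∀ N → suc N ≡ q ℕ.* (q ℕ.* (q ℕ.^ suc k ℕ.* q ℕ.^ suc k)) →
        fmax ℕ.* fmax-denom q ≡ fmax-numer q (suc (suc k)) →
        let Q₁ = ℕ.pred (q ℕ.^ suc k) in
        fmax ℕ.* ((q ℕ.* q ℕ.∸ 1) ℕ.* (q ℕ.* q ℕ.∸ q)) ℕ.+ N ℕ.* q
          ≡ maxTotal (suc p′) Q₁ N
      generalise .(suc (suc p′)) refl N = fmax-arithmetic p′ k N fmax

  bases-nonZero : ℕ.NonZero bases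
  bases-nonZero = ℕ.m*n≢0 (q ℕ.* q ℕ.∸ 1) (q ℕ.* q ℕ.∸ q) {{ℕ.>-nonZero (ℕ.m<n⇒0<n∸m (ℕ.<-≤-trans 1<q (ℕ.m≤m*n q q)))}}
    {{ℕ.>-nonZero (ℕ.m<n⇒0<n∸m (ℕ.m<m*n q q 1<q))}}

  -- The pair count is `number` times `bases` plus the same correction `# Singular? * q` that occurs
  -- in `fmax-bound`; cancelling the correction and then `bases` compares the numbers of lines.
  upper : (φ : BilinearForm 𝔽 m) → Alternating 𝔽 φ → NonZeroForm 𝔽 φ → AtMost 𝔽 η₀ φ fmax
  upper φ alternating nonzero = WithForm.atMost φ T T-lin T-alt φ-T
    (ℕ.*-cancelʳ-≤ number fmax bases {{bases-nonZero}} (ℕ.+-cancelʳ-≤ (# Singular? ℕ.* q) _ _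
      (ℕ.≤-trans (ℕ.≤-reflexive total-lines) (ℕ.≤-trans total-bound (ℕ.≤-reflexive (sym fmax-bound))))))
    where
    open FromForm φ alternating
    open IsotropicLines (suc k) space T T-lin T-alt using (number; total-lines)
    open UpperBound (suc k) (ℕ.s≤s ℕ.z≤n) space T T-lin T-alt (proj₁ (T-nonzero nonzero)) (proj₂ (T-nonzero nonzero)) using (total-bound)

  attained : ∃[ φ ] (Alternating 𝔽 φ × NonZeroForm 𝔽 φ × Exactly 𝔽 η₀ φ fmax)
  attained = φ , alternating , nonzero , WithForm.exactly φ T T-lin T-alt φ-T
    (ℕ.*-cancelʳ-≡ number fmax bases {{bases-nonZero}} (ℕ.+-cancelʳ-≡ (# Singular? ℕ.* q) _ _
      (trans total-lines (trans total (sym fmax-bound)))))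
    where
    open Extremal (suc k) space using (u; v; T; b-T; T-lin; T-alt; Tv≢0; total)
    open IsotropicLines (suc k) space T T-lin T-alt using (number; total-lines)
    φ : BilinearForm 𝔽 m
    φ = wedge 𝔽 η₀ u v
    φ-T : ∀ x y → bilinear 𝔽 (BilinearForm.matrix φ) x y ≡ b (T x) y
    φ-T x y = trans (wedge-eval 𝔽 η₀ u v x y) (sym (trans (b-T x y)
      (cong₂ _-_ (cong₂ _*_ (b-space u x) (b-space v y)) (cong₂ _*_ (b-space v x) (b-space u y)))))
    alternating : Alternating 𝔽 φ
    alternating x = trans (eval-vec 𝔽 φ x x) (trans (φ-T (vecₘ x) (vecₘ x)) (T-alt (vecₘ x)))
    nonzero : NonZeroForm 𝔽 φ
    nonzero = let (y , _ , ne) = ¬⊥⇒witness full (λ Tv∈ → Tv≢0 (full⊥ Tv∈)) in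
      lookup v , lookup y , λ e → ne (trans (sym (φ-T v y)) e)

theorem3p1 : (q : ℕ) → OddPrimePower q → (𝔽 : FiniteField q) →
    (n : ℕ) → n ≥ 2 →
    (η : QuadraticForm 𝔽 (2 ℕ.* n ℕ.+ 1)) → NonSingular 𝔽 η →
    (fmax : ℕ) → fmax ℕ.* fmax-denom q ≡ fmax-numer q n →
    ((φ : BilinearForm 𝔽 (2 ℕ.* n ℕ.+ 1)) → Alternating 𝔽 φ → NonZeroForm 𝔽 φ →
    AtMost 𝔽 η φ fmax)
    × (∃[ φ ] (Alternating 𝔽 φ × NonZeroForm 𝔽 φ × Exactly 𝔽 η φ fmax))
theorem3p1 q q-odd 𝔽 (suc (suc k)) (ℕ.s≤s (ℕ.s≤s ℕ.z≤n)) η nonsingular fmax fmax-eq = upper , attained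
  where open Conclusion 𝔽 k η (odd⇒2≢0 𝔽 (odd-prime-power q-odd)) nonsingular fmax fmax-eq
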